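{- The parameterized problem $P_2$-packing (parameter $k$) admits a kernel with at most $7k$ vertices.
   Context: $P_2$-packing: given an undirected graph $G$ and an integer $k$, decide whether $G$ contains $k$ pairwise vertex-disjoint paths with three vertices and two edges ($P_2$'s). A kernel with at most $f(k)$ vertices is a polynomial-time algorithm that maps any instance $(G,k)$ to an equivalent instance $(G',k')$ (i.e., $(G,k)$ is a yes-instance iff $(G',k')$ is) with $k'\le k$ and $|V(G')|\le f(k)$. -}

module Defs where

open import Data.Nat using (ℕ; zero; suc; _+_; _*_; _^_; _≤_)
open import Data.Fin using (Fin; zero; suc)
open import Data.Bool using (Bool; true; false)
open import Data.Maybe using (Maybe; just; nothing)
open import Data.List using (List; []; _∷_; _++_; map; concatMap; replicate; allFin; length)
open import Data.Product using (Σ; _×_; _,_)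
open import Relation.Binary.PropositionalEquality using (_≡_)
open import Function.Bundles using (_⇔_)

record Graph : Set where
  field
    n      : ℕ
    adj    : Fin n → Fin n → Bool
    sym    : ∀ i j → adj i j ≡ adj j i
    irrefl : ∀ i → adj i i ≡ false
open Graph public

-- a P₂ given by its three vertices p 0 - p 1 - p 2 (p 1 is the middle vertex);
-- distinctness of the three vertices is enforced by the packing injectivity
IsP₂ : (G : Graph) → (Fin 3 → Fin (n G)) → Set
IsP₂ G p = (adj G (p zero) (p (suc zero)) ≡ true)
         × (adj G (p (suc zero)) (p (suc (suc zero))) ≡ true)

HasP₂Packing : Graph → ℕ → Set
HasP₂Packing G k =
  Σ (Fin k → Fin 3 → Fin (n G)) λ f →
    (∀ i → IsP₂ G (f i))
    × (∀ i a j b → f i a ≡ f j b → (i ≡ j) × (a ≡ b))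

unary : ℕ → List Bool
unary m = replicate m true ++ (false ∷ [])

encode : Graph → ℕ → List Bool
encode G k =
  unary (n G)
  ++ concatMap (λ i → map (adj G i) (allFin (n G))) (allFin (n G))
  ++ unary k

Sym : Set
Sym = Maybe Bool   -- nothing = blank

data Move : Set where
  L R S : Move

-- Q states, start state zero; δ returning nothing means "halt"
record TM : Set where
  field
    q : ℕ
    δ : Fin (suc q) → Sym → Maybe (Fin (suc q) × Sym × Move)
open TM public

record Config (M : TM) : Set where
  constructor cfg
  field
    state : Fin (suc (q M))
    left  : List Sym   -- cells left of the head, nearest first
    head  : Sym
    right : List Sym   -- cells right of the head, nearest first

moveL : ∀ {M} → Fin (suc (q M)) → List Sym → Sym → List Sym → Config M
moveL s []       h r = cfg s [] nothing (h ∷ r)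
moveL s (x ∷ l)  h r = cfg s l x (h ∷ r)

moveR : ∀ {M} → Fin (suc (q M)) → List Sym → Sym → List Sym → Config M
moveR s l h []       = cfg s (h ∷ l) nothing []
moveR s l h (x ∷ r)  = cfg s (h ∷ l) x r

step : (M : TM) → Config M → Maybe (Config M)
step M (cfg s l h r) with δ M s h
... | nothing = nothing
... | just (s' , w , L) = just (moveL {M} s' l w r)
... | just (s' , w , R) = just (moveR {M} s' l w r)
... | just (s' , w , S) = just (cfg s' l w r)

exec : (M : TM) → ℕ → Config M → Maybe (Config M)
exec M t c with step M c
exec M t       c | nothing = just c
exec M zero    c | just _  = nothing
exec M (suc t) c | just c' = exec M t c'

initial : (M : TM) → List Bool → Config M
initial M []      = cfg zero [] nothing []
initial M (b ∷ w) = cfg zero [] (just b) (map just w)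

readOut : Sym → List Sym → List Bool
readOut nothing  _        = []
readOut (just b) []       = b ∷ []
readOut (just b) (s ∷ ss) = b ∷ readOut s ss

output : ∀ {M} → Config M → List Bool
output (cfg _ _ h r) = readOut h r

RunsTo : (M : TM) → List Bool → ℕ → List Bool → Set
RunsTo M w t v = Σ (Config M) λ c → (exec M t (initial M w) ≡ just c) × (output c ≡ v)

P₂PackingKernel : (ℕ → ℕ) → Set
P₂PackingKernel f =
  Σ TM λ M → Σ ℕ λ c → Σ ℕ λ d →
    ∀ (G : Graph) (k : ℕ) →
      Σ Graph λ G' → Σ ℕ λ k' →
        RunsTo M (encode G k) (c * length (encode G k) ^ d + c) (encode G' k')
        × (HasP₂Packing G k ⇔ HasP₂Packing G' k')
        × (k' ≤ k)
        × (n G' ≤ f k)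

{-# OPTIONS --safe #-}
-- Mathematics.  Start from a packing by classes (3-sets spanning a path) and improve it: add a path lying outside, split a class
-- into two using outside vertices, or exchange one vertex of a class so that more edges lie outside.  In a local optimum
-- everything outside consists of isolated vertices and K₂'s, and any two vertices of a class see the same isolated vertex,
-- respectively the same K₂.  Let every packing vertex offer one slot to a K₂ and two slots to isolated vertices, and let the
-- outside components bid for slots, always taking a cheapest adjacent one and raising its price by one.  If a component stays
-- without a slot, some price l+1 ≤ n does not occur; the vertices owning a slot dearer than l, together with the components
-- holding such slots or none, form a crown, which is removed while k drops by the number of those vertices.  What remains of
-- a class is charged at most its three vertices, two isolated vertices and one K₂: seven vertices per class.  With more than
-- k classes the instance is trivial.
--
-- Computation.  The tape is rewritten by repeated left-to-right sweeps of a finite transducer, each simulated in quadratic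
-- time.  The input bits become blocks with room for finitely many relations on the vertices and for marks of the values of
-- finitely many vertex variables; every primitive step of a program with vertex loops is then a single sweep, and nested
-- loops give polynomial time.  Deleting the blocks of removed vertices turns the input string into the encoding of the kernel.
module Submission where

open import Data.Bool using (Bool; true; false; if_then_else_; _∧_; _∨_; T; not)
open import Data.Bool.Properties using (∨-identityʳ; ∧-zeroʳ; ∧-identityʳ; ∨-assoc; ∨-zeroʳ; T?)
open import Data.Empty using (⊥; ⊥-elim)
open import Data.Fin as Fin using (Fin; zero; suc; combine; remQuot; toℕ; fromℕ<; _↑ˡ_; _↑ʳ_; inject≤; splitAt; join)
open import Data.Fin.Patterns
open import Data.Fin.Properties using (remQuot-combine; toℕ<n; toℕ-injective; fromℕ<-injective; toℕ-fromℕ<; toℕ-combine; any?; ↑ˡ-injective; ↑ʳ-injective; inject≤-injective; join-splitAt; pigeonhole)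
open import Data.List using (List; []; _∷_; _++_; length; _ʳ++_; reverse; mapMaybe; concatMap; tabulate; concat; allFin; filterᵇ; filter; cartesianProduct)
open import Data.List.Membership.Propositional using (_∈_)
open import Data.List.Membership.Propositional.Properties using (∈-allFin; ∈-cartesianProduct⁺; ∈-∃++; ∈-++⁻; ∈-++⁺ˡ; ∈-++⁺ʳ; ∈-filter⁺; ∈-filter⁻; ∈-lookup)
open import Data.List.Properties using (++-assoc; ++-identityʳ; length-++; ʳ++-ʳ++; ++-ʳ++; ʳ++-defn; map-ʳ++; map-++; length-reverse; length-mapMaybe; map-tabulate; length-replicate; tabulate-lookup; concat-map; map-cong; mapMaybe-++; length-filter; length-tabulate; length-map)
open import Data.List.Relation.Unary.Any using (here; there; index)
open import Data.List.Relation.Unary.Unique.Propositional using (Unique)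
open import Data.List.Relation.Unary.Unique.Propositional.Properties using (allFin⁺; filter⁺)
open import Data.Maybe using (Maybe; just; nothing)
open import Data.Nat
open import Data.Nat.Properties
open import Data.Nat.Tactic.RingSolver using (solve-∀)
open import Data.Product using (_×_; _,_; proj₁; proj₂; ∃-syntax)
open import Data.Sum using (_⊎_; inj₁; inj₂; [_,_]′)
open import Data.Unit using (⊤; tt)
open import Function using (_∘_; id)
open import Function.Bundles using (_⇔_; mk⇔)
open import Relation.Binary.Definitions using (tri<; tri≈; tri>)
open import Relation.Binary.PropositionalEquality
open import Relation.Nullary using (contradiction; ¬_; Dec; yes; no; does)
open import Relation.Nullary.Decidable using (_×-dec_; _⊎-dec_; ¬?; decidable-stable)
open import Relation.Unary using (Decidable)
import Data.Bool.Properties as Bool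

-- The auction stands in for matching theory. A crown is usually found with augmenting paths, whose
-- bookkeeping would be awkward for a machine that only sweeps; a bid is one first-order test
-- followed by a local change. Its invariant is that a customer's slot costs at most one more than
-- any slot suiting its component. If the price l+1 is absent, a customer paying more than l pays at
-- least l+2, so all slots suiting it cost more than l: dear slots are closed under neighbourhood,
-- which is the crown property. One slot for a K₂ and two for isolated vertices are the numbers that
-- complete a packing vertex h to a path, h-x-w or x-h-w, so every removed h is paid for by a path
-- of its own.
--
-- Vertex programs have loops over the vertices only, no while-loop. Both searches therefore run a
-- fixed number of steps, each of which changes nothing in a local optimum; a potential of cubic
-- size for the packing and of quadratic size for the prices shows that the optimum is reached
-- within these steps.

module Transduction where
  open import Defs hiding (sym)
  open import Data.List using (map; replicate)
  open import Data.Vec as Vec using (Vec; []; _∷_)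

  -- Finite sets and bounded strings coded in bits

  record Code (A : Set) : Set where
    field
      width   : ℕ
      enc     : A → Vec Bool width
      dec     : Vec Bool width → A
      dec-enc : ∀ a → dec (enc a) ≡ a

  open Code

  vtake-++ : ∀ {A : Set} {m n} (xs : Vec A m) (ys : Vec A n) → Vec.take m (xs Vec.++ ys) ≡ xs
  vtake-++ []       ys = refl
  vtake-++ (x ∷ xs) ys = cong (x ∷_) (vtake-++ xs ys)

  vdrop-++ : ∀ {A : Set} {m n} (xs : Vec A m) (ys : Vec A n) → Vec.drop m (xs Vec.++ ys) ≡ ys
  vdrop-++ []       ys = refl
  vdrop-++ (x ∷ xs) ys = vdrop-++ xs ys

  code-⊤ : Code ⊤
  code-⊤ = record { width = 0 ; enc = λ _ → [] ; dec = λ _ → tt ; dec-enc = λ _ → refl }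

  code-Vec : ∀ m → Code (Vec Bool m)
  code-Vec m = record { width = m ; enc = λ v → v ; dec = λ v → v ; dec-enc = λ _ → refl }

  code-Bool : Code Bool
  code-Bool = record { width = 1 ; enc = λ b → b ∷ [] ; dec = Vec.head ; dec-enc = λ _ → refl }

  code-via : ∀ {A B : Set} (f : A → B) (g : B → A) → (∀ a → g (f a) ≡ a) → Code B → Code A
  code-via f g gf c = record
    { width = width c ; enc = enc c ∘ f ; dec = g ∘ dec c
    ; dec-enc = λ a → trans (cong g (dec-enc c (f a))) (gf a) }

  code-× : ∀ {A B : Set} → Code A → Code B → Code (A × B)
  code-× ca cb = record
    { width = width ca + width cb
    ; enc = λ (a , b) → enc ca a Vec.++ enc cb b
    ; dec = λ v → dec ca (Vec.take (width ca) v) , dec cb (Vec.drop (width ca) v)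
    ; dec-enc = λ (a , b) → cong₂ _,_
        (trans (cong (dec ca) (vtake-++ (enc ca a) (enc cb b))) (dec-enc ca a))
        (trans (cong (dec cb) (vdrop-++ (enc ca a) (enc cb b))) (dec-enc cb b)) }

  -- Since `dec` is asked to be a left inverse only, both summands can be padded with `false` to one
  -- width.
  code-⊎ : ∀ {A B : Set} → Code A → Code B → Code (A ⊎ B)
  code-⊎ {A} {B} ca cb = record { width = suc (width ca + width cb) ; enc = e ; dec = d ; dec-enc = de }
    where
    e : A ⊎ B → Vec Bool (suc (width ca + width cb))
    e (inj₁ a) = false ∷ (enc ca a Vec.++ Vec.replicate (width cb) false)
    e (inj₂ b) = true ∷ (Vec.replicate (width ca) false Vec.++ enc cb b)
    d : Vec Bool (suc (width ca + width cb)) → A ⊎ B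
    d (false ∷ v) = inj₁ (dec ca (Vec.take (width ca) v))
    d (true ∷ v)  = inj₂ (dec cb (Vec.drop (width ca) v))
    de : ∀ x → d (e x) ≡ x
    de (inj₁ a) = cong inj₁ (trans (cong (dec ca) (vtake-++ (enc ca a) (Vec.replicate (width cb) false))) (dec-enc ca a))
    de (inj₂ b) = cong inj₂ (trans (cong (dec cb) (vdrop-++ (Vec.replicate (width ca) false) (enc cb b))) (dec-enc cb b))

  code-Maybe : ∀ {A : Set} → Code A → Code (Maybe A)
  code-Maybe {A} c = code-via f g gf (code-⊎ code-⊤ c)
    where
    f : Maybe A → ⊤ ⊎ A
    f nothing  = inj₁ tt
    f (just a) = inj₂ a
    g : ⊤ ⊎ A → Maybe A
    g (inj₁ _) = nothing
    g (inj₂ a) = just a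
    gf : ∀ a → g (f a) ≡ a
    gf nothing  = refl
    gf (just _) = refl

  bit→Fin : Bool → Fin 2
  bit→Fin false = zero
  bit→Fin true  = suc zero

  Fin→bit : Fin 2 → Bool
  Fin→bit zero    = false
  Fin→bit (suc _) = true

  bits→Fin : ∀ {w} → Vec Bool w → Fin (2 ^ w)
  bits→Fin []      = zero
  bits→Fin (b ∷ v) = combine (bit→Fin b) (bits→Fin v)

  Fin→bits : ∀ w → Fin (2 ^ w) → Vec Bool w
  Fin→bits zero    _ = []
  Fin→bits (suc w) i = let (b , j) = remQuot (2 ^ w) i in Fin→bit b ∷ Fin→bits w j

  Fin→bits→Fin : ∀ {w} (v : Vec Bool w) → Fin→bits w (bits→Fin v) ≡ v
  Fin→bits→Fin []      = refl
  Fin→bits→Fin {suc w} (b ∷ v) =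
    trans (cong (λ (c , j) → Fin→bit c ∷ Fin→bits w j) (remQuot-combine (bit→Fin b) (bits→Fin v)))
          (cong₂ _∷_ (bit-inv b) (Fin→bits→Fin v))
    where
    bit-inv : ∀ b → Fin→bit (bit→Fin b) ≡ b
    bit-inv false = refl
    bit-inv true  = refl

  -- Bit strings of length at most `w`. The bound keeps the type finite, so that pending output can
  -- be part of a machine state.
  Str : ℕ → Set
  Str zero    = ⊤
  Str (suc w) = Maybe (Bool × Str w)

  str : ∀ {w} → Str w → List Bool
  str {zero}  _              = []
  str {suc w} nothing        = []
  str {suc w} (just (b , x)) = b ∷ str x

  code-Str : ∀ w → Code (Str w)
  code-Str zero    = code-⊤
  code-Str (suc w) = code-Maybe (code-× code-Bool (code-Str w))

  weaken : ∀ {w} → Str w → Str (suc w)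
  weaken {zero}  _              = nothing
  weaken {suc w} nothing        = nothing
  weaken {suc w} (just (b , x)) = just (b , weaken x)

  str-weaken : ∀ {w} (x : Str w) → str (weaken x) ≡ str x
  str-weaken {zero}  _              = refl
  str-weaken {suc w} nothing        = refl
  str-weaken {suc w} (just (b , x)) = cong (b ∷_) (str-weaken x)

  -- The tail is weakened back to the bound `w`, because the phase `write` carries a buffer of one
  -- fixed capacity.
  uncons : ∀ {w} → Str w → Maybe (Bool × Str w)
  uncons {zero}  _              = nothing
  uncons {suc w} nothing        = nothing
  uncons {suc w} (just (b , x)) = just (b , weaken x)

  -- `next` is consulted at the end of a sweep: `nothing` halts, `just s` sweeps over the result again from s.
  record Transducer : Set₁ where
    field
      State : Set
      code  : Code State
      start : State
      cap   : ℕ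
      emit  : State → Bool → State × Str cap
      next  : State → Maybe State

    sweep : State → List Bool → State × List Bool
    sweep s []       = s , []
    sweep s (b ∷ bs) =
      let (s₁ , x) = emit s b ; (s₂ , out) = sweep s₁ bs in s₂ , str x ++ out

    -- `K` bounds every string between two sweeps: on the tape, the cost of a sweep grows with the
    -- lengths of its input and its output.
    data Sweeps (K : ℕ) : State → List Bool → ℕ → List Bool → Set where
      last : ∀ {s bs s' out} → sweep s bs ≡ (s' , out) → next s' ≡ nothing →
             length bs ≤ K → length out ≤ K → Sweeps K s bs 1 out
      more : ∀ {s bs s' s'' out n res} → sweep s bs ≡ (s' , out) → next s' ≡ just s'' →
             length bs ≤ K → length out ≤ K → Sweeps K s'' out n res → Sweeps K s bs (suc n) res

  -- Simulation of a transducer by a one-tape machine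

  module Simulation (T : Transducer) where
    open Transducer T

    -- The tape holds the unread input, a blank, and the output so far.
    data Phase : Set where
      fetch         : State → Phase
      right write   : State → Str cap → Phase
      back₁ back₂   : State → Phase
      halt          : Phase

    private
      Phase′ : Set
      Phase′ = (State ⊎ State ⊎ State) ⊎ (State × Str cap) ⊎ (State × Str cap) ⊎ ⊤

      fold : Phase → Phase′
      fold (fetch s)   = inj₁ (inj₁ s)
      fold (back₁ s)   = inj₁ (inj₂ (inj₁ s))
      fold (back₂ s)   = inj₁ (inj₂ (inj₂ s))
      fold (right s x) = inj₂ (inj₁ (s , x))
      fold (write s x) = inj₂ (inj₂ (inj₁ (s , x)))
      fold halt        = inj₂ (inj₂ (inj₂ tt))

      unfold : Phase′ → Phase
      unfold (inj₁ (inj₁ s))              = fetch s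
      unfold (inj₁ (inj₂ (inj₁ s)))       = back₁ s
      unfold (inj₁ (inj₂ (inj₂ s)))       = back₂ s
      unfold (inj₂ (inj₁ (s , x)))        = right s x
      unfold (inj₂ (inj₂ (inj₁ (s , x)))) = write s x
      unfold (inj₂ (inj₂ (inj₂ _)))       = halt

      unfold-fold : ∀ p → unfold (fold p) ≡ p
      unfold-fold (fetch s)   = refl
      unfold-fold (right s x) = refl
      unfold-fold (write s x) = refl
      unfold-fold (back₁ s)   = refl
      unfold-fold (back₂ s)   = refl
      unfold-fold halt        = refl

    code-Phase : Code Phase
    code-Phase = code-via fold unfold unfold-fold
      (code-⊎ (code-⊎ code (code-⊎ code code)) (code-⊎ pair (code-⊎ pair code-⊤)))
      where
      pair : Code (State × Str cap)
      pair = code-× code (code-Str cap)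

    -- Every bit is blanked when it is read, so blanks delimit both the unread input and the output:
    -- `back₁` returns over the output, `back₂` over the unread input up to the cell blanked last.
    -- When the input is used up, a step to the right across the separator makes the output the next
    -- input, so nothing is ever copied.
    rule : Phase → Sym → Maybe (Phase × Sym × Move)
    rule (fetch s) (just b) = let (s' , x) = emit s b in just (right s' x , nothing , R)
    rule (fetch s) nothing with next s
    ... | just s'  = just (fetch s' , nothing , R)
    ... | nothing  = just (halt , nothing , R)
    rule (right s x) (just b) = just (right s x , just b , R)
    rule (right s x) nothing  = just (write s x , nothing , R)
    rule (write s x) (just b) = just (write s x , just b , R)
    rule (write s x) nothing with uncons x
    ... | just (b , x') = just (write s x' , just b , R)
    ... | nothing       = just (back₁ s , nothing , L)
    rule (back₁ s) (just b) = just (back₁ s , just b , L)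
    rule (back₁ s) nothing  = just (back₂ s , nothing , L)
    rule (back₂ s) (just b) = just (back₂ s , just b , L)
    rule (back₂ s) nothing  = just (fetch s , nothing , R)
    rule halt _ = nothing

    -- The machine's initial state 0 is an extra name for the initial phase.
    abstract
      to : Phase → Fin (suc (2 ^ width code-Phase))
      to p = suc (bits→Fin (enc code-Phase p))

      from : Fin (suc (2 ^ width code-Phase)) → Phase
      from zero    = fetch start
      from (suc i) = dec code-Phase (Fin→bits _ i)

      from-to : ∀ p → from (to p) ≡ p
      from-to p = trans (cong (dec code-Phase) (Fin→bits→Fin (enc code-Phase p))) (dec-enc code-Phase p)

      from-zero : from zero ≡ fetch start
      from-zero = refl

    encodeRule : Maybe (Phase × Sym × Move) → Maybe (Fin (suc (2 ^ width code-Phase)) × Sym × Move)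
    encodeRule nothing               = nothing
    encodeRule (just (p , w , m)) = just (to p , w , m)

    machine : TM
    machine = record { q = 2 ^ width code-Phase ; δ = λ i h → encodeRule (rule (from i) h) }

    Conf : Set
    Conf = Config machine

    conf : Phase → List Sym → Sym → List Sym → Conf
    conf p l h r = cfg (to p) l h r

    at : Phase → List Sym → List Sym → Conf
    at p l []      = conf p l nothing []
    at p l (x ∷ r) = conf p l x r

    step-halt : ∀ {i} l {h} r → rule (from i) h ≡ nothing → step machine (cfg i l h r) ≡ nothing
    step-halt l r eq rewrite eq = refl

    moveR-at : ∀ p l h r → moveR {machine} (to p) l h r ≡ at p (h ∷ l) r
    moveR-at p l h []      = refl
    moveR-at p l h (x ∷ r) = refl

    step-R : ∀ p {p' w} l {h} r → rule p h ≡ just (p' , w , R) →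
      step machine (conf p l h r) ≡ just (at p' (w ∷ l) r)
    step-R p {p'} {w} l r eq rewrite from-to p | eq = cong just (moveR-at p' l w r)

    step-L : ∀ p {p' w} l {h} r → rule p h ≡ just (p' , w , L) →
      step machine (conf p l h r) ≡ just (moveL (to p') l w r)
    step-L p l r eq rewrite from-to p | eq = refl

    infixr 5 _◂_ _▸_
    data _⟶[_]_ : Conf → ℕ → Conf → Set where
      ε   : ∀ {c} → c ⟶[ 0 ] c
      _◂_ : ∀ {c c' c'' t} → step machine c ≡ just c' → c' ⟶[ t ] c'' → c ⟶[ suc t ] c''

    _▸_ : ∀ {c c' c'' t u} → c ⟶[ t ] c' → c' ⟶[ u ] c'' → c ⟶[ t + u ] c''
    ε        ▸ ys = ys
    (x ◂ xs) ▸ ys = x ◂ (xs ▸ ys)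

    from-≡ : ∀ {c c' d t} → c ≡ c' → c' ⟶[ t ] d → c ⟶[ t ] d
    from-≡ refl run = run

    to-≡ : ∀ {c d d' t} → c ⟶[ t ] d → d ≡ d' → c ⟶[ t ] d'
    to-≡ run refl = run

    exec-⟶ : ∀ {c c' t u} → c ⟶[ t ] c' → step machine c' ≡ nothing → t ≤ u → exec machine u c ≡ just c'
    exec-⟶ {c} {u = zero} ε stop _ with step machine c
    exec-⟶ ε refl _ | nothing = refl
    exec-⟶ {c} {u = suc u} ε stop _ with step machine c
    exec-⟶ ε refl _ | nothing = refl
    exec-⟶ {c} (eq ◂ xs) stop (s≤s t≤u) with step machine c
    exec-⟶ (refl ◂ xs) stop (s≤s t≤u) | just _ = exec-⟶ xs stop t≤u

    scanR : ∀ p → (∀ b → rule p (just b) ≡ just (p , just b , R)) →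
      ∀ bs l ys → at p l (map just bs ++ ys) ⟶[ length bs ] at p (map just bs ʳ++ l) ys
    scanR p r []       l ys = ε
    scanR p r (b ∷ bs) l ys = step-R p l _ (r b) ◂ scanR p r bs (just b ∷ l) ys

    scanL′ : ∀ p → (∀ b → rule p (just b) ≡ just (p , just b , L)) →
      ∀ bs l h ys → moveL (to p) (map just bs ++ nothing ∷ l) h ys ⟶[ length bs ]
                    conf p l nothing (map just bs ʳ++ (h ∷ ys))
    scanL′ p r []       l h ys = ε
    scanL′ p r (b ∷ bs) l h ys = step-L p _ _ (r b) ◂ scanL′ p r bs l (just b) (h ∷ ys)

    private
      rev-map : ∀ (bs : List Bool) (l : List Sym) → map just (reverse bs) ++ l ≡ map just bs ʳ++ l
      rev-map bs l = trans (cong (_++ l) (map-ʳ++ just bs)) (sym (ʳ++-defn (map just bs)))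

      rev-map-ʳ : ∀ (bs : List Bool) (l : List Sym) → map just (reverse bs) ʳ++ l ≡ map just bs ++ l
      rev-map-ʳ bs l = trans (cong (_ʳ++ l) (map-ʳ++ just bs)) (ʳ++-ʳ++ (map just bs))

    scanL : ∀ p → (∀ b → rule p (just b) ≡ just (p , just b , L)) →
      ∀ bs l h ys → moveL (to p) (map just bs ʳ++ (nothing ∷ l)) h ys ⟶[ length bs ]
                    conf p l nothing (map just bs ++ h ∷ ys)
    scanL p r bs l h ys with scanL′ p r (reverse bs) l h ys
    ... | run rewrite rev-map bs (nothing ∷ l) | rev-map-ʳ bs (h ∷ ys) | length-reverse bs = run

    -- Cells beyond the output that the head has visited remain in the configuration as explicit
    -- blanks; the run lemmas leave their number existential.
    blanks : ℕ → List Sym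
    blanks m = replicate m nothing

    at-blanks : ∀ p l m → at p l (blanks m) ≡ conf p l nothing (blanks (pred m))
    at-blanks p l zero    = refl
    at-blanks p l (suc m) = refl

    rule-uncons : ∀ {s x b x'} → uncons x ≡ just (b , x') →
      rule (write s x) nothing ≡ just (write s x' , just b , R)
    rule-uncons {x = x} eq with uncons x
    rule-uncons refl | just _ = refl

    rule-empty : ∀ {s x} → uncons x ≡ nothing → rule (write s x) nothing ≡ just (back₁ s , nothing , L)
    rule-empty {x = x} eq with uncons x
    rule-empty refl | nothing = refl

    uncons-[] : ∀ {w} (x : Str w) → str x ≡ [] → uncons x ≡ nothing
    uncons-[] {zero}  x       eq = refl
    uncons-[] {suc w} nothing eq = refl

    uncons-∷ : ∀ {w} (x : Str w) {b bs} → str x ≡ b ∷ bs → ∃[ x' ] (uncons x ≡ just (b , x') × str x' ≡ bs)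
    uncons-∷ {zero} x ()
    uncons-∷ {suc w} (just (b , x)) refl = weaken x , refl , str-weaken x

    write-out : ∀ s bs x → str x ≡ bs → ∀ l m →
      ∃[ m' ] (at (write s x) l (blanks m) ⟶[ suc (length bs) ]
               moveL (to (back₁ s)) (map just bs ʳ++ l) nothing (blanks m'))
    write-out s [] x eq l m rewrite at-blanks (write s x) l m =
      pred m , step-L (write s x) l _ (rule-empty {s} {x} (uncons-[] x eq)) ◂ ε
    write-out s (b ∷ bs) x eq l m rewrite at-blanks (write s x) l m =
      let (x' , un , eq') = uncons-∷ x eq
          (m' , run) = write-out s bs x' eq' (just b ∷ l) (pred m)
      in m' , step-R (write s x) l _ (rule-uncons {s} {x} un) ◂ run

    -- `rest` stands for blank ∷ ds ++ blanks, except before the first sweep, when it is empty.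
    Follows : List Sym → List Bool → ℕ → Set
    Follows rest ds m = ∀ p l → at p l rest ≡ at p l (nothing ∷ map just ds ++ blanks m)

    -- One bit costs a walk over the unread input, the output and the emitted string and the same
    -- way back: twice their total length plus five, rounded up.
    cycle-cost : ℕ → ℕ
    cycle-cost K = 4 * K + 6

    read-bit : ∀ s b bs ds {m rest} l → Follows rest ds m →
      ∃[ m' ] (at (fetch s) l (just b ∷ map just bs ++ rest)
        ⟶[ suc (length bs + suc (length ds + (suc (length (str (proj₂ (emit s b)))
            + (length (ds ++ str (proj₂ (emit s b))) + suc (length bs + 1))))) ) ]
        at (fetch (proj₁ (emit s b))) (nothing ∷ l)
           (map just bs ++ nothing ∷ map just (ds ++ str (proj₂ (emit s b))) ++ blanks m'))
    read-bit s b bs ds {m} {rest} l follows with emit s b in eq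
    ... | s' , x = suc m' , fetching ◂ scanR (right s' x) (λ _ → refl) bs (nothing ∷ l) rest
          ▸ from-≡ (follows (right s' x) l₁)
             (step-R (right s' x) l₁ _ refl ◂ scanR (write s' x) (λ _ → refl) ds (nothing ∷ l₁) (blanks m)
               ▸ proj₂ wr ▸ returning)
      where
      l₁ : List Sym
      l₁ = map just bs ʳ++ (nothing ∷ l)
      fetching : step machine (conf (fetch s) l (just b) (map just bs ++ rest))
                 ≡ just (at (right s' x) (nothing ∷ l) (map just bs ++ rest))
      fetching = step-R (fetch s) l _ (cong (λ { (s₁ , x₁) → just (right s₁ x₁ , nothing , R) }) eq)
      wr : ∃[ m' ] (at (write s' x) (map just ds ʳ++ (nothing ∷ l₁)) (blanks m) ⟶[ suc (length (str x)) ]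
               moveL (to (back₁ s')) (map just (str x) ʳ++ (map just ds ʳ++ (nothing ∷ l₁))) nothing (blanks m'))
      wr = write-out s' (str x) x refl (map just ds ʳ++ (nothing ∷ l₁)) m
      m' : ℕ
      m' = proj₁ wr
      glue : map just (str x) ʳ++ (map just ds ʳ++ (nothing ∷ l₁)) ≡ map just (ds ++ str x) ʳ++ (nothing ∷ l₁)
      glue = trans (sym (++-ʳ++ (map just ds))) (cong (_ʳ++ (nothing ∷ l₁)) (sym (map-++ just ds (str x))))
      returning : moveL (to (back₁ s')) (map just (str x) ʳ++ (map just ds ʳ++ (nothing ∷ l₁))) nothing (blanks m')
                  ⟶[ length (ds ++ str x) + suc (length bs + 1) ]
                  at (fetch s') (nothing ∷ l) (map just bs ++ nothing ∷ map just (ds ++ str x) ++ nothing ∷ blanks m')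
      returning rewrite glue =
        scanL (back₁ s') (λ _ → refl) (ds ++ str x) l₁ nothing (blanks m')
        ▸ (step-L (back₁ s') l₁ _ refl
        ◂ scanL (back₂ s') (λ _ → refl) bs l nothing _
        ▸ (step-R (back₂ s') l _ refl ◂ ε))

    private
      cycle-bound : ∀ p d c e K → e ≡ d + c → p + (d + c) ≤ K →
        suc (p + suc (d + (suc c + (e + suc (p + 1))))) ≤ cycle-cost K
      cycle-bound p d c .(d + c) K refl le = begin
        suc (p + suc (d + (suc c + ((d + c) + suc (p + 1))))) ≡⟨ lem p d c ⟩
        2 * (p + (d + c)) + 5                                  ≤⟨ +-mono-≤ (*-mono-≤ (s≤s (s≤s (z≤n {2}))) le) (n≤1+n 5) ⟩
        4 * K + 6 ∎
        where
        open ≤-Reasoning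
        lem : ∀ p d c → suc (p + suc (d + (suc c + ((d + c) + suc (p + 1))))) ≡ 2 * (p + (d + c)) + 5
        lem = solve-∀

    -- The output `ds` written so far is a parameter of the induction. Unread input plus final
    -- output dominates what the tape holds at every later bit, so one bound `K` serves the whole
    -- sweep.
    sweep-run : ∀ K bs s ds l {m rest} → Follows rest ds m →
      length bs + (length ds + length (proj₂ (sweep s bs))) ≤ K →
      ∃[ t ] ∃[ l' ] ∃[ m' ] (t ≤ length bs * cycle-cost K ×
        (at (fetch s) l (map just bs ++ rest) ⟶[ t ]
         at (fetch (proj₁ (sweep s bs))) l' (nothing ∷ map just (ds ++ proj₂ (sweep s bs)) ++ blanks m')))
    sweep-run K [] s ds l {m} follows le =
      0 , l , m , z≤n , from-≡ (follows (fetch s) l)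
        (to-≡ ε (cong (λ z → at (fetch s) l (nothing ∷ map just z ++ blanks m)) (sym (++-identityʳ ds))))
    sweep-run K (b ∷ bs) s ds l {m} follows le =
      let s' = proj₁ (emit s b)
          x  = str (proj₂ (emit s b))
          out = proj₂ (sweep s' bs)
          (m₁ , run₁) = read-bit s b bs ds l follows
          le′ : length bs + (length (ds ++ x) + length out) ≤ K
          le′ = ≤-trans (≤-reflexive (trans (cong (λ z → length bs + (z + length out)) (length-++ ds))
                  (cong (length bs +_) (trans (+-assoc (length ds) (length x) (length out))
                    (cong (length ds +_) (sym (length-++ x)))))))
                (≤-trans (n≤1+n _) le)
          le₂ : length bs + (length ds + length x) ≤ K
          le₂ = ≤-trans (+-monoʳ-≤ (length bs) (≤-trans (≤-reflexive (sym (length-++ ds))) (m≤m+n _ _))) le′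
          (t₂ , l₂ , m₂ , t₂≤ , run₂) = sweep-run K bs s' (ds ++ x) (nothing ∷ l) {m₁}
               {nothing ∷ map just (ds ++ x) ++ blanks m₁} (λ _ _ → refl) le′
      in _ , l₂ , m₂
         , +-mono-≤ (cycle-bound (length bs) (length ds) (length x) (length (ds ++ x)) K (length-++ ds) le₂) t₂≤
         , to-≡ (run₁ ▸ run₂)
             (cong (λ z → at (fetch (proj₁ (sweep s' bs))) l₂ (nothing ∷ map just z ++ blanks m₂)) (++-assoc ds x out))

    rule-more : ∀ {s s'} → next s ≡ just s' → rule (fetch s) nothing ≡ just (fetch s' , nothing , R)
    rule-more {s} eq with next s
    rule-more refl | just _ = refl

    rule-last : ∀ {s} → next s ≡ nothing → rule (fetch s) nothing ≡ just (halt , nothing , R)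
    rule-last {s} eq with next s
    rule-last refl | nothing = refl

    readOut-blanks : ∀ {p} l bs m → output {machine} (at p l (map just bs ++ blanks m)) ≡ bs
    readOut-blanks l [] zero    = refl
    readOut-blanks l [] (suc m) = refl
    readOut-blanks l (b ∷ bs) m = go b bs m
      where
      go : ∀ b bs m → readOut (just b) (map just bs ++ blanks m) ≡ b ∷ bs
      go b [] zero    = refl
      go b [] (suc m) = refl
      go b (b' ∷ bs) m = cong (b ∷_) (go b' bs m)

    -- At most `K` bits are read, over a tape with at most `K` unread and `K` written cells; the
    -- last step is the one across the separator.
    sweep-cost : ℕ → ℕ
    sweep-cost K = K * cycle-cost (K + K) + 1

    private
      one-sweep : ∀ {K s bs s' out} → sweep s bs ≡ (s' , out) → length bs ≤ K → length out ≤ K →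
        ∀ l {m rest} → Follows rest [] m →
        ∃[ t ] ∃[ l' ] ∃[ m' ] (t ≤ K * cycle-cost (K + K) ×
          (at (fetch s) l (map just bs ++ rest) ⟶[ t ] at (fetch s') l' (nothing ∷ map just out ++ blanks m')))
      one-sweep {K} {s} {bs} refl le₁ le₂ l follows =
        let (t , l' , m' , t≤ , run) = sweep-run (K + K) bs s [] l follows (+-mono-≤ le₁ le₂)
        in t , l' , m' , ≤-trans t≤ (*-monoˡ-≤ _ le₁) , run

    simulate : ∀ {K s bs n res} → Sweeps K s bs n res → ∀ l {m rest} → Follows rest [] m →
      ∃[ t ] ∃[ c ] (t ≤ n * sweep-cost K × (at (fetch s) l (map just bs ++ rest) ⟶[ t ] c)
        × step machine c ≡ nothing × output c ≡ res)
    simulate {K} (last {out = out} sw eq le₁ le₂) l {m} follows =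
      let (t , l' , m' , t≤ , run) = one-sweep sw le₁ le₂ l follows
      in _ , at halt (nothing ∷ l') (map just out ++ blanks m')
         , ≤-trans (+-monoˡ-≤ 1 t≤) (≤-reflexive (sym (+-identityʳ _)))
         , (run ▸ (step-R (fetch _) l' _ (rule-last eq) ◂ ε)) , halted (map just out ++ blanks m') (nothing ∷ l')
         , readOut-blanks (nothing ∷ l') out m'
      where
      halted : ∀ r l → step machine (at halt l r) ≡ nothing
      halted []      l = step-halt l [] (cong (λ p → rule p nothing) (from-to halt))
      halted (x ∷ r) l = step-halt l r (cong (λ p → rule p x) (from-to halt))
    simulate {K} (more {out = out} {n = n} sw eq le₁ le₂ sws) l {m} follows =
      let (t , l' , m' , t≤ , run) = one-sweep sw le₁ le₂ l follows
          (u , c , u≤ , run' , hlt , res) = simulate sws (nothing ∷ l') {pred m'} {blanks m'}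
             (λ p l → at-blanks p l m')
      in _ , c
         , ≤-trans (≤-reflexive (sym (+-assoc t 1 u))) (+-mono-≤ (+-monoˡ-≤ 1 t≤) u≤)
         , (run ▸ (step-R (fetch _) l' _ (rule-more eq) ◂ run')) , hlt , res

    private
      step-zero : ∀ l h r → step machine (cfg zero l h r) ≡ step machine (conf (fetch start) l h r)
      step-zero l h r rewrite from-zero | from-to (fetch start) = refl

      fetch-moves : ∀ s h → rule (fetch s) h ≢ nothing
      fetch-moves s nothing eq with next s
      fetch-moves s nothing () | just _
      fetch-moves s nothing () | nothing

      step-fetch : ∀ s l h r → step machine (conf (fetch s) l h r) ≢ nothing
      step-fetch s l h r eq rewrite from-to (fetch s) with rule (fetch s) h | fetch-moves s h
      step-fetch s l h r eq | nothing | moves = moves refl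
      step-fetch s l h r () | just (p , w , L) | _
      step-fetch s l h r () | just (p , w , R) | _
      step-fetch s l h r () | just (p , w , S) | _

      -- State zero and the name of `fetch start` have the same transitions, so the two runs
      -- coincide after their first step. A run without steps would keep the two names apart; it is
      -- excluded because a fetching machine never halts.
      rename-start : ∀ {l h r t c} → conf (fetch start) l h r ⟶[ t ] c → step machine c ≡ nothing →
        cfg zero l h r ⟶[ t ] c
      rename-start ε stop = contradiction stop (step-fetch start _ _ _)
      rename-start {l} {h} {r} (eq ◂ run) stop = trans (step-zero l h r) eq ◂ run

    runsTo : ∀ {K bs n res u} → Sweeps K start bs n res → n * sweep-cost K ≤ u → RunsTo machine bs u res
    runsTo {bs = bs} sws le with simulate sws [] {0} {[]} (λ _ _ → refl)
    ... | t , c , t≤ , run , stop , out rewrite ++-identityʳ (map (just {A = Bool}) bs) =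
      c , exec-⟶ (go bs run) stop (≤-trans t≤ le) , out
      where
      go : ∀ {t} bs → at (fetch start) [] (map just bs) ⟶[ t ] c → initial machine bs ⟶[ t ] c
      go []       run = rename-start run stop
      go (b ∷ bs) run = rename-start run stop

-- Control flow between finite-state sweeps over blocks

module SweepPrograms where
  open import Defs hiding (sym)
  open Transduction
  open import Data.Vec as Vec using (Vec; []; _∷_; toList)
  open import Data.Vec.Properties using (length-toList)
  open import Data.Sum using (map)

  -- A transducer sees single bits, so a block has to be collected in the state; `inj₂` signals that
  -- this bit has completed it.
  feed : ∀ {w} → Str w → Bool → Str w ⊎ Vec Bool w
  feed {zero}        _              b = inj₁ tt
  feed {suc w}       (just (a , x)) b = map (λ x' → just (a , x')) (a ∷_) (feed x b)
  feed {suc zero}    nothing        b = inj₂ (b ∷ [])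
  feed {suc (suc w)} nothing        b = inj₁ (just (b , nothing))

  data Feeds {w} : Str w → List Bool → Vec Bool w → Set where
    last : ∀ {x b v} → feed x b ≡ inj₂ v → Feeds x (b ∷ []) v
    more : ∀ {x b x' bs v} → feed x b ≡ inj₁ x' → Feeds x' bs v → Feeds x (b ∷ bs) v

  feeds-∷ : ∀ {w} {x : Str w} {bs v} a → Feeds x bs v → Feeds {suc w} (just (a , x)) bs (a ∷ v)
  feeds-∷ a (last eq)    = last (cong (map (λ x' → just (a , x')) (a ∷_)) eq)
  feeds-∷ a (more eq fs) = more (cong (map (λ x' → just (a , x')) (a ∷_)) eq) (feeds-∷ a fs)

  feeds-all : ∀ {w} (v : Vec Bool (suc w)) → Feeds nothing (toList v) v
  feeds-all (b ∷ [])           = last refl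
  feeds-all (b ∷ v@(_ ∷ _))    = more refl (feeds-∷ b (feeds-all v))

  fullStr : ∀ {w} → Vec Bool w → Str w
  fullStr []      = tt
  fullStr (b ∷ v) = just (b , fullStr v)

  str-fullStr : ∀ {w} (v : Vec Bool w) → str (fullStr v) ≡ toList v
  str-fullStr []      = refl
  str-fullStr (b ∷ v) = cong (b ∷_) (str-fullStr v)

  emptyStr : ∀ w → Str w
  emptyStr zero    = tt
  emptyStr (suc w) = nothing

  str-emptyStr : ∀ w → str (emptyStr w) ≡ []
  str-emptyStr zero    = refl
  str-emptyStr (suc w) = refl

  module Programs (Blk : Set) where

    pass : ∀ {S : Set} → (S → Blk → S × Blk) → S → List Blk → S × List Blk
    pass δ s []       = s , []
    pass δ s (x ∷ xs) =
      let (s₁ , y) = δ s x ; (s₂ , ys) = pass δ s₁ xs in s₂ , y ∷ ys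

    length-pass : ∀ {S : Set} (δ : S → Blk → S × Blk) s xs → length (proj₂ (pass δ s xs)) ≡ length xs
    length-pass δ s []       = refl
    length-pass δ s (x ∷ xs) = cong suc (length-pass δ (proj₁ (δ s x)) xs)

    record Mealy : Set₁ where
      field
        {Q}     : Set
        codeQ   : Code Q
        q₀      : Q
        trans-δ : Q → Blk → Q × Blk
        verdict : Q → Bool
    open Mealy

    -- `loop P A` alternates P and A until P succeeds (result true) or A fails (result false).
    data Prg : Set₁ where
      prim : Mealy → Prg
      cond : Prg → Prg → Prg → Prg
      loop : Prg → Prg → Prg

    -- The state records which subprogram is active, so the tape carries data only.
    St : Prg → Set
    St (prim m)     = Q m
    St (cond P A B) = St P ⊎ St A ⊎ St B
    St (loop P A)   = St P ⊎ St A

    code-St : ∀ P → Code (St P)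
    code-St (prim m)     = codeQ m
    code-St (cond P A B) = code-⊎ (code-St P) (code-⊎ (code-St A) (code-St B))
    code-St (loop P A)   = code-⊎ (code-St P) (code-St A)

    entry : ∀ P → St P
    entry (prim m)     = q₀ m
    entry (cond P A B) = inj₁ (entry P)
    entry (loop P A)   = inj₁ (entry P)

    act : ∀ P → St P → Blk → St P × Blk
    act (prim m)     s               x = trans-δ m s x
    act (cond P A B) (inj₁ s)        x = let (s' , y) = act P s x in inj₁ s' , y
    act (cond P A B) (inj₂ (inj₁ s)) x = let (s' , y) = act A s x in inj₂ (inj₁ s') , y
    act (cond P A B) (inj₂ (inj₂ s)) x = let (s' , y) = act B s x in inj₂ (inj₂ s') , y
    act (loop P A)   (inj₁ s)        x = let (s' , y) = act P s x in inj₁ s' , y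
    act (loop P A)   (inj₂ s)        x = let (s' , y) = act A s x in inj₂ s' , y

    after : ∀ {S S' : Set} → (Bool → Bool ⊎ S') → (S → S') → Bool ⊎ S → Bool ⊎ S'
    after k ι (inj₁ b) = k b
    after k ι (inj₂ s) = inj₂ (ι s)

    -- Control passes between sweeps only: `inj₁` leaves the program with its verdict, `inj₂` starts
    -- another sweep.
    fin : ∀ P → St P → Bool ⊎ St P
    fin (prim m)     s               = inj₁ (verdict m s)
    fin (cond P A B) (inj₁ s)        =
      after (λ b → if b then inj₂ (inj₂ (inj₁ (entry A))) else inj₂ (inj₂ (inj₂ (entry B)))) inj₁ (fin P s)
    fin (cond P A B) (inj₂ (inj₁ s)) = after inj₁ (λ s → inj₂ (inj₁ s)) (fin A s)
    fin (cond P A B) (inj₂ (inj₂ s)) = after inj₁ (λ s → inj₂ (inj₂ s)) (fin B s)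
    fin (loop P A)   (inj₁ s)        = after (λ b → if b then inj₁ true else inj₂ (inj₂ (entry A))) inj₁ (fin P s)
    fin (loop P A)   (inj₂ s)        = after (λ b → if b then inj₂ (inj₁ (entry P)) else inj₁ false) inj₂ (fin A s)

    data Exec (P : Prg) : St P → List Blk → ℕ → Bool → List Blk → Set where
      last : ∀ {s t s' u b} → pass (act P) s t ≡ (s' , u) → fin P s' ≡ inj₁ b → Exec P s t 1 b u
      more : ∀ {s t s' u s'' n b v} → pass (act P) s t ≡ (s' , u) → fin P s' ≡ inj₂ s'' →
             Exec P s'' u n b v → Exec P s t (suc n) b v

    Runs : Prg → List Blk → ℕ → Bool → List Blk → Set
    Runs P = Exec P (entry P)

    runs-≡ : ∀ {P t n b b' u u'} → Runs P t n b u → b ≡ b' → u ≡ u' → Runs P t n b' u'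
    runs-≡ r refl refl = r

    -- A subprogram at work inside a larger one: its sweeps are the same along `ι`, and the
    -- continuation `k` takes the place of its exit. One argument then covers every position in
    -- `cond` and `loop`.
    record Embedding (P P' : Prg) : Set where
      field
        ι     : St P → St P'
        k     : Bool → Bool ⊎ St P'
        act-ι : ∀ s x → act P' (ι s) x ≡ (ι (proj₁ (act P s x)) , proj₂ (act P s x))
        fin-ι : ∀ s → fin P' (ι s) ≡ after k ι (fin P s)

      pass-ι : ∀ s t → pass (act P') (ι s) t ≡ (ι (proj₁ (pass (act P) s t)) , proj₂ (pass (act P) s t))
      pass-ι s []      = refl
      pass-ι s (x ∷ t) rewrite act-ι s x | pass-ι (proj₁ (act P s x)) t = refl

      private
        pass-≡ : ∀ {s t s' u} → pass (act P) s t ≡ (s' , u) → pass (act P') (ι s) t ≡ (ι s' , u)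
        pass-≡ {s} {t} eq = trans (pass-ι s t) (cong (λ (s' , u) → ι s' , u) eq)

      exits : ∀ {s t n b u c} → Exec P s t n b u → k b ≡ inj₁ c → Exec P' (ι s) t n c u
      exits (last {s' = s'} eq f) kb = last (pass-≡ eq) (trans (fin-ι s') (trans (cong (after k ι) f) kb))
      exits (more {s' = s'} eq f e) kb = more (pass-≡ eq) (trans (fin-ι s') (cong (after k ι) f)) (exits e kb)

      continues : ∀ {s t n b u s' m c v} → Exec P s t n b u → k b ≡ inj₂ s' → Exec P' s' u m c v →
        Exec P' (ι s) t (n + m) c v
      continues (last {s' = s'} eq f) kb e' = more (pass-≡ eq) (trans (fin-ι s') (trans (cong (after k ι) f) kb)) e'
      continues (more {s' = s'} eq f e) kb e' =
        more (pass-≡ eq) (trans (fin-ι s') (cong (after k ι) f)) (continues e kb e')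

    open Embedding

    runs-prim : ∀ {m t s' u} → pass (trans-δ m) (q₀ m) t ≡ (s' , u) → Runs (prim m) t 1 (verdict m s') u
    runs-prim eq = last eq refl

    module _ {P A B : Prg} where
      private
        e₁ : Embedding P (cond P A B)
        e₁ = record { ι = inj₁ ; k = _ ; act-ι = λ _ _ → refl ; fin-ι = λ _ → refl }
        e₂ : Embedding A (cond P A B)
        e₂ = record { ι = λ s → inj₂ (inj₁ s) ; k = _ ; act-ι = λ _ _ → refl ; fin-ι = λ _ → refl }
        e₃ : Embedding B (cond P A B)
        e₃ = record { ι = λ s → inj₂ (inj₂ s) ; k = _ ; act-ι = λ _ _ → refl ; fin-ι = λ _ → refl }

      runs-then : ∀ {t n u m b v} → Runs P t n true u → Runs A u m b v → Runs (cond P A B) t (n + m) b v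
      runs-then p a = continues e₁ p refl (exits e₂ a refl)

      runs-else : ∀ {t n u m b v} → Runs P t n false u → Runs B u m b v → Runs (cond P A B) t (n + m) b v
      runs-else p a = continues e₁ p refl (exits e₃ a refl)

    module _ {P A : Prg} where
      private
        e₁ : Embedding P (loop P A)
        e₁ = record { ι = inj₁ ; k = _ ; act-ι = λ _ _ → refl ; fin-ι = λ _ → refl }
        e₂ : Embedding A (loop P A)
        e₂ = record { ι = inj₂ ; k = _ ; act-ι = λ _ _ → refl ; fin-ι = λ _ → refl }

      runs-found : ∀ {t n u} → Runs P t n true u → Runs (loop P A) t n true u
      runs-found p = exits e₁ p refl

      runs-exhausted : ∀ {t n u m v} → Runs P t n false u → Runs A u m false v → Runs (loop P A) t (n + m) false v
      runs-exhausted p a = continues e₁ p refl (exits e₂ a refl)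

      runs-again : ∀ {t n u m v l b w} → Runs P t n false u → Runs A u m true v → Runs (loop P A) v l b w →
        Runs (loop P A) t (n + (m + l)) b w
      runs-again p a r = continues e₁ p refl (continues e₂ a refl r)

    exec-length : ∀ {P s t n b u} → Exec P s t n b u → length u ≡ length t
    exec-length {P} (last {s} {t} eq _) = trans (cong (λ z → length (proj₂ z)) (sym eq)) (length-pass (act P) s t)
    exec-length {P} (more {s} {t} eq _ e) =
      trans (exec-length e) (trans (cong (λ z → length (proj₂ z)) (sym eq)) (length-pass (act P) s t))

    -- Turns a program on blocks into a transducer on bits: the first sweep replaces every input bit
    -- by a block, the last one every block by at most one bit.
    module Job (codeBlk : Code Blk) {X : Set} (codeX : Code X) (x₀ : X) (intro : X → Bool → X × Blk)
               (P : Prg) (contract : Blk → Maybe Bool) where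
      private
        w : ℕ
        w = Code.width codeBlk

      -- The leading bit keeps blocks nonempty whatever the width of their code, as `feeds-all`
      -- requires.
      bits : Blk → Vec Bool (suc w)
      bits x = true ∷ Code.enc codeBlk x

      unbits : Vec Bool (suc w) → Blk
      unbits v = Code.dec codeBlk (Vec.tail v)

      unbits-bits : ∀ x → unbits (bits x) ≡ x
      unbits-bits = Code.dec-enc codeBlk

      data Mode : Set where
        expanding   : X → Mode
        running     : Str (suc w) → St P → Mode
        contracting : Str (suc w) → Mode

      private
        code-Mode : Code Mode
        code-Mode = code-via f g gf (code-⊎ codeX (code-⊎ (code-× (code-Str (suc w)) (code-St P)) (code-Str (suc w))))
          where
          f : Mode → X ⊎ (Str (suc w) × St P) ⊎ Str (suc w)
          f (expanding x)   = inj₁ x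
          f (running y s)   = inj₂ (inj₁ (y , s))
          f (contracting y) = inj₂ (inj₂ y)
          g : X ⊎ (Str (suc w) × St P) ⊎ Str (suc w) → Mode
          g (inj₁ x)              = expanding x
          g (inj₂ (inj₁ (y , s))) = running y s
          g (inj₂ (inj₂ y))       = contracting y
          gf : ∀ a → g (f a) ≡ a
          gf (expanding x)   = refl
          gf (running y s)   = refl
          gf (contracting y) = refl

      contracted : Maybe Bool → Str (suc w)
      contracted nothing  = nothing
      contracted (just b) = just (b , emptyStr w)

      emit-running : St P → Str (suc w) ⊎ Vec Bool (suc w) → Mode × Str (suc w)
      emit-running s (inj₁ y) = running y s , nothing
      emit-running s (inj₂ v) = let (s' , x) = act P s (unbits v) in running nothing s' , fullStr (bits x)

      emit-contracting : Str (suc w) ⊎ Vec Bool (suc w) → Mode × Str (suc w)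
      emit-contracting (inj₁ y) = contracting y , nothing
      emit-contracting (inj₂ v) = contracting nothing , contracted (contract (unbits v))

      emit-Mode : Mode → Bool → Mode × Str (suc w)
      emit-Mode (expanding x)   b = let (x' , y) = intro x b in expanding x' , fullStr (bits y)
      emit-Mode (running y s)   b = emit-running s (feed y b)
      emit-Mode (contracting y) b = emit-contracting (feed y b)

      next-running : Bool ⊎ St P → Mode
      next-running (inj₁ _) = contracting nothing
      next-running (inj₂ s) = running nothing s

      next-Mode : Mode → Maybe Mode
      next-Mode (expanding x)   = just (running nothing (entry P))
      next-Mode (running y s)   = just (next-running (fin P s))
      next-Mode (contracting y) = nothing

      transducer : Transducer
      transducer = record
        { State = Mode ; code = code-Mode ; start = expanding x₀ ; cap = suc w ; emit = emit-Mode ; next = next-Mode }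

      open Transducer transducer using (sweep; Sweeps; last; more)

      expand : X → List Bool → List Blk
      expand x []       = []
      expand x (b ∷ bs) = let (x' , y) = intro x b in y ∷ expand x' bs

      raw : List Blk → List Bool
      raw = concatMap (λ x → toList (bits x))

      sweep-expanding : ∀ x bs → ∃[ x' ] sweep (expanding x) bs ≡ (expanding x' , raw (expand x bs))
      sweep-expanding x []       = x , refl
      sweep-expanding x (b ∷ bs) with sweep-expanding (proj₁ (intro x b)) bs
      ... | x' , eq rewrite eq = x' , cong (λ z → expanding x' , z ++ raw (expand (proj₁ (intro x b)) bs)) (str-fullStr (bits (proj₂ (intro x b))))

      private
        sweep-∷ : ∀ {s b s' x} → emit-Mode s b ≡ (s' , x) → ∀ bs →
          sweep s (b ∷ bs) ≡ (proj₁ (sweep s' bs) , str x ++ proj₂ (sweep s' bs))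
        sweep-∷ eq bs rewrite eq = refl

        feed-running : ∀ {y bs v} s → Feeds y bs v → ∀ bs' →
          sweep (running y s) (bs ++ bs') ≡
          (let (s' , x) = act P s (unbits v) ; (z , out) = sweep (running nothing s') bs' in z , toList (bits x) ++ out)
        feed-running {y} {b ∷ []} {v} s (last eq) bs' =
          trans (sweep-∷ {running y s} (cong (emit-running s) eq) bs')
            (cong (λ z → proj₁ (sweep (running nothing (proj₁ (act P s (unbits v)))) bs')
                       , z ++ proj₂ (sweep (running nothing (proj₁ (act P s (unbits v)))) bs'))
                  (str-fullStr (bits (proj₂ (act P s (unbits v))))))
        feed-running {y} {b ∷ bs} s (more eq fs) bs' =
          trans (sweep-∷ {running y s} (cong (emit-running s) eq) (bs ++ bs')) (feed-running s fs bs')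

        str-contracted : ∀ x → str (contracted (contract x)) ≡ mapMaybe contract (x ∷ [])
        str-contracted x with contract x
        ... | nothing = refl
        ... | just b  = cong (b ∷_) (str-emptyStr w)

        feed-contracting : ∀ {y bs v} → Feeds y bs v → ∀ bs' →
          sweep (contracting y) (bs ++ bs') ≡
          (let (z , out) = sweep (contracting nothing) bs' in z , mapMaybe contract (unbits v ∷ []) ++ out)
        feed-contracting {y} {b ∷ []} {v} (last eq) bs' =
          trans (sweep-∷ {contracting y} (cong emit-contracting eq) bs')
            (cong (λ z → proj₁ (sweep (contracting nothing) bs') , z ++ proj₂ (sweep (contracting nothing) bs')) (str-contracted (unbits v)))
        feed-contracting {y} {b ∷ bs} (more eq fs) bs' =
          trans (sweep-∷ {contracting y} (cong emit-contracting eq) (bs ++ bs')) (feed-contracting fs bs')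

        mapMaybe-∷ : ∀ x xs → mapMaybe contract (x ∷ xs) ≡ mapMaybe contract (x ∷ []) ++ mapMaybe contract xs
        mapMaybe-∷ x xs with contract x
        ... | nothing = refl
        ... | just _  = refl

      sweep-running : ∀ s t → sweep (running nothing s) (raw t) ≡
        (running nothing (proj₁ (pass (act P) s t)) , raw (proj₂ (pass (act P) s t)))
      sweep-running s []      = refl
      sweep-running s (x ∷ t) rewrite feed-running s (feeds-all (bits x)) (raw t) | unbits-bits x
        | sweep-running (proj₁ (act P s x)) t = refl

      sweep-contracting : ∀ t → sweep (contracting nothing) (raw t) ≡ (contracting nothing , mapMaybe contract t)
      sweep-contracting []      = refl
      sweep-contracting (x ∷ t) rewrite feed-contracting (feeds-all (bits x)) (raw t) | unbits-bits x
        | sweep-contracting t = cong (contracting nothing ,_) (sym (mapMaybe-∷ x t))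

      length-raw : ∀ t → length (raw t) ≡ length t * suc w
      length-raw []      = refl
      length-raw (x ∷ t) = trans (length-++ (toList (bits x)))
        (cong₂ _+_ (length-toList (bits x)) (length-raw t))

      length-expand : ∀ x bs → length (expand x bs) ≡ length bs
      length-expand x []       = refl
      length-expand x (b ∷ bs) = cong suc (length-expand _ bs)

      private
        sweeps-running : ∀ {K s t n b u} → Exec P s t n b u → length t * suc w ≤ K →
          Sweeps K (running nothing s) (raw t) (n + 1) (mapMaybe contract u)
        sweeps-running {K} {s} {t} e@(last {s' = s'} {u = u} eq f) le =
          more (trans (sweep-running s t) (cong (λ (s' , u) → running nothing s' , raw u) eq))
               (cong (λ z → just (next-running z)) f)
               (≤-trans (≤-reflexive (length-raw t)) le)
               (≤-trans (≤-reflexive (length-raw u)) le′)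
               (last (sweep-contracting u) refl (≤-trans (≤-reflexive (length-raw u)) le′)
                  (≤-trans (length-mapMaybe contract u) (≤-trans (m≤m*n (length u) (suc w)) le′)))
          where
          le′ : length u * suc w ≤ K
          le′ = ≤-trans (≤-reflexive (cong (_* suc w) (exec-length e))) le
        sweeps-running {K} {s} {t} (more {u = u} eq f e) le =
          more (trans (sweep-running s t) (cong (λ (s' , u) → running nothing s' , raw u) eq))
               (cong (λ z → just (next-running z)) f)
               (≤-trans (≤-reflexive (length-raw t)) le)
               (≤-trans (≤-reflexive (length-raw u)) le′)
               (sweeps-running e le′)
          where
          le′ : length u * suc w ≤ K
          le′ = ≤-trans (≤-reflexive (cong (_* suc w)
                  (trans (cong (λ z → length (proj₂ z)) (sym eq)) (length-pass (act P) s t)))) le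

      -- One sweep expands and one contracts. In between, the tape always has as many blocks as the
      -- input has bits, whence the common length bound.
      job-sweeps : ∀ {bs n b u} → Runs P (expand x₀ bs) n b u →
        Sweeps (length bs * suc w) (expanding x₀) bs (suc (n + 1)) (mapMaybe contract u)
      job-sweeps {bs} r =
        let (x' , eq) = sweep-expanding x₀ bs
            le = ≤-reflexive (cong (_* suc w) (length-expand x₀ bs))
        in more eq refl (m≤m*n (length bs) (suc w))
             (≤-trans (≤-reflexive (length-raw (expand x₀ bs))) le)
             (sweeps-running r le)

-- Vertex programs, their meaning, and the tape that represents their memory

module TapeLayout where
  open import Defs hiding (sym; n)
  open Transduction
  open SweepPrograms
  open import Data.Vec as Vec using (Vec; []; _∷_; lookup; _[_]≔_; replicate)
  open import Data.Vec.Properties using (lookup-replicate; lookup∘tabulate; []≔-lookup; tabulate-cong)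

  T⇒≡ : ∀ {b} → T b → b ≡ true
  T⇒≡ {true} _ = refl

  ¬T⇒≡ : ∀ {b} → ¬ T b → b ≡ false
  ¬T⇒≡ {false} _ = refl
  ¬T⇒≡ {true}  h = contradiction tt h

  <ᵇ-true : ∀ {m n} → m < n → (m <ᵇ n) ≡ true
  <ᵇ-true lt = T⇒≡ (<⇒<ᵇ lt)

  <ᵇ-false : ∀ {m n} → n ≤ m → (m <ᵇ n) ≡ false
  <ᵇ-false {m} {n} le = ¬T⇒≡ λ t → <⇒≱ (<ᵇ⇒< m n t) le

  ≡ᵇ-true : ∀ {m n} → m ≡ n → (m ≡ᵇ n) ≡ true
  ≡ᵇ-true {m} {n} eq = T⇒≡ (≡⇒≡ᵇ m n eq)

  ≡ᵇ-false : ∀ {m n} → m ≢ n → (m ≡ᵇ n) ≡ false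
  ≡ᵇ-false {m} {n} ne = ¬T⇒≡ λ t → ne (≡ᵇ⇒≡ m n t)

  infix 4 _==_
  _==_ : ∀ {n} → Fin n → Fin n → Bool
  i == j = toℕ i ≡ᵇ toℕ j

  ==-refl : ∀ {n} (i : Fin n) → (i == i) ≡ true
  ==-refl i = ≡ᵇ-true {toℕ i} refl

  ==-false : ∀ {n} {i j : Fin n} → i ≢ j → (i == j) ≡ false
  ==-false ne = ≡ᵇ-false λ eq → ne (toℕ-injective eq)

  ==⇒≡ : ∀ {n} {i j : Fin n} → (i == j) ≡ true → i ≡ j
  ==⇒≡ {i = i} {j} eq = toℕ-injective (≡ᵇ⇒≡ (toℕ i) (toℕ j) (subst T (sym eq) tt))

  tabulate-[]≔ : ∀ {A : Set} {m} (f : Fin m → A) i x →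
    Vec.tabulate f [ i ]≔ x ≡ Vec.tabulate (λ j → if j == i then x else f j)
  tabulate-[]≔ f zero    x = refl
  tabulate-[]≔ f (suc i) x = cong (f zero ∷_) (tabulate-[]≔ (λ j → f (suc j)) i x)

  data Kind : Set where
    hdr sep mat suf : Kind

  code-Kind : Code Kind
  code-Kind = code-via f g gf (code-× code-Bool code-Bool)
    where
    f : Kind → Bool × Bool
    f hdr = false , false
    f sep = false , true
    f mat = true , false
    f suf = true , true
    g : Bool × Bool → Kind
    g (false , false) = hdr
    g (false , true)  = sep
    g (true , false)  = mat
    g (true , true)   = suf
    gf : ∀ a → g (f a) ≡ a
    gf hdr = refl
    gf sep = refl
    gf mat = refl
    gf suf = refl

  -- v is the number of vertex variables in scope.  `any` stops at the first vertex for which its body succeeds, `kill` marks a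
  -- vertex for deletion, and `tick c` spends one unit of the budget k of counter c, failing if none is left.
  data Prog (r : ℕ) (v : ℕ) : Set where
    ret  : Bool → Prog r v
    rel  : Fin r → Fin v → Fin v → Prog r v
    lt   : Fin v → Fin v → Prog r v
    put  : Fin r → Fin v → Fin v → Bool → Prog r v
    kill : Fin v → Prog r v
    tick : Bool → Prog r v
    seq  : Prog r v → Prog r v → Prog r v
    ite  : Prog r v → Prog r v → Prog r v → Prog r v
    any  : Prog r (suc v) → Prog r v

  record Mem (r n : ℕ) : Set where
    constructor mem
    field
      rels  : Fin r → Fin n → Fin n → Bool
      dead  : Fin n → Bool
      ticks : Bool → ℕ
  open Mem

  startRels : ∀ {R n} → (Fin n → Fin n → Bool) → Fin (suc R) → Fin n → Fin n → Bool
  startRels bits zero    i j = bits i j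
  startRels bits (suc _) i j = false

  startMem : ∀ {R n} → (Fin n → Fin n → Bool) → Mem (suc R) n
  startMem bits = mem (startRels bits) (λ _ → false) (λ _ → 0)

  -- Changes made by a failing body persist. A body that always fails therefore turns `any` into a
  -- loop over all vertices.
  anyM : ∀ {n} {M : Set} → (Fin n → M → Bool × M) → M → Bool × M
  anyM {zero}  f m = false , m
  anyM {suc n} f m with f zero m
  ... | true  , m' = true , m'
  ... | false , m' = anyM (λ i → f (suc i)) m'

  putRel : ∀ {r n} → Fin r → Fin n → Fin n → Bool → Mem r n → Mem r n
  putRel r i j b m = record m
    { rels = λ r' i' j' → if (i' == i) ∧ (j' == j) then (if r' == r then b else rels m r' i' j') else rels m r' i' j' }

  killVertex : ∀ {r n} → Fin n → Mem r n → Mem r n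
  killVertex i m = record m { dead = λ i' → dead m i' ∨ (i' == i) }

  -- Counters saturate at `k`, since a unit is spent by marking one of the `k` budget cells on the
  -- tape.
  tickMem : ∀ {r n} → ℕ → Bool → Mem r n → Mem r n
  tickMem k false m = record m { ticks = λ { false → suc (ticks m false) ⊓ k ; true → ticks m true } }
  tickMem k true  m = record m { ticks = λ { false → ticks m false ; true → suc (ticks m true) ⊓ k } }

  module Semantics {r n : ℕ} (k : ℕ) where

    eval : ∀ {v} → Prog r v → Vec (Fin n) v → Mem r n → Bool × Mem r n
    eval (ret b)       ρ m = b , m
    eval (rel x i j)   ρ m = rels m x (lookup ρ i) (lookup ρ j) , m
    eval (lt i j)      ρ m = (toℕ (lookup ρ i) <ᵇ toℕ (lookup ρ j)) , m
    eval (put x i j b) ρ m = true , putRel x (lookup ρ i) (lookup ρ j) b m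
    eval (kill i)      ρ m = true , killVertex (lookup ρ i) m
    eval (tick c)      ρ m = (ticks m c <ᵇ k) , tickMem k c m
    eval (seq P P')    ρ m = eval P' ρ (proj₂ (eval P ρ m))
    eval (ite P A B)   ρ m with eval P ρ m
    ... | true  , m' = eval A ρ m'
    ... | false , m' = eval B ρ m'
    eval (any P)       ρ m = anyM (λ i → eval P (i ∷ ρ)) m

  module Blocks (R D : ℕ) where

    -- The graph bit of a cell is relation 0.
    record Blk : Set where
      constructor blk
      field
        kind       : Kind
        row₀ col₀  : Bool
        cnt₁ cnt₂  : Bool
        gone       : Bool
        tick₁ tick₂ : Bool
        vals       : Vec Bool (suc R)
        rows cols  : Vec Bool D

    open Blk public

    code-Blk : Code Blk
    code-Blk = code-via f g (λ _ → refl)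
      (code-× code-Kind (code-× (code-Vec 7) (code-× (code-Vec (suc R)) (code-× (code-Vec D) (code-Vec D)))))
      where
      f : Blk → Kind × Vec Bool 7 × Vec Bool (suc R) × Vec Bool D × Vec Bool D
      f (blk k a b c d e t₁ t₂ v x y) = k , (a ∷ b ∷ c ∷ d ∷ e ∷ t₁ ∷ t₂ ∷ []) , v , x , y
      g : Kind × Vec Bool 7 × Vec Bool (suc R) × Vec Bool D × Vec Bool D → Blk
      g (k , (a ∷ b ∷ c ∷ d ∷ e ∷ t₁ ∷ t₂ ∷ []) , v , x , y) = blk k a b c d e t₁ t₂ v x y

    bitOf : Blk → Bool
    bitOf x = Vec.head (vals x)

    open Programs Blk public

    tape : ∀ {n l k} → (Fin n → Blk) → Blk → (Fin l → Fin n → Blk) → (Fin k → Blk) → Blk → List Blk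
    tape h s m f e = tabulate h ++ s ∷ concat (tabulate (λ i → tabulate (m i))) ++ tabulate f ++ e ∷ []

    tabulate-≡ : ∀ {n} {A : Set} {f g : Fin n → A} → (∀ i → f i ≡ g i) → tabulate f ≡ tabulate g
    tabulate-≡ {zero}  eq = refl
    tabulate-≡ {suc n} eq = cong₂ _∷_ (eq zero) (tabulate-≡ (λ i → eq (suc i)))

    module _ {S : Set} (δ : S → Blk → S × Blk) where

      pass-++ : ∀ {s s' s'' xs xs' ys ys'} → pass δ s xs ≡ (s' , xs') → pass δ s' ys ≡ (s'' , ys') →
        pass δ s (xs ++ ys) ≡ (s'' , xs' ++ ys')
      pass-++ {xs = []}     refl q = q
      pass-++ {s} {xs = x ∷ xs} refl q =
        cong (λ z → proj₁ z , proj₂ (δ s x) ∷ proj₂ z) (pass-++ {proj₁ (δ s x)} {xs = xs} refl q)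

      pass-∷ : ∀ {s s' s'' x x' ys ys'} → δ s x ≡ (s' , x') → pass δ s' ys ≡ (s'' , ys') →
        pass δ s (x ∷ ys) ≡ (s'' , x' ∷ ys')
      pass-∷ refl refl = refl

      pass-tabulate : ∀ {n} (σ : ℕ → S) (f g : Fin n → Blk) →
        (∀ j → δ (σ (toℕ j)) (f j) ≡ (σ (suc (toℕ j)) , g j)) → pass δ (σ 0) (tabulate f) ≡ (σ n , tabulate g)
      pass-tabulate {zero}  σ f g h = refl
      pass-tabulate {suc n} σ f g h =
        pass-∷ (h zero) (pass-tabulate (λ j → σ (suc j)) (λ j → f (suc j)) (λ j → g (suc j)) (λ j → h (suc j)))

      pass-grid : ∀ {l n} (σ : ℕ → ℕ → S) (f g : Fin l → Fin n → Blk) →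
        (∀ i j → δ (σ (toℕ i) (toℕ j)) (f i j) ≡ (σ (toℕ i) (suc (toℕ j)) , g i j)) →
        (∀ i → σ i n ≡ σ (suc i) 0) →
        pass δ (σ 0 0) (concat (tabulate (λ i → tabulate (f i)))) ≡ (σ l 0 , concat (tabulate (λ i → tabulate (g i))))
      pass-grid {zero}  σ f g h w = refl
      pass-grid {suc l} σ f g h w =
        pass-++ (trans (pass-tabulate (σ 0) (f zero) (g zero) (h zero)) (cong (_, tabulate (g zero)) (w 0)))
          (pass-grid (λ i → σ (suc i)) (λ i → f (suc i)) (λ i → g (suc i)) (λ i → h (suc i)) (λ i → w (suc i)))

      -- A sweep is verified by announcing the state of the automaton as a function of the position,
      -- `α` on the header, `β` on the matrix and `γ` on the budget; what is left to check is one
      -- transition per kind of cell.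
      pass-tape : ∀ {l n k} {h h' : Fin n → Blk} {s s'} {m m' : Fin l → Fin n → Blk} {f f' : Fin k → Blk} {e e' z}
        (α : ℕ → S) (β : ℕ → ℕ → S) (γ : ℕ → S) →
        (∀ j → δ (α (toℕ j)) (h j) ≡ (α (suc (toℕ j)) , h' j)) →
        δ (α n) s ≡ (β 0 0 , s') →
        (∀ i j → δ (β (toℕ i) (toℕ j)) (m i j) ≡ (β (toℕ i) (suc (toℕ j)) , m' i j)) →
        (∀ i → β i n ≡ β (suc i) 0) → β l 0 ≡ γ 0 →
        (∀ p → δ (γ (toℕ p)) (f p) ≡ (γ (suc (toℕ p)) , f' p)) →
        δ (γ k) e ≡ (z , e') →
        pass δ (α 0) (tape h s m f e) ≡ (z , tape h' s' m' f' e')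
      pass-tape {h = h} {h'} {m = m} {m'} {f} {f'} α β γ ph ps pm pw pj pf pe =
        pass-++ (pass-tabulate α h h' ph) (pass-∷ ps (pass-++ (trans (pass-grid β m m' pm pw) (cong (_, _) pj))
          (pass-++ (pass-tabulate γ f f' pf) (pass-∷ {ys = []} pe refl))))

    retM : Bool → Mealy
    retM b = record { codeQ = code-⊤ ; q₀ = tt ; trans-δ = λ s x → s , x ; verdict = λ _ → b }

    mapM : (Blk → Blk) → Mealy
    mapM g = record { codeQ = code-⊤ ; q₀ = tt ; trans-δ = λ s x → s , g x ; verdict = λ _ → true }

    testM : (Blk → Bool) → Mealy
    testM p = record { codeQ = code-Bool ; q₀ = false ; trans-δ = λ s x → s ∨ p x , x ; verdict = λ s → s }

    putB : Fin (suc R) → Fin D → Fin D → Bool → Blk → Blk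
    putB r a b v x = record x { vals = if lookup (rows x) a ∧ lookup (cols x) b then vals x [ r ]≔ v else vals x }

    killB : Fin D → Blk → Blk
    killB a x = record x { gone = gone x ∨ (lookup (rows x) a ∨ lookup (cols x) a) }

    resetB : Fin D → Blk → Blk
    resetB a x = record x { rows = rows x [ a ]≔ row₀ x ; cols = cols x [ a ]≔ col₀ x }

    relB : Fin (suc R) → Fin D → Fin D → Blk → Bool
    relB r a b x = (lookup (rows x) a ∧ lookup (cols x) b) ∧ lookup (vals x) r

    -- The first component tells whether the mark of `a` lies strictly to the left: it is consulted
    -- before the current cell updates it, so equal values do not count as smaller.
    ltM : Fin D → Fin D → Mealy
    ltM a b = record { codeQ = code-× code-Bool code-Bool ; q₀ = false , false ; trans-δ = δ' ; verdict = proj₂ }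
      where
      δ' : Bool × Bool → Blk → (Bool × Bool) × Blk
      δ' (seen , acc) x with kind x
      ... | hdr = (seen ∨ lookup (cols x) a , acc ∨ (seen ∧ lookup (cols x) b)) , x
      ... | _   = (seen , acc) , x

    -- The budget is unary, so the first unmarked budget cell is marked. The end cell has bit
    -- `false` and is passed over, which makes the sweep fail once all `k` units are spent.
    tickM : Bool → Mealy
    tickM c = record { codeQ = code-Bool ; q₀ = false ; trans-δ = δ' c ; verdict = λ s → s }
      where
      δ' : Bool → Bool → Blk → Bool × Blk
      δ' c true  x = true , x
      δ' c false x with kind x
      δ' c false x | suf with bitOf x
      δ' false false x | suf | true with tick₁ x
      ... | true  = false , x
      ... | false = true , record x { tick₁ = true }
      δ' true false x | suf | true with tick₂ x
      ... | true  = false , x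
      ... | false = true , record x { tick₂ = true }
      δ' c false x | suf | false = false , x
      δ' c false x | _   = false , x

    -- Shifts the marks of a variable by one place. `cp` is the old column mark of the previous
    -- cell, `p` the old mark of the previous row, `cur` the old mark of the current row, and a cell
    -- of column 0 opens a new row. The verdict `acc` is true when the shifted mark still lies in
    -- the header.
    advM : Fin D → Mealy
    advM a = record
      { codeQ = code-× code-Bool (code-× code-Bool (code-× code-Bool code-Bool))
      ; q₀ = false , false , false , false ; trans-δ = δ' ; verdict = λ (_ , _ , _ , acc) → acc }
      where
      δ' : Bool × Bool × Bool × Bool → Blk → (Bool × Bool × Bool × Bool) × Blk
      δ' (cp , p , cur , acc) x with kind x
      ... | hdr = (lookup (cols x) a , p , cur , acc ∨ cp) , record x { cols = cols x [ a ]≔ cp }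
      ... | mat = let p' = if col₀ x then cur else p in
                  (lookup (cols x) a , p' , lookup (rows x) a , acc)
                  , record x { rows = rows x [ a ]≔ p' ; cols = cols x [ a ]≔ (if col₀ x then false else cp) }
      ... | _   = (cp , p , cur , acc) , x

    -- The tape keeps the shape of the input: n header cells, a separator, the n × n matrix, k budget cells and an end cell.
    -- Variable d has value i when `cols` of header cell i, and `rows` and `cols` of row i and column i, are marked at d.
    Env : Set
    Env = Fin D → ℕ

    none : ∀ {m} → Vec Bool m
    none = replicate _ false

    marks : ℕ → Env → Vec Bool D
    marks i ρ = Vec.tabulate (λ d → i ≡ᵇ ρ d)

    module _ {n : ℕ} (k : ℕ) (m : Mem (suc R) n) (ρ : Env) where
      hdrC : Fin n → Blk
      hdrC j = blk hdr false (toℕ j ≡ᵇ 0) true false (dead m j) false false (true ∷ none) none (marks (toℕ j) ρ)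

      sepC : Blk
      sepC = blk sep false false false false false false false none none none

      matC : Fin n → Fin n → Blk
      matC i j = blk mat (toℕ i ≡ᵇ 0) (toℕ j ≡ᵇ 0) false false (dead m i ∨ dead m j) false false
        (Vec.tabulate (λ r → rels m r i j)) (marks (toℕ i) ρ) (marks (toℕ j) ρ)

      sufC : Fin k → Blk
      sufC p = blk suf false false false false false (toℕ p <ᵇ ticks m false) (toℕ p <ᵇ ticks m true) (true ∷ none) none none

      endC : Blk
      endC = blk suf false false false false false false false none none none

      layout : List Blk
      layout = tape hdrC sepC matC sufC endC

    upd : Env → Fin D → ℕ → Env
    upd ρ a x d = if d == a then x else ρ d

    lookup-none : ∀ {m} (a : Fin m) → lookup none a ≡ false
    lookup-none a = lookup-replicate a false

    lookup-marks : ∀ i ρ a → lookup (marks i ρ) a ≡ (i ≡ᵇ ρ a)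
    lookup-marks i ρ a = lookup∘tabulate (λ d → i ≡ᵇ ρ d) a

    marks-upd : ∀ i ρ a {x b} → b ≡ (i ≡ᵇ x) → marks i ρ [ a ]≔ b ≡ marks i (upd ρ a x)
    marks-upd i ρ a {x} refl = trans (tabulate-[]≔ _ a _) (tabulate-cong go)
      where
      go : ∀ d → (if d == a then i ≡ᵇ x else i ≡ᵇ ρ d) ≡ (i ≡ᵇ upd ρ a x d)
      go d with d == a
      ... | true  = refl
      ... | false = refl

    none-upd : ∀ (a : Fin D) → none [ a ]≔ false ≡ none
    none-upd a = trans (cong (none [ a ]≔_) (sym (lookup-none a))) ([]≔-lookup none a)

    module _ {n : ℕ} {k : ℕ} where

      run-ret : ∀ b t → Runs (prim (retM b)) t 1 b t
      run-ret b t = runs-prim (pass-id t)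
        where
        pass-id : ∀ t → pass (λ s x → s , x) tt t ≡ (tt , t)
        pass-id []      = refl
        pass-id (x ∷ t) = pass-∷ _ {x = x} refl (pass-id t)

      pass-layout : ∀ {S : Set} (δ : S → Blk → S × Blk) (m m' : Mem (suc R) n) (ρ ρ' : Env) {z}
        (α : ℕ → S) (β : ℕ → ℕ → S) (γ : ℕ → S) →
        (∀ j → δ (α (toℕ j)) (hdrC k m ρ j) ≡ (α (suc (toℕ j)) , hdrC k m' ρ' j)) →
        δ (α n) (sepC k m ρ) ≡ (β 0 0 , sepC k m' ρ') →
        (∀ i j → δ (β (toℕ i) (toℕ j)) (matC k m ρ i j) ≡ (β (toℕ i) (suc (toℕ j)) , matC k m' ρ' i j)) →
        (∀ i → β i n ≡ β (suc i) 0) → β n 0 ≡ γ 0 →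
        (∀ p → δ (γ (toℕ p)) (sufC k m ρ p) ≡ (γ (suc (toℕ p)) , sufC k m' ρ' p)) →
        δ (γ k) (endC k m ρ) ≡ (z , endC k m' ρ') →
        pass δ (α 0) (layout k m ρ) ≡ (z , layout k m' ρ')
      pass-layout δ m m' ρ ρ' = pass-tape δ {m = matC k m ρ} {m' = matC k m' ρ'}

      run-map : ∀ g (m m' : Mem (suc R) n) ρ ρ' →
        (∀ j → g (hdrC k m ρ j) ≡ hdrC k m' ρ' j) → g (sepC k m ρ) ≡ sepC k m' ρ' →
        (∀ i j → g (matC k m ρ i j) ≡ matC k m' ρ' i j) →
        (∀ p → g (sufC k m ρ p) ≡ sufC k m' ρ' p) → g (endC k m ρ) ≡ endC k m' ρ' →
        Runs (prim (mapM g)) (layout k m ρ) 1 true (layout k m' ρ')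
      run-map g m m' ρ ρ' h s mt f e = runs-prim (pass-layout _ m m' ρ ρ' (λ _ → tt) (λ _ _ → tt) (λ _ → tt)
        (λ j → cong (tt ,_) (h j)) (cong (tt ,_) s) (λ i j → cong (tt ,_) (mt i j)) (λ _ → refl) refl
        (λ p → cong (tt ,_) (f p)) (cong (tt ,_) e))

      run-put : ∀ r {a b} v (m : Mem (suc R) n) ρ i j → ρ a ≡ toℕ i → ρ b ≡ toℕ j →
        Runs (prim (mapM (putB r a b v))) (layout k m ρ) 1 true (layout k (putRel r i j v m) ρ)
      run-put r {a} {b} v m ρ i j ea eb = run-map (putB r a b v) m (putRel r i j v m) ρ ρ
        (λ j' → cong (λ z → record (hdrC k m ρ j') { vals = if z ∧ _ then _ else _ }) (lookup-none a))
        (cong (λ z → record (sepC k m ρ) { vals = if z ∧ _ then _ else _ }) (lookup-none a))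
        (λ i' j' → cong (λ z → record (matC k m ρ i' j') { vals = z }) (go i' j'))
        (λ p → cong (λ z → record (sufC k m ρ p) { vals = if z ∧ _ then _ else _ }) (lookup-none a))
        (cong (λ z → record (endC k m ρ) { vals = if z ∧ _ then _ else _ }) (lookup-none a))
        where
        go : ∀ i' j' → vals (putB r a b v (matC k m ρ i' j')) ≡ vals (matC k (putRel r i j v m) ρ i' j')
        go i' j' rewrite lookup-marks (toℕ i') ρ a | lookup-marks (toℕ j') ρ b | ea | eb
          with (i' == i) ∧ (j' == j)
        ... | true  = tabulate-[]≔ (λ r' → rels m r' i' j') r v
        ... | false = refl

      run-kill : ∀ {a} (m : Mem (suc R) n) ρ i → ρ a ≡ toℕ i →
        Runs (prim (mapM (killB a))) (layout k m ρ) 1 true (layout k (killVertex i m) ρ)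
      run-kill {a} m ρ i ea = run-map (killB a) m (killVertex i m) ρ ρ
        (λ j → cong (λ z → record (hdrC k m ρ j) { gone = z })
          (cong₂ (λ u v → dead m j ∨ (u ∨ v)) (lookup-none a) (trans (lookup-marks (toℕ j) ρ a) (cong (toℕ j ≡ᵇ_) ea))))
        (cong (λ z → record (sepC k m ρ) { gone = z ∨ z }) (lookup-none a))
        (λ i' j → cong (λ z → record (matC k m ρ i' j) { gone = z })
          (trans (cong₂ (λ u v → (dead m i' ∨ dead m j) ∨ (u ∨ v))
             (trans (lookup-marks (toℕ i') ρ a) (cong (toℕ i' ≡ᵇ_) ea))
             (trans (lookup-marks (toℕ j) ρ a) (cong (toℕ j ≡ᵇ_) ea)))
            (swap (dead m i') (dead m j) (i' == i) (j == i))))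
        (λ p → cong (λ z → record (sufC k m ρ p) { gone = z ∨ z }) (lookup-none a))
        (cong (λ z → record (endC k m ρ) { gone = z ∨ z }) (lookup-none a))
        where
        swap : ∀ a b c d → (a ∨ b) ∨ (c ∨ d) ≡ (a ∨ c) ∨ (b ∨ d)
        swap true  b     c     d = refl
        swap false true  true  d = refl
        swap false true  false d = refl
        swap false false c     d = refl

      run-reset : ∀ a (m : Mem (suc R) n) ρ →
        Runs (prim (mapM (resetB a))) (layout k m ρ) 1 true (layout k m (upd ρ a 0))
      run-reset a m ρ = run-map (resetB a) m m ρ (upd ρ a 0)
        (λ j → cong₂ (λ u v → record (hdrC k m ρ j) { rows = u ; cols = v }) (none-upd a) (marks-upd (toℕ j) ρ a refl))
        (cong₂ (λ u v → record (sepC k m ρ) { rows = u ; cols = v }) (none-upd a) (none-upd a))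
        (λ i j → cong₂ (λ u v → record (matC k m ρ i j) { rows = u ; cols = v })
          (marks-upd (toℕ i) ρ a refl) (marks-upd (toℕ j) ρ a refl))
        (λ p → cong₂ (λ u v → record (sufC k m ρ p) { rows = u ; cols = v }) (none-upd a) (none-upd a))
        (cong₂ (λ u v → record (endC k m ρ) { rows = u ; cols = v }) (none-upd a) (none-upd a))

      private
        <ᵇ-suc : ∀ v j → (v <ᵇ j) ∨ (j ≡ᵇ v) ≡ (v <ᵇ suc j)
        <ᵇ-suc v j with <-cmp v j
        ... | tri< v<j _ _    rewrite <ᵇ-true v<j | <ᵇ-true (m<n⇒m<1+n v<j) = refl
        ... | tri≈ _ refl _   rewrite <ᵇ-false (≤-refl {v}) | ≡ᵇ-true {v} refl | <ᵇ-true (n<1+n v) = refl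
        ... | tri> _ v≢j j<v  rewrite <ᵇ-false (<⇒≤ j<v) | ≡ᵇ-false (≢-sym v≢j) | <ᵇ-false j<v = refl

      run-lt : ∀ {a b} (m : Mem (suc R) n) ρ (i j : Fin n) → ρ a ≡ toℕ i → ρ b ≡ toℕ j →
        Runs (prim (ltM a b)) (layout k m ρ) 1 (toℕ i <ᵇ toℕ j) (layout k m ρ)
      run-lt {a} {b} m ρ i j ea eb = subst (λ z → Runs (prim (ltM a b)) (layout k m ρ) 1 z (layout k m ρ)) final
        (runs-prim (pass-layout (Mealy.trans-δ (ltM a b)) m m ρ ρ σ (λ _ _ → σ n) (λ _ → σ n)
          (λ p → cong (_, hdrC k m ρ p) (cong₂ _,_ (seen p) (acc p))) refl (λ _ _ → refl) (λ _ → refl) refl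
          (λ _ → refl) refl))
        where
        σ : ℕ → Bool × Bool
        σ p = (toℕ i <ᵇ p) , ((toℕ j <ᵇ p) ∧ (toℕ i <ᵇ toℕ j))
        final : (toℕ j <ᵇ n) ∧ (toℕ i <ᵇ toℕ j) ≡ (toℕ i <ᵇ toℕ j)
        final rewrite <ᵇ-true (toℕ<n j) = refl
        seen : ∀ (p : Fin n) → (toℕ i <ᵇ toℕ p) ∨ lookup (marks (toℕ p) ρ) a ≡ (toℕ i <ᵇ suc (toℕ p))
        seen p rewrite lookup-marks (toℕ p) ρ a | ea = <ᵇ-suc (toℕ i) (toℕ p)
        acc : ∀ (p : Fin n) → ((toℕ j <ᵇ toℕ p) ∧ (toℕ i <ᵇ toℕ j)) ∨ ((toℕ i <ᵇ toℕ p) ∧ lookup (marks (toℕ p) ρ) b)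
              ≡ (toℕ j <ᵇ suc (toℕ p)) ∧ (toℕ i <ᵇ toℕ j)
        acc p rewrite lookup-marks (toℕ p) ρ b | eb | sym (<ᵇ-suc (toℕ j) (toℕ p)) = go (toℕ p ≟ toℕ j)
          where
          go : Dec (toℕ p ≡ toℕ j) → ((toℕ j <ᵇ toℕ p) ∧ (toℕ i <ᵇ toℕ j)) ∨ ((toℕ i <ᵇ toℕ p) ∧ (toℕ p ≡ᵇ toℕ j))
               ≡ ((toℕ j <ᵇ toℕ p) ∨ (toℕ p ≡ᵇ toℕ j)) ∧ (toℕ i <ᵇ toℕ j)
          go (yes eq) rewrite eq | <ᵇ-false (≤-refl {toℕ j}) | ≡ᵇ-true {toℕ j} refl = ∧-identityʳ (toℕ i <ᵇ toℕ j)
          go (no ne) rewrite ≡ᵇ-false ne | ∧-zeroʳ (toℕ i <ᵇ toℕ p) | ∨-identityʳ (toℕ j <ᵇ toℕ p)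
            = ∨-identityʳ _

      run-adv : ∀ {a} (m : Mem (suc R) n) ρ {x} → ρ a ≡ x → 1 ≤ n →
        Runs (prim (advM a)) (layout k m ρ) 1 (suc x <ᵇ n) (layout k m (upd ρ a (suc x)))
      run-adv {a} m ρ {x} refl (s≤s {n = n'} _) =
        runs-prim (pass-layout (Mealy.trans-δ (advM a)) m m ρ (upd ρ a (suc x)) α β (λ _ → β n 0)
          (λ j → cong₂ _,_ (cong₂ (λ u v → u , false , false , v) (lookup-marks (toℕ j) ρ a) (<ᵇ-suc (suc x) (toℕ j)))
                   (cong (λ z → record (hdrC k m ρ j) { cols = z }) (marks-upd (toℕ j) ρ a refl)))
          refl cell (λ i → refl) refl (λ _ → refl) refl)
        where
        A : Bool
        A = suc x <ᵇ n
        α : ℕ → Bool × Bool × Bool × Bool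
        α j = (j ≡ᵇ suc x) , false , false , (suc x <ᵇ j)
        -- At the start of a row the state is that left by the end of the previous one; only the
        -- first cell, recognised by `col₀`, moves it on. This makes the passage between rows hold
        -- by computation.
        β : ℕ → ℕ → Bool × Bool × Bool × Bool
        β i zero    = (n ≡ᵇ suc x) , (i ≡ᵇ suc (suc x)) , (i ≡ᵇ suc x) , A
        β i (suc j) = (suc j ≡ᵇ suc x) , (i ≡ᵇ suc x) , (i ≡ᵇ x) , A
        cell : ∀ (i j : Fin n) → Mealy.trans-δ (advM a) (β (toℕ i) (toℕ j)) (matC k m ρ i j)
               ≡ (β (toℕ i) (suc (toℕ j)) , matC k m (upd ρ a (suc x)) i j)
        cell i zero = cong₂ _,_ (cong₂ (λ u v → u , (toℕ i ≡ᵇ suc x) , v , A) (lookup-marks 0 ρ a) (lookup-marks (toℕ i) ρ a))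
          (cong₂ (λ u v → record (matC k m ρ i zero) { rows = u ; cols = v })
            (marks-upd (toℕ i) ρ a refl) (marks-upd 0 ρ a refl))
        cell i (suc j) = cong₂ _,_
          (cong₂ (λ u v → u , (toℕ i ≡ᵇ suc x) , v , A) (lookup-marks (suc (toℕ j)) ρ a) (lookup-marks (toℕ i) ρ a))
          (cong₂ (λ u v → record (matC k m ρ i (suc j)) { rows = u ; cols = v })
            (marks-upd (toℕ i) ρ a refl) (marks-upd (suc (toℕ j)) ρ a refl))

      run-tick : ∀ c (m : Mem (suc R) n) ρ → ticks m c ≤ k →
        Runs (prim (tickM c)) (layout k m ρ) 1 (ticks m c <ᵇ k) (layout k (tickMem k c m) ρ)
      run-tick c m ρ le =
        runs-prim (pass-layout (Mealy.trans-δ (tickM c)) m (tickMem k c m) ρ ρ (λ _ → false) (λ _ _ → false) (λ p → ticks m c <ᵇ p)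
          (hdr-step c) (sep-step c) (mat-step c) (λ _ → refl) refl (cell c) (end-step c (ticks m c <ᵇ k)))
        where
        hdr-step : ∀ c j → Mealy.trans-δ (tickM c) false (hdrC k m ρ j) ≡ (false , hdrC k (tickMem k c m) ρ j)
        hdr-step false j = refl
        hdr-step true  j = refl
        sep-step : ∀ c → Mealy.trans-δ (tickM c) false (sepC k m ρ) ≡ (false , sepC k (tickMem k c m) ρ)
        sep-step false = refl
        sep-step true  = refl
        mat-step : ∀ c i j → Mealy.trans-δ (tickM c) false (matC k m ρ i j) ≡ (false , matC k (tickMem k c m) ρ i j)
        mat-step false i j = refl
        mat-step true  i j = refl
        end-step : ∀ c b → Mealy.trans-δ (tickM c) b (endC k m ρ) ≡ (b , endC k (tickMem k c m) ρ)
        end-step false true  = refl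
        end-step false false = refl
        end-step true  true  = refl
        end-step true  false = refl
        small : ∀ t (p : Fin k) → (toℕ p <ᵇ suc t ⊓ k) ≡ (toℕ p <ᵇ suc t)
        small t p with toℕ p <? suc t
        ... | yes lt′ rewrite <ᵇ-true lt′ = <ᵇ-true (⊓-glb lt′ (toℕ<n p))
        ... | no ge   rewrite <ᵇ-false (≮⇒≥ ge) = <ᵇ-false (≤-trans (m⊓n≤m (suc t) k) (≮⇒≥ ge))
        cell : ∀ c p → Mealy.trans-δ (tickM c) (ticks m c <ᵇ toℕ p) (sufC k m ρ p) ≡
               ((ticks m c <ᵇ suc (toℕ p)) , sufC k (tickMem k c m) ρ p)
        cell false p rewrite small (ticks m false) p with <-cmp (ticks m false) (toℕ p)
        ... | tri< t<p _ _  rewrite <ᵇ-true t<p | <ᵇ-true (m<n⇒m<1+n t<p) | <ᵇ-false (<⇒≤ t<p) | <ᵇ-false t<p = refl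
        ... | tri≈ _ eq _   rewrite eq | <ᵇ-false (≤-refl {toℕ p}) | <ᵇ-true (n<1+n (toℕ p)) = refl
        ... | tri> _ _ p<t  rewrite <ᵇ-false (<⇒≤ p<t) | <ᵇ-true p<t | <ᵇ-false p<t | <ᵇ-true (m<n⇒m<1+n p<t) = refl
        cell true p rewrite small (ticks m true) p with <-cmp (ticks m true) (toℕ p)
        ... | tri< t<p _ _  rewrite <ᵇ-true t<p | <ᵇ-true (m<n⇒m<1+n t<p) | <ᵇ-false (<⇒≤ t<p) | <ᵇ-false t<p = refl
        ... | tri≈ _ eq _   rewrite eq | <ᵇ-false (≤-refl {toℕ p}) | <ᵇ-true (n<1+n (toℕ p)) = refl
        ... | tri> _ _ p<t  rewrite <ᵇ-false (<⇒≤ p<t) | <ᵇ-true p<t | <ᵇ-false p<t | <ᵇ-true (m<n⇒m<1+n p<t) = refl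

-- Compilation of vertex programs into sweeps

module Compilation where
  open import Defs hiding (sym; n)
  open Transduction
  open SweepPrograms
  open TapeLayout
  open import Data.Vec as Vec using (Vec; []; _∷_; lookup)
  open import Data.Vec.Properties using (lookup∘tabulate)

  open Mem

  -- De Bruijn levels: unlike an index, the level of a variable is unaffected by further binders, so
  -- it can name a fixed track of marks.
  level : ∀ {v} → Fin v → ℕ
  level {suc v} zero    = v
  level {suc v} (suc x) = level x

  level<v : ∀ {v} (x : Fin v) → level x < v
  level<v {suc v} zero    = n<1+n v
  level<v {suc v} (suc x) = m<n⇒m<1+n (level<v x)

  depth : ∀ {r v} → Prog r v → ℕ
  depth (seq P Q)   = depth P ⊔ depth Q
  depth (ite P A B) = depth P ⊔ (depth A ⊔ depth B)
  depth (any P)     = depth P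
  depth {v = v} _   = v

  scope≤depth : ∀ {r v} (P : Prog r v) → v ≤ depth P
  scope≤depth (ret _)       = ≤-refl
  scope≤depth (rel _ _ _)   = ≤-refl
  scope≤depth (lt _ _)      = ≤-refl
  scope≤depth (put _ _ _ _) = ≤-refl
  scope≤depth (kill _)      = ≤-refl
  scope≤depth (tick _)      = ≤-refl
  scope≤depth (seq P Q)     = ≤-trans (scope≤depth P) (m≤m⊔n _ _)
  scope≤depth (ite P A B)   = ≤-trans (scope≤depth P) (m≤m⊔n _ _)
  scope≤depth (any P)       = ≤-trans (n≤1+n _) (scope≤depth P)

  -- Counts sweeps, not machine steps. A loop takes one sweep to reset its variable, and for each
  -- vertex the body and one sweep to advance.
  cost : ∀ {r v} → Prog r v → ℕ → ℕ
  cost (seq P Q)   n = cost P n + cost Q n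
  cost (ite P A B) n = cost P n + (cost A n + cost B n)
  cost (any P)     n = 1 + n * (cost P n + 1)
  cost _           n = 1

  module Compiler (R D : ℕ) where
    open Blocks R D

    var : ∀ {v} → v ≤ D → Fin v → Fin D
    var h x = fromℕ< (<-≤-trans (level<v x) h)

    compile : ∀ {v} (P : Prog (suc R) v) → depth P ≤ D → Prg
    compile (ret b)       h = prim (retM b)
    compile (rel r i j)   h = prim (testM (relB r (var h i) (var h j)))
    compile (lt i j)      h = prim (ltM (var h i) (var h j))
    compile (put r i j b) h = prim (mapM (putB r (var h i) (var h j) b))
    compile (kill i)      h = prim (mapM (killB (var h i)))
    compile (tick c)      h = prim (tickM c)
    compile (seq P Q)     h =
      -- Both branches are `Q`, since sequencing disregards the verdict of `P`.
      cond (compile P (m⊔n≤o⇒m≤o _ _ h)) (compile Q (m⊔n≤o⇒n≤o _ _ h)) (compile Q (m⊔n≤o⇒n≤o _ _ h))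
    compile (ite P A B)   h =
      cond (compile P (m⊔n≤o⇒m≤o _ _ h)) (compile A (m⊔n≤o⇒m≤o _ _ (m⊔n≤o⇒n≤o (depth P) _ h)))
           (compile B (m⊔n≤o⇒n≤o _ _ (m⊔n≤o⇒n≤o (depth P) _ h)))
    compile (any P)       h =
      -- A reset always succeeds, so `cond` acts as sequencing here.
      cond (prim (mapM (resetB a))) (loop (compile P h) (prim (advM a))) (prim (retM false))
      where
      a : Fin D
      a = fromℕ< (≤-trans (scope≤depth P) h)

    orB : (Blk → Bool) → List Blk → Bool
    orB p []       = false
    orB p (x ∷ xs) = p x ∨ orB p xs

    run-test : ∀ p xs → Runs (prim (testM p)) xs 1 (orB p xs) xs
    run-test p xs = runs-prim (pass-test false xs)
      where
      pass-test : ∀ s xs → pass (Mealy.trans-δ (testM p)) s xs ≡ (s ∨ orB p xs , xs)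
      pass-test s []       = cong (_, []) (sym (∨-identityʳ s))
      pass-test s (x ∷ xs) = pass-∷ _ {x = x} refl (trans (pass-test (s ∨ p x) xs) (cong (_, xs) (∨-assoc s (p x) _)))

    module _ (p : Blk → Bool) where

      orB-++ : ∀ xs ys → orB p (xs ++ ys) ≡ orB p xs ∨ orB p ys
      orB-++ []       ys = refl
      orB-++ (x ∷ xs) ys = trans (cong (p x ∨_) (orB-++ xs ys)) (sym (∨-assoc (p x) _ _))

      orB-concat-none : ∀ {l} (f : Fin l → List Blk) → (∀ i → orB p (f i) ≡ false) → orB p (concat (tabulate f)) ≡ false
      orB-concat-none {zero}  f h = refl
      orB-concat-none {suc l} f h =
        trans (orB-++ (f zero) _) (cong₂ _∨_ (h zero) (orB-concat-none (λ i → f (suc i)) (λ i → h (suc i))))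

      orB-concat : ∀ {l} (f : Fin l → List Blk) i (q : Fin l → Bool) → (∀ i' → orB p (f i') ≡ (i' == i) ∧ q i') →
        orB p (concat (tabulate f)) ≡ q i
      orB-concat f zero    q h = trans (orB-++ (f zero) _)
        (trans (cong₂ _∨_ (h zero) (orB-concat-none (λ i → f (suc i)) (λ i → h (suc i)))) (∨-identityʳ (q zero)))
      orB-concat f (suc i) q h = trans (orB-++ (f zero) _)
        (cong₂ _∨_ (h zero) (orB-concat (λ i → f (suc i)) i (λ i → q (suc i)) (λ i → h (suc i))))

      orB-tabulate-none : ∀ {l} (f : Fin l → Blk) → (∀ i → p (f i) ≡ false) → orB p (tabulate f) ≡ false
      orB-tabulate-none {zero}  f h = refl
      orB-tabulate-none {suc l} f h = cong₂ _∨_ (h zero) (orB-tabulate-none (λ i → f (suc i)) (λ i → h (suc i)))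

      orB-tabulate : ∀ {l} (f : Fin l → Blk) i (q : Fin l → Bool) → (∀ i' → p (f i') ≡ (i' == i) ∧ q i') → orB p (tabulate f) ≡ q i
      orB-tabulate f zero    q h =
        trans (cong₂ _∨_ (h zero) (orB-tabulate-none (λ i → f (suc i)) (λ i → h (suc i)))) (∨-identityʳ (q zero))
      orB-tabulate f (suc i) q h = cong₂ _∨_ (h zero) (orB-tabulate (λ i → f (suc i)) i (λ i → q (suc i)) (λ i → h (suc i)))

    module _ {n k : ℕ} where

      run-rel : ∀ r {a b} (m : Mem (suc R) n) ρ i j → ρ a ≡ toℕ i → ρ b ≡ toℕ j →
        Runs (prim (testM (relB r a b))) (layout k m ρ) 1 (rels m r i j) (layout k m ρ)
      run-rel r {a} {b} m ρ i j ea eb =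
        subst (λ z → Runs (prim (testM p)) (layout k m ρ) 1 z (layout k m ρ)) value (run-test p (layout k m ρ))
        where
        p : Blk → Bool
        p = relB r a b
        unmarked : ∀ x → rows x ≡ none → p x ≡ false
        unmarked x eq rewrite eq | lookup-none a = refl
        shuffle : ∀ a b c → (a ∧ b) ∧ c ≡ b ∧ (a ∧ c)
        shuffle true  b c = refl
        shuffle false b c = sym (∧-zeroʳ b)
        cell : ∀ i' j' → p (matC k m ρ i' j') ≡ (j' == j) ∧ ((i' == i) ∧ rels m r i' j')
        cell i' j' rewrite lookup-marks (toℕ i') ρ a | lookup-marks (toℕ j') ρ b | ea | eb
          | lookup∘tabulate (λ r → rels m r i' j') r = shuffle (i' == i) (j' == j) (rels m r i' j')
        value : orB p (layout k m ρ) ≡ rels m r i j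
        value = trans (orB-++ p (tabulate (hdrC k m ρ)) _) (trans
          (cong₂ _∨_ (orB-tabulate-none p (hdrC k m ρ) (λ j → unmarked (hdrC k m ρ j) refl))
            (cong₂ _∨_ (unmarked (sepC k m ρ) refl) (trans (orB-++ p (concat (tabulate λ i → tabulate (matC k m ρ i))) _)
              (cong₂ _∨_ (orB-concat p (λ i → tabulate (matC k m ρ i)) i (λ i' → rels m r i' j)
                (λ i' → orB-tabulate p (matC k m ρ i') j (λ j' → (i' == i) ∧ rels m r i' j') (cell i')))
                (trans (orB-++ p (tabulate (sufC k m ρ)) _)
                  (cong₂ _∨_ (orB-tabulate-none p (sufC k m ρ) (λ j → unmarked (sufC k m ρ j) refl))
                     (cong (_∨ false) (unmarked (endC k m ρ) refl))))))))
          (∨-identityʳ (rels m r i j)))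

    module Correctness {n k : ℕ} (1≤n : 1 ≤ n) where
      open Semantics {suc R} {n} k

      Agree : ∀ {v} → v ≤ D → Vec (Fin n) v → Env → Set
      Agree h ρ e = ∀ x → e (var h x) ≡ toℕ (lookup ρ x)

      TicksBounded : Mem (suc R) n → Set
      TicksBounded m = ∀ c → ticks m c ≤ k

      private
        Outcome : Prg → ℕ → (Env → Set) → List Blk → Bool × Mem (suc R) n → Set
        Outcome P c A t (b , m) = ∃[ t' ] ∃[ e ] (t' ≤ c × Runs P t t' b (layout k m e) × A e × TicksBounded m)

        tick-bounded : ∀ c (m : Mem (suc R) n) → TicksBounded m → TicksBounded (tickMem k c m)
        tick-bounded false m tb false = m⊓n≤n _ k
        tick-bounded false m tb true  = tb true
        tick-bounded true  m tb true  = m⊓n≤n _ k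
        tick-bounded true  m tb false = tb false

        upd-at : ∀ e a x → upd e a x a ≡ x
        upd-at e a x rewrite ==-refl a = refl

        upd-other : ∀ e a x d → d ≢ a → upd e a x d ≡ e d
        upd-other e a x d ne rewrite ==-false ne = refl

        module _ {v} (h : suc v ≤ D) where
          top : Fin D
          top = fromℕ< h

          var≢top : ∀ x → var (<⇒≤ h) x ≢ top
          var≢top x eq = <⇒≢ (level<v x) (fromℕ<-injective _ _ (<-≤-trans (level<v x) (<⇒≤ h)) h eq)

          agree-tail : ∀ {i} ρ e → Agree h (i ∷ ρ) e → Agree (<⇒≤ h) ρ e
          agree-tail ρ e ag x = ag (suc x)

          agree-upd : ∀ ρ e x → Agree (<⇒≤ h) ρ e → Agree (<⇒≤ h) ρ (upd e top x)
          agree-upd ρ e x ag y = trans (upd-other e top x _ (var≢top y)) (ag y)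

          agree-cons : ∀ ρ e i → e top ≡ toℕ i → Agree (<⇒≤ h) ρ e → Agree h (i ∷ ρ) e
          agree-cons ρ e i eq ag zero    = eq
          agree-cons ρ e i eq ag (suc x) = ag x

          agree-head : ∀ ρ e {i} → Agree h (i ∷ ρ) e → e top ≡ toℕ i
          agree-head ρ e ag = ag zero

          -- Induction on the number of vertices still to be tried, which `g` enumerates from `x`
          -- upwards: `anyM` recurses on that number, while the tape knows the current vertex `x`.
          -- When the vertices run out, the variable is left with the value `n`, which marks no
          -- cell.
          loop-correct : ∀ {P : Prg} {ρ c} (f : Fin n → Mem (suc R) n → Bool × Mem (suc R) n) →
            (∀ i m e → Agree h (i ∷ ρ) e → TicksBounded m → Outcome P c (Agree h (i ∷ ρ)) (layout k m e) (f i m)) →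
            ∀ l (g : Fin (suc l) → Fin n) x → x + suc l ≡ n → (∀ i → toℕ (g i) ≡ x + toℕ i) →
            ∀ m e → e top ≡ x → Agree (<⇒≤ h) ρ e → TicksBounded m →
            Outcome (loop P (prim (advM top))) (suc l * (c + 1)) (Agree (<⇒≤ h) ρ) (layout k m e) (anyM (λ i → f (g i)) m)
          loop-correct {P} {ρ} {c} f step l g x eq gi m e et ag tb
            with f (g zero) m in fm
               | step (g zero) m e (agree-cons ρ e (g zero) (trans et (trans (sym (+-identityʳ x)) (sym (gi zero)))) ag) tb
          ... | true , m₁ | t₁ , e₁ , t₁≤ , run₁ , ag₁ , tb₁ =
            t₁ , e₁ , ≤-trans t₁≤ (≤-trans (m≤m+n c 1) (m≤m+n (c + 1) _)) , runs-found run₁ , agree-tail ρ e₁ ag₁ , tb₁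
          ... | false , m₁ | t₁ , e₁ , t₁≤ , run₁ , ag₁ , tb₁ = continue l g eq gi
            where
            e₂ : Env
            e₂ = upd e₁ top (suc x)
            e₁-top : e₁ top ≡ x
            e₁-top = trans (agree-head ρ e₁ ag₁) (trans (gi zero) (+-identityʳ x))
            e₂-top : e₂ top ≡ suc x
            e₂-top = upd-at e₁ top (suc x)
            ag₂ : Agree (<⇒≤ h) ρ e₂
            ag₂ = agree-upd ρ e₁ (suc x) (agree-tail ρ e₁ ag₁)
            advance : Runs (prim (advM top)) (layout k m₁ e₁) 1 (suc x <ᵇ n) (layout k m₁ e₂)
            advance = run-adv {k = k} m₁ e₁ e₁-top 1≤n
            continue : ∀ l (g : Fin (suc l) → Fin n) → x + suc l ≡ n → (∀ i → toℕ (g i) ≡ x + toℕ i) →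
              Outcome (loop P (prim (advM top))) (suc l * (c + 1)) (Agree (<⇒≤ h) ρ) (layout k m e)
                (anyM (λ i → f (g (suc i))) m₁)
            continue zero g eq gi = t₁ + 1 , e₂ , ≤-trans (+-monoˡ-≤ 1 t₁≤) (m≤m+n (c + 1) _)
              , runs-exhausted run₁ (subst (λ z → Runs (prim (advM top)) (layout k m₁ e₁) 1 z (layout k m₁ e₂))
                  (<ᵇ-false (≤-reflexive (trans (sym eq) (+-comm x 1)))) advance) , ag₂ , tb₁
            continue (suc l) g eq gi with loop-correct f step l (λ i → g (suc i)) (suc x)
                   (trans (sym (+-suc x (suc l))) eq) (λ i → trans (gi (suc i)) (+-suc x (toℕ i))) m₁ e₂ e₂-top ag₂ tb₁
            ... | t₃ , e₃ , t₃≤ , run₃ , ag₃ , tb₃ = t₁ + (1 + t₃) , e₃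
              , ≤-trans (≤-reflexive (sym (+-assoc t₁ 1 t₃))) (+-mono-≤ (+-monoˡ-≤ 1 t₁≤) t₃≤)
              , runs-again run₁ (subst (λ z → Runs (prim (advM top)) (layout k m₁ e₁) 1 z (layout k m₁ e₂))
                  (<ᵇ-true sx<n) advance) run₃ , ag₃ , tb₃
              where
              sx<n : suc x < n
              sx<n = ≤-trans (+-monoʳ-≤ 2 (m≤m+n x l)) (≤-reflexive (trans (lem x l) eq))
                where
                lem : ∀ x l → 2 + (x + l) ≡ x + suc (suc l)
                lem x l = sym (trans (+-suc x (suc l)) (cong suc (+-suc x l)))

      compile-correct : ∀ {v} (P : Prog (suc R) v) (h : depth P ≤ D) ρ m e →
        Agree (≤-trans (scope≤depth P) h) ρ e → TicksBounded m →
        ∃[ t ] ∃[ e' ] (t ≤ cost P n × Runs (compile P h) (layout k m e) t (proj₁ (eval P ρ m)) (layout k (proj₂ (eval P ρ m)) e')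
          × Agree (≤-trans (scope≤depth P) h) ρ e' × TicksBounded (proj₂ (eval P ρ m)))
      compile-correct (ret b) h ρ m e ag tb = 1 , e , ≤-refl , run-ret {n} {k} b _ , ag , tb
      compile-correct (rel r i j) h ρ m e ag tb =
        1 , e , ≤-refl , run-rel r m e (lookup ρ i) (lookup ρ j) (ag i) (ag j) , ag , tb
      compile-correct (lt i j) h ρ m e ag tb =
        1 , e , ≤-refl , run-lt m e (lookup ρ i) (lookup ρ j) (ag i) (ag j) , ag , tb
      compile-correct (put r i j b) h ρ m e ag tb =
        1 , e , ≤-refl , run-put r b m e (lookup ρ i) (lookup ρ j) (ag i) (ag j) , ag , tb
      compile-correct (kill i) h ρ m e ag tb =
        1 , e , ≤-refl , run-kill m e (lookup ρ i) (ag i) , ag , tb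
      compile-correct (tick c) h ρ m e ag tb =
        1 , e , ≤-refl , run-tick c m e (tb c) , ag , tick-bounded c m tb
      compile-correct (seq P Q) h ρ m e ag tb
        with eval P ρ m | compile-correct P (m⊔n≤o⇒m≤o _ _ h) ρ m e ag tb
      ... | true , m₁ | t₁ , e₁ , t₁≤ , run₁ , ag₁ , tb₁ =
        let (t₂ , e₂ , t₂≤ , run₂ , ag₂ , tb₂) = compile-correct Q (m⊔n≤o⇒n≤o _ _ h) ρ m₁ e₁ ag₁ tb₁
        in t₁ + t₂ , e₂ , +-mono-≤ t₁≤ t₂≤ , runs-then run₁ run₂ , ag₂ , tb₂
      ... | false , m₁ | t₁ , e₁ , t₁≤ , run₁ , ag₁ , tb₁ =
        let (t₂ , e₂ , t₂≤ , run₂ , ag₂ , tb₂) = compile-correct Q (m⊔n≤o⇒n≤o _ _ h) ρ m₁ e₁ ag₁ tb₁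
        in t₁ + t₂ , e₂ , +-mono-≤ t₁≤ t₂≤ , runs-else run₁ run₂ , ag₂ , tb₂
      compile-correct (ite P A B) h ρ m e ag tb
        with eval P ρ m | compile-correct P (m⊔n≤o⇒m≤o _ _ h) ρ m e ag tb
      ... | true , m₁ | t₁ , e₁ , t₁≤ , run₁ , ag₁ , tb₁ =
        let (t₂ , e₂ , t₂≤ , run₂ , ag₂ , tb₂) =
              compile-correct A (m⊔n≤o⇒m≤o _ _ (m⊔n≤o⇒n≤o (depth P) _ h)) ρ m₁ e₁ ag₁ tb₁
        in t₁ + t₂ , e₂ , +-mono-≤ t₁≤ (≤-trans t₂≤ (m≤m+n _ _)) , runs-then run₁ run₂ , ag₂ , tb₂
      ... | false , m₁ | t₁ , e₁ , t₁≤ , run₁ , ag₁ , tb₁ =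
        let (t₂ , e₂ , t₂≤ , run₂ , ag₂ , tb₂) =
              compile-correct B (m⊔n≤o⇒n≤o _ _ (m⊔n≤o⇒n≤o (depth P) _ h)) ρ m₁ e₁ ag₁ tb₁
        in t₁ + t₂ , e₂ , +-mono-≤ t₁≤ (≤-trans t₂≤ (m≤n+m _ _)) , runs-else run₁ run₂ , ag₂ , tb₂
      compile-correct {v} (any P) h ρ m e ag tb = go 1≤n
        where
        h' : suc v ≤ D
        h' = ≤-trans (scope≤depth P) h
        go : 1 ≤ n → ∃[ t ] ∃[ e' ] (t ≤ 1 + n * (cost P n + 1)
          × Runs (compile (any P) h) (layout k m e) t (proj₁ (eval (any P) ρ m)) (layout k (proj₂ (eval (any P) ρ m)) e')
          × Agree (≤-trans (scope≤depth (any P)) h) ρ e' × TicksBounded (proj₂ (eval (any P) ρ m)))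
        go (s≤s {n = l} _) =
          let (t , e' , t≤ , run , ag' , tb') = loop-correct h' (λ i m → eval P (i ∷ ρ) m)
                (λ i m e ag tb → compile-correct P h (i ∷ ρ) m e ag tb) l (λ i → i) 0 refl (λ _ → refl)
                m (upd e (top h') 0) (upd-at e (top h') 0) (agree-upd h' ρ e 0 ag) tb
          in 1 + t , e' , s≤s t≤ , runs-then (run-reset {k = k} (top h') m e) run , ag' , tb'

-- From the input string to the initial tape

module Loading where
  open import Defs hiding (sym; n)
  open Transduction
  open SweepPrograms
  open TapeLayout
  open Compilation
  open import Data.Vec as Vec using (Vec; []; _∷_)

  open Mem

  tabulate-↑ : ∀ {A : Set} m {n} (f : Fin (m + n) → A) →
    tabulate f ≡ tabulate (λ i → f (i ↑ˡ n)) ++ tabulate (λ j → f (m ↑ʳ j))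
  tabulate-↑ zero    f = refl
  tabulate-↑ (suc m) f = cong (f zero ∷_) (tabulate-↑ m (λ i → f (suc i)))

  tabulate-combine : ∀ {A : Set} m {n} (f : Fin (m * n) → A) →
    tabulate f ≡ concat (tabulate (λ i → tabulate (λ j → f (combine {m} {n} i j))))
  tabulate-combine zero        f = refl
  tabulate-combine (suc m) {n} f = trans (tabulate-↑ n f)
    (cong (tabulate (λ i → f (i ↑ˡ (m * n))) ++_) (tabulate-combine m (λ q → f (n ↑ʳ q))))

  module Loader (R D : ℕ) where
    open Blocks R D
    open Compiler R D

    sufB : Bool → Blk
    sufB b = blk suf false false false false false false false (b ∷ none) none none

    -- A finite automaton cannot tell where the matrix ends. Every bit after the separator is loaded
    -- as a budget cell at first, and `boot` converts the leading n·n of them into matrix cells.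
    intro : Bool × Bool → Bool → (Bool × Bool) × Blk
    intro (first , true)  b     = (first , true) , sufB b
    intro (first , false) true  =
      (false , false) , blk hdr false first false false false false false (true ∷ none) none none
    intro (first , false) false = (first , true) , blk sep false false false false false false false none none none

    -- Only units of the counter `true` are taken off the budget in the output; the counter `false`
    -- measures the packing against `k` without affecting the result.
    contract : Blk → Maybe Bool
    contract x = if gone x ∨ tick₂ x then nothing else just (bitOf x)

    -- Header counters: cnt₁ counts finished rows, cnt₂ counts the finished cells of the current row.
    markM : Mealy
    markM = record
      { codeQ = code-× code-Bool (code-× code-Bool (code-× code-Bool (code-× code-Bool (code-× code-Bool code-Bool))))
      ; q₀ = true , false , false , false , false , false
      ; trans-δ = δ' ; verdict = λ (_ , _ , _ , _ , mr , _) → not mr }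
      where
      δ' : Bool × Bool × Bool × Bool × Bool × Bool → Blk → (Bool × Bool × Bool × Bool × Bool × Bool) × Blk
      δ' (start , r , c , fb , mr , done) x with kind x
      -- `fb` means that an unfinished column was passed, `mr` that a second one follows and the row
      -- stays incomplete after this sweep. The first header cell tells whether the current row or
      -- column is number 0.
      ... | hdr = (false , (if start then not (cnt₁ x) else r) , (if start then not (cnt₂ x) else c)
                   , fb ∨ not (cnt₂ x) , mr ∨ (fb ∧ not (cnt₂ x)) , done)
                  , record x { cnt₂ = cnt₂ x ∨ not fb }
      -- The first remaining budget cell becomes the next matrix cell; `done` protects the ones
      -- behind it.
      ... | suf = (start , r , c , fb , mr , true)
                  , (if done then x else record x { kind = mat ; row₀ = r ; col₀ = c })
      ... | _   = (start , r , c , fb , mr , done) , x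

    nextRowM : Mealy
    nextRowM = record
      { codeQ = code-× code-Bool code-Bool ; q₀ = false , false ; trans-δ = δ' ; verdict = λ (_ , mr) → not mr }
      where
      δ' : Bool × Bool → Blk → (Bool × Bool) × Blk
      δ' (fa , mr) x with kind x
      ... | hdr = (fa ∨ not (cnt₁ x) , mr ∨ (fa ∧ not (cnt₁ x))) , record x { cnt₁ = cnt₁ x ∨ not fa ; cnt₂ = false }
      ... | _   = (fa , mr) , x

    isHdr : Blk → Bool
    isHdr x with kind x
    ... | hdr = true
    ... | _   = false

    -- The bodies `retM true` make the loops repeat: the inner loop ends with a complete row, the
    -- outer one with the last row.
    boot : Prg
    boot = loop (cond (loop (prim markM) (prim (retM true))) (prim nextRowM) (prim nextRowM)) (prim (retM true))

    -- Without header cells `boot` would turn a cell behind the separator into a matrix cell, so the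
    -- empty graph bypasses both loading and program.
    wrap : Prg → Prg
    wrap P = cond (prim (testM isHdr)) (cond boot P P) (prim (retM true))

    module _ {n : ℕ} (bits : Fin n → Fin n → Bool) (k : ℕ) where

      cellB : Bool → Fin n × Fin n → Blk
      cellB done (i , j) =
        if done
        then blk mat (toℕ i ≡ᵇ 0) (toℕ j ≡ᵇ 0) false false false false false (bits i j ∷ none) none none
        else sufB (bits i j)

      bodyB : ℕ → Fin (n * n) → Blk
      bodyB m q = cellB (toℕ q <ᵇ m) (remQuot n q)

      bodyB-combine : ∀ m i j → bodyB m (combine i j) ≡ cellB (n * toℕ i + toℕ j <ᵇ m) (i , j)
      bodyB-combine m i j = cong₂ (λ x y → cellB (x <ᵇ m) y) (toℕ-combine i j) (remQuot-combine i j)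

      hdrB : ℕ → ℕ → Fin n → Blk
      hdrB a b p = blk hdr false (toℕ p ≡ᵇ 0) (toℕ p <ᵇ a) (toℕ p <ᵇ b) false false false (true ∷ none) none none

      sepB : Blk
      sepB = blk sep false false false false false false false none none none

      -- The loading invariant: `a` rows finished, `b` cells of the current row finished, `m` cells
      -- converted in all.
      partial : ℕ → ℕ → ℕ → List Blk
      partial a b m = tabulate (hdrB a b) ++ sepB ∷ tabulate (bodyB m) ++ tabulate {n = k} (λ _ → sufB true) ++ sufB false ∷ []

      private
        pass-partial : ∀ {S : Set} (δ : S → Blk → S × Blk) a b m a' b' m' {z} (α β : ℕ → S) (γ : S) →
          (∀ p → δ (α (toℕ p)) (hdrB a b p) ≡ (α (suc (toℕ p)) , hdrB a' b' p)) →
          δ (α n) sepB ≡ (β 0 , sepB) →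
          (∀ q → δ (β (toℕ q)) (bodyB m q) ≡ (β (suc (toℕ q)) , bodyB m' q)) →
          β (n * n) ≡ γ → δ γ (sufB true) ≡ (γ , sufB true) → δ γ (sufB false) ≡ (z , sufB false) →
          pass δ (α 0) (partial a b m) ≡ (z , partial a' b' m')
        pass-partial δ a b m a' b' m' α β γ ph ps pb pj pf pe =
          pass-++ δ (pass-tabulate δ α (hdrB a b) (hdrB a' b') ph) (pass-∷ δ ps
            (pass-++ δ (trans (pass-tabulate δ β (bodyB m) (bodyB m') pb) (cong (_, tabulate (bodyB m')) pj))
              (pass-++ δ (pass-tabulate δ {n = k} (λ _ → γ) (λ _ → sufB true) (λ _ → sufB true) (λ _ → pf))
                (pass-∷ δ {ys = []} pe refl))))

        count-found : ∀ j p → (j <ᵇ p) ∨ not (p <ᵇ j) ≡ (j <ᵇ suc p)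
        count-found j p with <-cmp j p
        ... | tri< j<p _ _ rewrite <ᵇ-true j<p | <ᵇ-true (m<n⇒m<1+n j<p) = refl
        ... | tri≈ _ refl _ rewrite <ᵇ-false (≤-refl {j}) | <ᵇ-true (n<1+n j) = refl
        ... | tri> _ _ p<j rewrite <ᵇ-false (<⇒≤ p<j) | <ᵇ-true p<j | <ᵇ-false p<j = refl

        count-mr : ∀ j p → (suc j <ᵇ p) ∨ ((j <ᵇ p) ∧ not (p <ᵇ j)) ≡ (j <ᵇ p)
        count-mr j p with <-cmp j p
        ... | tri< j<p _ _ rewrite <ᵇ-true j<p | <ᵇ-false (<⇒≤ j<p) = ∨-zeroʳ (suc j <ᵇ p)
        ... | tri≈ _ refl _ rewrite <ᵇ-false (≤-refl {j}) | <ᵇ-false (n≤1+n j) = refl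
        ... | tri> _ _ p<j rewrite <ᵇ-false (<⇒≤ p<j) | <ᵇ-false (<⇒≤ (m<n⇒m<1+n p<j)) = refl

        record-start : ∀ p i → (if p ≡ᵇ 0 then not (p <ᵇ i) else ((0 <ᵇ p) ∧ (i ≡ᵇ 0))) ≡ (i ≡ᵇ 0)
        record-start zero    zero    = refl
        record-start zero    (suc i) = refl
        record-start (suc p) i       = refl

      run-mark : ∀ (i j : Fin n) →
        Runs (prim markM) (partial (toℕ i) (toℕ j) (n * toℕ i + toℕ j)) 1 (not (suc (toℕ j) <ᵇ n))
          (partial (toℕ i) (suc (toℕ j)) (suc (n * toℕ i + toℕ j)))
      run-mark i j = runs-prim (pass-partial (Mealy.trans-δ markM) (toℕ i) (toℕ j) m (toℕ i) (suc (toℕ j)) (suc m) α β (β (n * n))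
          (λ p → cong₂ _,_
            (cong₂ (λ u (v , w , z) → false , u , v , w , z , false) (record-start (toℕ p) (toℕ i))
              (cong₂ _,_ (record-start (toℕ p) (toℕ j))
                 (cong₂ _,_ (count-found (toℕ j) (toℕ p)) (count-mr (toℕ j) (toℕ p)))))
            (cong (λ z → record (hdrB (toℕ i) (toℕ j) p) { cnt₂ = z }) (count-found (toℕ p) (toℕ j))))
          sep-step cell refl suf-step end-step)
        where
        m : ℕ
        m = n * toℕ i + toℕ j
        m≡ : toℕ (combine i j) ≡ m
        m≡ = toℕ-combine i j
        m<nn : m < n * n
        m<nn = subst (_< n * n) m≡ (toℕ<n (combine i j))
        α : ℕ → Bool × Bool × Bool × Bool × Bool × Bool
        α p = (p ≡ᵇ 0) , ((0 <ᵇ p) ∧ (toℕ i ≡ᵇ 0)) , ((0 <ᵇ p) ∧ (toℕ j ≡ᵇ 0)) , (toℕ j <ᵇ p) , (suc (toℕ j) <ᵇ p) , false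
        β : ℕ → Bool × Bool × Bool × Bool × Bool × Bool
        β q = false , (toℕ i ≡ᵇ 0) , (toℕ j ≡ᵇ 0) , (toℕ j <ᵇ n) , (suc (toℕ j) <ᵇ n) , (m <ᵇ q)
        positive : ∀ {n} → Fin n → ∀ b → (n ≡ᵇ 0) ≡ false × (0 <ᵇ n) ∧ b ≡ b
        positive {suc n} _ b = refl , refl
        sep-step : Mealy.trans-δ markM (α n) sepB ≡ (β 0 , sepB)
        sep-step rewrite proj₁ (positive i true) | proj₂ (positive i (toℕ i ≡ᵇ 0)) | proj₂ (positive i (toℕ j ≡ᵇ 0)) = refl
        suf-step : Mealy.trans-δ markM (β (n * n)) (sufB true) ≡ (β (n * n) , sufB true)
        suf-step rewrite <ᵇ-true m<nn = refl
        end-step : Mealy.trans-δ markM (β (n * n)) (sufB false) ≡ (β (n * n) , sufB false)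
        end-step rewrite <ᵇ-true m<nn = refl
        cell : ∀ q → Mealy.trans-δ markM (β (toℕ q)) (bodyB m q) ≡ (β (suc (toℕ q)) , bodyB (suc m) q)
        cell q with <-cmp (toℕ q) m
        ... | tri< q<m _ _ rewrite <ᵇ-true q<m | <ᵇ-true (m<n⇒m<1+n q<m) | <ᵇ-false (<⇒≤ q<m) | <ᵇ-false q<m = refl
        ... | tri≈ _ q≡m _ = subst (λ q → Mealy.trans-δ markM (β (toℕ q)) (bodyB m q) ≡ (β (suc (toℕ q)) , bodyB (suc m) q))
                (toℕ-injective (trans m≡ (sym q≡m)))
                (trans (cong₂ (λ x y → Mealy.trans-δ markM (β x) y) m≡ (bodyB-combine m i j)) (trans diagonal
                  (cong₂ (λ x y → β (suc x) , y) (sym m≡) (sym (bodyB-combine (suc m) i j)))))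
          where
          diagonal : Mealy.trans-δ markM (β m) (cellB (m <ᵇ m) (i , j)) ≡ (β (suc m) , cellB (m <ᵇ suc m) (i , j))
          diagonal rewrite <ᵇ-false (≤-refl {m}) | <ᵇ-true (n<1+n m) = refl
        ... | tri> _ _ m<q rewrite <ᵇ-false (<⇒≤ m<q) | <ᵇ-false m<q | <ᵇ-true m<q | <ᵇ-true (m<n⇒m<1+n m<q) = refl

      run-nextRow : ∀ i b m → Runs (prim nextRowM) (partial i b m) 1 (not (suc i <ᵇ n)) (partial (suc i) 0 m)
      run-nextRow i b m = runs-prim (pass-partial (Mealy.trans-δ nextRowM) i b m (suc i) 0 m α (λ _ → α n) (α n)
        (λ p → cong₂ _,_ (cong₂ _,_ (count-found i (toℕ p)) (count-mr i (toℕ p)))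
           (cong (λ z → record (hdrB i b p) { cnt₁ = z ; cnt₂ = false }) (count-found (toℕ p) i)))
        refl cell refl refl refl)
        where
        α : ℕ → Bool × Bool
        α p = (i <ᵇ p) , (suc i <ᵇ p)
        cell : ∀ q → Mealy.trans-δ nextRowM (α n) (bodyB m q) ≡ (α n , bodyB m q)
        cell q with toℕ q <ᵇ m
        ... | true  = refl
        ... | false = refl

      private
        rowLoop : Prg
        rowLoop = loop (prim markM) (prim (retM true))

        run-row : ∀ (i : Fin n) l j → j + suc l ≡ n → ∃[ t ] (t ≤ suc l * 2 ×
          Runs rowLoop (partial (toℕ i) j (n * toℕ i + j)) t true (partial (toℕ i) n (n * suc (toℕ i))))
        run-row i l j eq = go l eq
          where
          j<n : j < n
          j<n = ≤-trans (≤-reflexive (+-comm 1 j)) (≤-trans (+-monoʳ-≤ j (s≤s z≤n)) (≤-reflexive eq))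
          marked : Runs (prim markM) (partial (toℕ i) j (n * toℕ i + j)) 1 (not (suc j <ᵇ n))
                     (partial (toℕ i) (suc j) (n * toℕ i + suc j))
          marked = subst₂ (λ x y → Runs (prim markM) (partial (toℕ i) x (n * toℕ i + x)) 1 (not (suc x <ᵇ n))
                      (partial (toℕ i) (suc x) y)) (toℕ-fromℕ< j<n)
                      (trans (cong (λ x → suc (n * toℕ i + x)) (toℕ-fromℕ< j<n)) (sym (+-suc (n * toℕ i) j)))
                      (run-mark i (fromℕ< j<n))
          go : ∀ l → j + suc l ≡ n → ∃[ t ] (t ≤ suc l * 2 ×
            Runs rowLoop (partial (toℕ i) j (n * toℕ i + j)) t true (partial (toℕ i) n (n * suc (toℕ i))))
          go zero eq = 1 , s≤s z≤n , runs-found (runs-≡ marked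
              (cong not (<ᵇ-false {suc j} (≤-reflexive (sym sj≡n)))) (cong₂ (partial (toℕ i)) sj≡n
                (trans (cong (n * toℕ i +_) sj≡n) (trans (+-comm (n * toℕ i) n) (sym (*-suc n (toℕ i)))))))
            where
            sj≡n : suc j ≡ n
            sj≡n = trans (+-comm 1 j) eq
          go (suc l) eq =
            let (t , t≤ , run) = run-row i l (suc j) (trans (sym (+-suc j (suc l))) eq)
            in suc (suc t) , s≤s (s≤s t≤) , runs-again
                 (runs-≡ marked (cong not (<ᵇ-true {suc j} sj<n)) refl)
                 (run-ret {n} {k} true _) run
            where
            sj<n : suc j < n
            sj<n = ≤-trans (+-monoʳ-≤ 2 (m≤m+n j l))
              (≤-reflexive (trans (sym (trans (+-suc j (suc l)) (cong suc (+-suc j l)))) eq))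

        run-rows : ∀ l i → i + suc l ≡ n → 1 ≤ n → ∃[ t ] (t ≤ suc l * (2 + n * 2) ×
          Runs boot (partial i 0 (n * i)) t true (partial n 0 (n * n)))
        run-rows l i eq (s≤s {n = n'} _) = go l eq
          where
          i<n : i < n
          i<n = ≤-trans (≤-reflexive (+-comm 1 i)) (≤-trans (+-monoʳ-≤ i (s≤s z≤n)) (≤-reflexive eq))
          row : ∃[ t ] (t ≤ n * 2 × Runs rowLoop (partial i 0 (n * i)) t true (partial i n (n * suc i)))
          row with run-row (fromℕ< i<n) n' 0 refl
          ... | t , t≤ , run = t , t≤ , subst₂ (λ x y → Runs rowLoop (partial x 0 y) t true (partial x n (n * suc x)))
                  (toℕ-fromℕ< i<n) (trans (+-identityʳ _) (cong (n *_) (toℕ-fromℕ< i<n))) run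
          body : ∀ {b} → not (suc i <ᵇ n) ≡ b → ∃[ t ] (t ≤ 1 + n * 2 ×
            Runs (cond rowLoop (prim nextRowM) (prim nextRowM)) (partial i 0 (n * i)) t b (partial (suc i) 0 (n * suc i)))
          body refl = let (t , t≤ , run) = row in
            t + 1 , ≤-trans (+-monoˡ-≤ 1 t≤) (≤-reflexive (+-comm (n * 2) 1)) , runs-then run (run-nextRow i n (n * suc i))
          go : ∀ l → i + suc l ≡ n → ∃[ t ] (t ≤ suc l * (2 + n * 2) ×
            Runs boot (partial i 0 (n * i)) t true (partial n 0 (n * n)))
          go zero eq =
            let (t , t≤ , run) = body (cong not (<ᵇ-false {suc i} (≤-reflexive (sym si≡n))))
            in t , ≤-trans t≤ (≤-trans (n≤1+n _) (m≤m+n (2 + n * 2) _)) , runs-found (runs-≡ run refl (cong (λ x → partial x 0 (n * x)) si≡n))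
            where
            si≡n : suc i ≡ n
            si≡n = trans (+-comm 1 i) eq
          go (suc l) eq =
            let (t , t≤ , run) = body (cong not (<ᵇ-true {suc i} si<n))
                (t' , t'≤ , run') = run-rows l (suc i) (trans (sym (+-suc i (suc l))) eq) (s≤s z≤n)
            in t + (1 + t') , ≤-trans (≤-reflexive (sym (+-assoc t 1 t')))
                 (+-mono-≤ (≤-trans (+-monoˡ-≤ 1 t≤) (≤-reflexive (+-comm (1 + n * 2) 1))) t'≤)
               , runs-again run (run-ret {n} {k} true _) run'
            where
            si<n : suc i < n
            si<n = ≤-trans (+-monoʳ-≤ 2 (m≤m+n i l))
              (≤-reflexive (trans (sym (trans (+-suc i (suc l)) (cong suc (+-suc i l)))) eq))

      run-boot : 1 ≤ n → ∃[ t ] (t ≤ n * (2 + n * 2) × Runs boot (partial 0 0 0) t true (partial n 0 (n * n)))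
      run-boot (s≤s {n = n'} z) =
        let (t , t≤ , run) = run-rows n' 0 refl (s≤s z)
        in t , t≤ , subst (λ x → Runs boot (partial 0 0 x) t true (partial n 0 (n * n))) (*-zeroʳ n) run

      -- The value `n` marks no cell. Freshly loaded blocks carry no marks, so every variable starts
      -- out of range.
      startEnv : Env
      startEnv _ = n

      private
        tabulate-none : ∀ m {f : Fin m → Bool} → (∀ d → f d ≡ false) → none ≡ Vec.tabulate f
        tabulate-none zero    h = refl
        tabulate-none (suc m) h = cong₂ _∷_ (sym (h zero)) (tabulate-none m (λ d → h (suc d)))

        marks-none : ∀ (i : Fin n) → none ≡ marks (toℕ i) startEnv
        marks-none i = tabulate-none D (λ _ → ≡ᵇ-false (<⇒≢ (toℕ<n i)))

      partial-layout : partial n 0 (n * n) ≡ layout k (startMem bits) startEnv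
      partial-layout = cong₂ _++_
        (tabulate-≡ λ j → cong₂ (λ x y → blk hdr false (toℕ j ≡ᵇ 0) x false false false false (true ∷ none) none y)
          (<ᵇ-true (toℕ<n j)) (marks-none j))
        (cong (sepB ∷_) (cong (_++ (tabulate {n = k} (λ _ → sufB true) ++ sufB false ∷ []))
          (trans (tabulate-combine n (bodyB (n * n))) (cong concat (tabulate-≡ λ i → tabulate-≡ λ j → cell i j)))))
        where
        cell : ∀ i j → bodyB (n * n) (combine i j) ≡ matC k (startMem bits) startEnv i j
        cell i j = trans (bodyB-combine (n * n) i j)
          (trans (cong (λ x → cellB x (i , j)) (<ᵇ-true (subst (_< n * n) (toℕ-combine i j) (toℕ<n (combine i j)))))
            (cong₂ (λ x (y , z) → blk mat (toℕ i ≡ᵇ 0) (toℕ j ≡ᵇ 0) false false false false false (bits i j ∷ x) y z)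
              (tabulate-none R (λ _ → refl)) (cong₂ _,_ (marks-none i) (marks-none j))))

-- Polynomial running time and the output string

module Execution where
  open import Defs hiding (sym; n)
  open Transduction
  open SweepPrograms
  open TapeLayout
  open Compilation
  open Loading
  open import Data.List using (map; replicate; lookup)
  open import Data.Vec as Vec using ([]; _∷_)

  open Mem

  -- The base `suc N` is positive, so exponents may be raised when bounds are added; quantifying
  -- over all `n ≤ N` builds monotonicity into the bound.
  Polynomial : (ℕ → ℕ) → Set
  Polynomial f = ∃[ c ] ∃[ d ] (∀ {n N} → n ≤ N → f n ≤ c * suc N ^ d)

  poly-const : ∀ a → Polynomial (λ _ → a)
  poly-const a = a , 0 , λ _ → ≤-reflexive (sym (*-identityʳ a))

  poly-id : Polynomial (λ n → n)
  poly-id = 1 , 1 , λ {n} {N} le → ≤-trans le (≤-trans (n≤1+n N) (≤-reflexive (sym (trans (+-identityʳ _) (*-identityʳ (suc N))))))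

  poly-+ : ∀ {f g} → Polynomial f → Polynomial g → Polynomial (λ n → f n + g n)
  poly-+ (a , d , p) (b , e , q) = a + b , d + e , λ {n} {N} le →
    ≤-trans (+-mono-≤ (≤-trans (p le) (*-monoʳ-≤ a (^-monoʳ-≤ (suc N) (m≤m+n d e)))) (≤-trans (q le) (*-monoʳ-≤ b (^-monoʳ-≤ (suc N) (m≤n+m e d)))))
      (≤-reflexive (sym (*-distribʳ-+ (suc N ^ (d + e)) a b)))

  poly-* : ∀ {f g} → Polynomial f → Polynomial g → Polynomial (λ n → f n * g n)
  poly-* (a , d , p) (b , e , q) = a * b , d + e , λ {n} {N} le →
    ≤-trans (*-mono-≤ (p le) (q le))
      (≤-reflexive (trans (lem a (suc N ^ d) b (suc N ^ e)) (cong (a * b *_) (sym (^-distribˡ-+-* (suc N) d e)))))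
    where
    lem : ∀ a x b y → a * x * (b * y) ≡ a * b * (x * y)
    lem = solve-∀

  poly-cost : ∀ {r v} (P : Prog r v) → Polynomial (cost P)
  poly-cost (ret _)       = poly-const 1
  poly-cost (rel _ _ _)   = poly-const 1
  poly-cost (lt _ _)      = poly-const 1
  poly-cost (put _ _ _ _) = poly-const 1
  poly-cost (kill _)      = poly-const 1
  poly-cost (tick _)      = poly-const 1
  poly-cost (seq P Q)     = poly-+ (poly-cost P) (poly-cost Q)
  poly-cost (ite P A B)   = poly-+ (poly-cost P) (poly-+ (poly-cost A) (poly-cost B))
  poly-cost (any P)       = poly-+ (poly-const 1) (poly-* poly-id (poly-+ (poly-cost P) (poly-const 1)))

  -- For `N ≥ 1` one has `suc N ≤ 2 * N`, so the change of base costs the factor `2 ^ d`.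
  poly-bound : ∀ {f} → Polynomial f → ∃[ c ] ∃[ d ] (∀ N → 1 ≤ N → f N ≤ c * N ^ d + c)
  poly-bound {f} (a , d , p) = a * 2 ^ d , d , λ N 1≤N → begin
    f N                     ≤⟨ p ≤-refl ⟩
    a * suc N ^ d           ≤⟨ *-monoʳ-≤ a (^-monoˡ-≤ d (+-monoˡ-≤ N 1≤N)) ⟩
    a * (N + N) ^ d         ≡⟨ cong (λ z → a * (N + z) ^ d) (+-identityʳ N) ⟨
    a * (2 * N) ^ d         ≡⟨ cong (a *_) (dist 2 N d) ⟩
    a * (2 ^ d * N ^ d)     ≡⟨ *-assoc a (2 ^ d) (N ^ d) ⟨
    a * 2 ^ d * N ^ d       ≤⟨ m≤m+n _ _ ⟩
    a * 2 ^ d * N ^ d + a * 2 ^ d ∎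
    where
    open ≤-Reasoning
    dist : ∀ x y d → (x * y) ^ d ≡ x ^ d * y ^ d
    dist x y zero    = refl
    dist x y (suc d) = trans (cong (x * y *_) (dist x y d)) (lem x y (x ^ d) (y ^ d))
      where
      lem : ∀ a b c d → a * b * (c * d) ≡ a * c * (b * d)
      lem = solve-∀

  alive : ∀ {r n} → Mem r n → Fin n → Bool
  alive m i = not (dead m i)

  survivors : ∀ {r n} → Mem r n → List (Fin n)
  survivors m = filterᵇ (alive m) (allFin _)

  -- The input string with the cells of dead vertices and of ticked units deleted.
  remains : ∀ {R n} → ℕ → Mem (suc R) n → List Bool
  remains k m = map (λ _ → true) (survivors m) ++ false ∷
    concatMap (λ i → map (rels m zero i) (survivors m)) (survivors m)
    ++ replicate (k ∸ ticks m true) true ++ false ∷ []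

  -- New vertices are positions in the list. For the survivors in their input order, this is the
  -- numbering that deleting rows and columns produces.
  induced : ∀ (G : Graph) → List (Fin (Graph.n G)) → Graph
  induced G vs = record
    { n = length vs ; adj = λ a b → adj G (lookup vs a) (lookup vs b)
    ; sym = λ a b → Graph.sym G (lookup vs a) (lookup vs b) ; irrefl = λ a → irrefl G (lookup vs a) }

  module Realisation {R : ℕ} (P : Prog (suc R) 0) where
    private
      D : ℕ
      D = depth P

    open Blocks R D
    open Compiler R D
    open Loader R D
    open Job code-Blk (code-× code-Bool code-Bool) (true , false) intro (wrap (compile P ≤-refl)) contract

    machine : TM
    machine = Simulation.machine transducer

    private
      expand-body : ∀ f bs → expand (f , true) bs ≡ map sufB bs
      expand-body f []       = refl
      expand-body f (b ∷ bs) = cong (sufB b ∷_) (expand-body f bs)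

      hdrX : Bool → Blk
      hdrX c = blk hdr false c false false false false false (true ∷ none) none none

      expand-header : ∀ n first bs → expand (first , false) (replicate n true ++ false ∷ bs) ≡
        tabulate {n = n} (λ p → hdrX (first ∧ (toℕ p ≡ᵇ 0))) ++ blk sep false false false false false false false none none none ∷ map sufB bs
      expand-header zero    first bs = cong (_ ∷_) (expand-body first bs)
      expand-header (suc n) first bs = cong₂ _∷_ (cong hdrX (sym (∧-identityʳ first)))
        (trans (expand-header n false bs) (cong (_++ (blk sep false false false false false false false none none none ∷ map sufB bs))
          (tabulate-≡ {n} {Blk} λ p → cong hdrX (sym (∧-zeroʳ first)))))

      map-replicate-tab : ∀ k → map sufB (replicate k true) ≡ tabulate {n = k} (λ _ → sufB true)
      map-replicate-tab zero    = refl
      map-replicate-tab (suc k) = cong (_ ∷_) (map-replicate-tab k)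

      expand-matrix : ∀ {n} (bits : Fin n → Fin n → Bool) →
        map sufB (concatMap (λ i → map (bits i) (allFin n)) (allFin n)) ≡ tabulate (bodyB bits 0 0)
      expand-matrix {n} bits = begin
        map sufB (concat (map (λ i → map (bits i) (allFin n)) (allFin n))) ≡⟨ cong (λ z → map sufB (concat z)) (map-tabulate id (λ i → map (bits i) (allFin n))) ⟩
        map sufB (concat (tabulate (λ i → map (bits i) (allFin n)))) ≡⟨ concat-map {f = sufB} (tabulate (λ i → map (bits i) (allFin n))) ⟨
        concat (map (map sufB) (tabulate (λ i → map (bits i) (allFin n)))) ≡⟨ cong concat (map-tabulate (λ i → map (bits i) (allFin n)) (map sufB)) ⟩
        concat (tabulate (λ i → map sufB (map (bits i) (allFin n)))) ≡⟨ cong concat (tabulate-≡ {n} {List Blk} λ i →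
          trans (cong (map sufB) (map-tabulate id (bits i))) (trans (map-tabulate (bits i) sufB) (tabulate-≡ λ j → sym (bodyB-combine bits 0 0 i j)))) ⟩
        concat (tabulate (λ i → tabulate (λ j → bodyB bits 0 0 (combine {n} {n} i j)))) ≡⟨ tabulate-combine n (bodyB bits 0 0) ⟨
        tabulate (bodyB bits 0 0) ∎
        where open ≡-Reasoning

    expand-encode : ∀ G k → expand (true , false) (encode G k) ≡ partial (adj G) k 0 0 0
    expand-encode G k = trans (cong (expand (true , false)) (++-assoc (replicate (Graph.n G) true) _ _))
      (trans (expand-header (Graph.n G) true _)
        (cong (λ z → tabulate (hdrB (adj G) k 0 0) ++ sepB (adj G) k ∷ z)
          (trans (map-++ sufB (concatMap _ (allFin (Graph.n G))) (unary k))
            (cong₂ _++_ (expand-matrix (adj G)) (trans (map-++ sufB (replicate k true) _) (cong (_++ _) (map-replicate-tab k)))))))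

    private
      mapMaybe-tabulate : ∀ {l n} {B : Set} (g : Blk → Maybe B) (d : Fin n → Bool) (b : Fin n → B) (φ : Fin l → Fin n) (c : Fin l → Blk) →
        (∀ i → g (c i) ≡ (if d (φ i) then nothing else just (b (φ i)))) →
        mapMaybe g (tabulate c) ≡ map b (filterᵇ (λ i → not (d i)) (tabulate φ))
      mapMaybe-tabulate {zero}  g d b φ c h = refl
      mapMaybe-tabulate {suc l} g d b φ c h rewrite h zero with d (φ zero)
      ... | true  = mapMaybe-tabulate g d b (φ ∘ suc) (c ∘ suc) (h ∘ suc)
      ... | false = cong (b (φ zero) ∷_) (mapMaybe-tabulate g d b (φ ∘ suc) (c ∘ suc) (h ∘ suc))

      mapMaybe-concat : ∀ {l n} {B : Set} (g : Blk → Maybe B) (d : Fin n → Bool) (b : Fin n → List B) (φ : Fin l → Fin n) (c : Fin l → List Blk) →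
        (∀ i → mapMaybe g (c i) ≡ (if d (φ i) then [] else b (φ i))) →
        mapMaybe g (concat (tabulate c)) ≡ concatMap b (filterᵇ (λ i → not (d i)) (tabulate φ))
      mapMaybe-concat {zero}  g d b φ c h = refl
      mapMaybe-concat {suc l} g d b φ c h rewrite mapMaybe-++ g (c zero) (concat (tabulate (c ∘ suc))) | h zero with d (φ zero)
      ... | true  = mapMaybe-concat g d b (φ ∘ suc) (c ∘ suc) (h ∘ suc)
      ... | false = cong (b (φ zero) ++_) (mapMaybe-concat g d b (φ ∘ suc) (c ∘ suc) (h ∘ suc))

      mapMaybe-none : ∀ {l} {B : Set} (g : Blk → Maybe B) (c : Fin l → Blk) → (∀ i → g (c i) ≡ nothing) → mapMaybe g (tabulate c) ≡ []
      mapMaybe-none {zero}  g c h = refl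
      mapMaybe-none {suc l} g c h rewrite h zero = mapMaybe-none g (c ∘ suc) (h ∘ suc)

      mapMaybe-suffix : ∀ k t (c : Fin k → Blk) → (∀ p → contract (c p) ≡ (if toℕ p <ᵇ t then nothing else just true)) →
        mapMaybe contract (tabulate c) ≡ replicate (k ∸ t) true
      mapMaybe-suffix zero    zero    c h = refl
      mapMaybe-suffix zero    (suc t) c h = refl
      mapMaybe-suffix (suc k) zero    c h rewrite h zero = cong (true ∷_) (mapMaybe-suffix k zero (c ∘ suc) (h ∘ suc))
      mapMaybe-suffix (suc k) (suc t) c h rewrite h zero = mapMaybe-suffix k t (c ∘ suc) (h ∘ suc)

    contract-layout : ∀ {n} k (m : Mem (suc R) n) e → mapMaybe contract (layout k m e) ≡ remains k m
    contract-layout {n} k m e =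
      trans (mapMaybe-++ contract (tabulate (hdrC k m e)) _) (cong₂ _++_
        (mapMaybe-tabulate contract (dead m) (λ _ → true) id (hdrC k m e) header)
        (cong (false ∷_) (trans (mapMaybe-++ contract (concat (tabulate λ i → tabulate (matC k m e i))) _) (cong₂ _++_
          (mapMaybe-concat contract (dead m) (λ i → map (rels m zero i) (survivors m)) id (λ i → tabulate (matC k m e i)) row)
          (trans (mapMaybe-++ contract (tabulate (sufC k m e)) _)
            (cong (_++ (false ∷ [])) (mapMaybe-suffix k (ticks m true) (sufC k m e) (λ p → refl))))))))
      where
      header : ∀ i → contract (hdrC k m e i) ≡ (if dead m i then nothing else just true)
      header i rewrite ∨-identityʳ (dead m i) = refl
      row : ∀ i → mapMaybe contract (tabulate (matC k m e i)) ≡ (if dead m i then [] else map (rels m zero i) (survivors m))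
      row i with dead m i
      ... | true  = mapMaybe-none {n} contract (λ j → record (matC k m e i j) { gone = true }) (λ _ → refl)
      ... | false = mapMaybe-tabulate contract (dead m) (rels m zero i) id (λ j → record (matC k m e i j) { gone = dead m j })
          (λ j → drop-∨ (dead m j) (rels m zero i j))
        where
        drop-∨ : ∀ d (b : Bool) → (if d ∨ false then nothing else just b) ≡ (if d then nothing else just b)
        drop-∨ true  b = refl
        drop-∨ false b = refl

    -- Two cases, as in `wrap`: on the empty graph the memory is still the initial one.
    Final : (G : Graph) (k : ℕ) → Mem (suc R) (Graph.n G) → Set
    Final G k m = (Graph.n G ≡ 0 × m ≡ startMem (adj G))
      ⊎ (1 ≤ Graph.n G × m ≡ proj₂ (Semantics.eval k P [] (startMem (adj G))))

    private
      sweeps : ℕ → ℕ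
      sweeps n = 2 + (n * (2 + n * 2) + cost P n)

      run-wrap : ∀ G k {m} → Final G k m → ∃[ t ] ∃[ b ] ∃[ e ] (t ≤ sweeps (Graph.n G) ×
        Runs (wrap (compile P ≤-refl)) (partial (adj G) k 0 0 0) t b (layout k m e))
      run-wrap G k (inj₁ (n≡0 , refl)) = 2 , true , startEnv (adj G) k , s≤s (s≤s z≤n)
        , runs-else (runs-≡ (run-test isHdr _) (empty G n≡0) refl)
            (runs-≡ (run-ret {Graph.n G} {k} true _) refl (trans (same G n≡0) (partial-layout (adj G) k)))
        where
        suffix : ∀ k → orB isHdr (tabulate {n = k} (λ _ → sufB true) ++ sufB false ∷ []) ≡ false
        suffix zero    = refl
        suffix (suc k) = suffix k
        empty : ∀ G → Graph.n G ≡ 0 → orB isHdr (partial (adj G) k 0 0 0) ≡ false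
        empty record { n = zero } refl = suffix k
        same : ∀ G → Graph.n G ≡ 0 → partial (adj G) k 0 0 0 ≡ partial (adj G) k (Graph.n G) 0 (Graph.n G * Graph.n G)
        same record { n = zero } refl = refl
      run-wrap G k (inj₂ (1≤n , refl)) =
        let (t , t≤ , booted) = run-boot (adj G) k 1≤n
            (u , e , u≤ , ran , _ , _) = Correctness.compile-correct 1≤n P ≤-refl [] (startMem (adj G)) (startEnv (adj G) k)
               (λ ()) (λ _ → z≤n)
        in 1 + (t + u) , _ , e , s≤s (≤-trans (+-mono-≤ t≤ u≤) (n≤1+n _))
           , runs-then (runs-≡ (run-test isHdr _) (nonempty G 1≤n) refl)
               (runs-then (runs-≡ booted refl (partial-layout (adj G) k)) ran)
        where
        nonempty : ∀ G → 1 ≤ Graph.n G → orB isHdr (partial (adj G) k 0 0 0) ≡ true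
        nonempty record { n = suc n } _ = refl

      w : ℕ
      w = Code.width code-Blk

      -- The number of sweeps times `sweep-cost`, unfolded at the tape length `N * suc w`: each
      -- input bit occupies one block of `suc w` bits.
      time : ℕ → ℕ
      time N = (1 + (sweeps N + 1)) * (N * suc w * (4 * (N * suc w + N * suc w) + 6) + 1)

      sweeps-mono : ∀ {a b} → a ≤ b → sweeps a ≤ sweeps b
      sweeps-mono le = s≤s (s≤s (+-mono-≤ (*-mono-≤ le (+-monoʳ-≤ 2 (*-monoˡ-≤ 2 le))) (cost-mono P le)))
        where
        cost-mono : ∀ {r v} (P : Prog r v) {a b} → a ≤ b → cost P a ≤ cost P b
        cost-mono (ret _)       le = ≤-refl
        cost-mono (rel _ _ _)   le = ≤-refl
        cost-mono (lt _ _)      le = ≤-refl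
        cost-mono (put _ _ _ _) le = ≤-refl
        cost-mono (kill _)      le = ≤-refl
        cost-mono (tick _)      le = ≤-refl
        cost-mono (seq P Q)     le = +-mono-≤ (cost-mono P le) (cost-mono Q le)
        cost-mono (ite P A B)   le = +-mono-≤ (cost-mono P le) (+-mono-≤ (cost-mono A le) (cost-mono B le))
        cost-mono (any P)       le = s≤s (*-mono-≤ le (+-monoˡ-≤ 1 (cost-mono P le)))

      poly-time : Polynomial time
      poly-time = poly-* (poly-+ (poly-const 1) (poly-+ poly-sweeps (poly-const 1)))
        (poly-+ (poly-* poly-K (poly-+ (poly-* (poly-const 4) (poly-+ poly-K poly-K)) (poly-const 6))) (poly-const 1))
        where
        poly-K : Polynomial (λ N → N * suc w)
        poly-K = poly-* poly-id (poly-const (suc w))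
        poly-sweeps : Polynomial sweeps
        poly-sweeps = poly-+ (poly-const 2)
          (poly-+ (poly-* poly-id (poly-+ (poly-const 2) (poly-* poly-id (poly-const 2)))) (poly-cost P))

    coefficient degree : ℕ
    coefficient = proj₁ (poly-bound poly-time)
    degree = proj₁ (proj₂ (poly-bound poly-time))

    n<length-encode : ∀ G k → Graph.n G < length (encode G k)
    n<length-encode G k = ≤-trans (≤-reflexive (sym (trans (length-++ (replicate (Graph.n G) true))
        (trans (+-comm _ 1) (cong suc (length-replicate (Graph.n G)))))))
      (≤-trans (m≤m+n _ _) (≤-reflexive (sym (length-++ (unary (Graph.n G))))))

    machine-correct : ∀ G k {m} → Final G k m →
      RunsTo machine (encode G k) (coefficient * length (encode G k) ^ degree + coefficient) (remains k m)
    machine-correct G k {m} final =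
      let (t , b , e , t≤ , run) = run-wrap G k final
          N = length (encode G k)
          n≤N = <⇒≤ (n<length-encode G k)
      in subst (RunsTo machine (encode G k) _) (contract-layout k m e)
           (Simulation.runsTo transducer
             (job-sweeps {encode G k} (subst (λ z → Runs (wrap (compile P ≤-refl)) z t b (layout k m e)) (sym (expand-encode G k)) run))
             (≤-trans (*-monoˡ-≤ (Simulation.sweep-cost transducer (N * suc w))
                 (s≤s (+-monoˡ-≤ 1 (≤-trans t≤ (sweeps-mono n≤N)))))
               (proj₂ (proj₂ (poly-bound poly-time)) N (≤-trans (s≤s z≤n) (n<length-encode G k)))))

    remains-encode : ∀ G k (m : Mem (suc R) (Graph.n G)) → (∀ i j → rels m zero i j ≡ adj G i j) →
      remains k m ≡ encode (induced G (survivors m)) (k ∸ ticks m true)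
    remains-encode G k m eq = trans (cong₂ (λ x y → x ++ false ∷ y ++ unary (k ∸ ticks m true)) (const vs) matrix)
        (sym (++-assoc (replicate (length vs) true) _ _))
      where
      vs : List (Fin (Graph.n G))
      vs = survivors m
      const : ∀ {A : Set} (xs : List A) → map (λ _ → true) xs ≡ replicate (length xs) true
      const []       = refl
      const (x ∷ xs) = cong (true ∷_) (const xs)
      relist : ∀ {A B : Set} (f : A → B) xs → map f xs ≡ map (f ∘ lookup xs) (allFin (length xs))
      relist f xs = trans (cong (map f) (sym (tabulate-lookup xs)))
        (trans (map-tabulate (lookup xs) f) (sym (map-tabulate id (f ∘ lookup xs))))
      matrix : concatMap (λ i → map (rels m zero i) vs) vs ≡
               concatMap (λ a → map (λ b → adj G (lookup vs a) (lookup vs b)) (allFin (length vs))) (allFin (length vs))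
      matrix = cong concat (trans (relist (λ i → map (rels m zero i) vs) vs)
        (map-cong (λ a → trans (map-cong (eq (lookup vs a)) vs) (relist (adj G (lookup vs a)) vs)) (allFin (length vs))))

-- First-order tests, exhaustive search, and bounded iteration towards a local optimum

module ProgramLogic where
  open TapeLayout
  open import Data.Vec as Vec using (Vec; []; _∷_; lookup) renaming (_++_ to _⊕_)

  open Mem

  data Form (r v : ℕ) : Set where
    rel     : Fin r → Fin v → Fin v → Form r v
    _≐_ _≺_ : Fin v → Fin v → Form r v
    neg     : Form r v → Form r v
    _&_ _or_ : Form r v → Form r v → Form r v
    ex      : Form r (suc v) → Form r v

  infix 7 _≐_ _≺_
  infixr 6 _&_
  infixr 5 _or_

  ⌜_⌝ : ∀ {r v} → Form r v → Prog r v
  ⌜ rel x i j ⌝ = rel x i j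
  ⌜ i ≺ j ⌝     = lt i j
  ⌜ i ≐ j ⌝     = ite (lt i j) (ret false) (ite (lt j i) (ret false) (ret true))
  ⌜ neg φ ⌝     = ite ⌜ φ ⌝ (ret false) (ret true)
  ⌜ φ & ψ ⌝     = ite ⌜ φ ⌝ ⌜ ψ ⌝ (ret false)
  ⌜ φ or ψ ⌝    = ite ⌜ φ ⌝ (ret true) ⌜ ψ ⌝
  ⌜ ex φ ⌝      = any ⌜ φ ⌝

  -- The final `ret true` lets the verdict report the test, whatever the command returns.
  guard : ∀ {r v} → Form r v → Prog r v → Prog r v
  guard φ C = ite ⌜ φ ⌝ (seq C (ret true)) (ret false)

  orElse : ∀ {r v} → Prog r v → Prog r v → Prog r v
  orElse P Q = ite P (ret true) Q

  any^ : ∀ l {r v} → Prog r (l + v) → Prog r v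
  any^ zero    P = P
  any^ (suc l) P = any^ l (any P)

  clearRow : ∀ {r v} → Fin r → Fin v → Prog r v
  clearRow x i = any (seq (put x (suc i) zero false) (ret false))

  -- The factor four suffices for both searches: for `n ≥ 1`, `n ^ 3 * 4` exceeds the potential of
  -- the local search and `n ^ 2 * 4` that of the auction. The final `ret false` keeps the loops of
  -- `loopN` going.
  seq₄ : ∀ {r v} → Prog r v → Prog r v
  seq₄ P = seq P (seq P (seq P (seq P (ret false))))

  loopN : ∀ {r} → ℕ → (∀ {v} → Prog r v) → ∀ {v} → Prog r v
  loopN zero    P = seq₄ P
  loopN (suc d) P = any (loopN d P)

  module Logic {r n : ℕ} (k : ℕ) where
    open Semantics {r} {n} k public

    M : Set
    M = Mem r n

    ⟦_⟧ : ∀ {v} → Form r v → Vec (Fin n) v → M → Set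
    ⟦ rel x i j ⟧ ρ m = rels m x (lookup ρ i) (lookup ρ j) ≡ true
    ⟦ i ≺ j ⟧     ρ m = toℕ (lookup ρ i) < toℕ (lookup ρ j)
    ⟦ i ≐ j ⟧     ρ m = lookup ρ i ≡ lookup ρ j
    ⟦ neg φ ⟧     ρ m = ¬ ⟦ φ ⟧ ρ m
    ⟦ φ & ψ ⟧     ρ m = ⟦ φ ⟧ ρ m × ⟦ ψ ⟧ ρ m
    ⟦ φ or ψ ⟧    ρ m = ⟦ φ ⟧ ρ m ⊎ ⟦ ψ ⟧ ρ m
    ⟦ ex φ ⟧      ρ m = ∃[ i ] ⟦ φ ⟧ (i ∷ ρ) m

    check : ∀ {v} (φ : Form r v) ρ m → Dec (⟦ φ ⟧ ρ m)
    check (rel x i j) ρ m = rels m x (lookup ρ i) (lookup ρ j) Bool.≟ true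
    check (i ≺ j)     ρ m = toℕ (lookup ρ i) <? toℕ (lookup ρ j)
    check (i ≐ j)     ρ m = lookup ρ i Fin.≟ lookup ρ j
    check (neg φ)     ρ m = ¬? (check φ ρ m)
    check (φ & ψ)     ρ m = check φ ρ m ×-dec check ψ ρ m
    check (φ or ψ)    ρ m = check φ ρ m ⊎-dec check ψ ρ m
    check (ex φ)      ρ m = any? (λ i → check φ (i ∷ ρ) m)

    private
      does-yes : ∀ {P : Set} (d : Dec P) → P → does d ≡ true
      does-yes (yes _) _ = refl
      does-yes (no ¬p) p = contradiction p ¬p

      does-no : ∀ {P : Set} (d : Dec P) → ¬ P → does d ≡ false
      does-no (yes p) ¬p = contradiction p ¬p
      does-no (no _)  _  = refl

      anyM-pure : ∀ {l} {P : Fin l → Set} (P? : Decidable P) (f : Fin l → M → Bool × M) m →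
        (∀ i → f i m ≡ (does (P? i) , m)) → anyM f m ≡ (does (any? P?) , m)
      anyM-pure {zero}  P? f m h = refl
      anyM-pure {suc l} P? f m h rewrite h zero with P? zero
      ... | yes _ = refl
      ... | no _  = anyM-pure (λ i → P? (suc i)) (λ i → f (suc i)) m (λ i → h (suc i))

    eval-form : ∀ {v} (φ : Form r v) ρ m → eval ⌜ φ ⌝ ρ m ≡ (does (check φ ρ m) , m)
    eval-form (rel x i j) ρ m with rels m x (lookup ρ i) (lookup ρ j)
    ... | true  = refl
    ... | false = refl
    eval-form (i ≺ j) ρ m = refl
    eval-form (i ≐ j) ρ m with toℕ (lookup ρ i) <? toℕ (lookup ρ j) | toℕ (lookup ρ j) <? toℕ (lookup ρ i)
    ... | yes p | _ rewrite <ᵇ-true p = cong (_, m) (sym (does-no (lookup ρ i Fin.≟ lookup ρ j) (λ e → <⇒≢ p (cong toℕ e))))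
    ... | no p | yes q rewrite <ᵇ-false (≮⇒≥ p) | <ᵇ-true q =
      cong (_, m) (sym (does-no (lookup ρ i Fin.≟ lookup ρ j) (λ e → <⇒≢ q (cong toℕ (sym e)))))
    ... | no p | no q rewrite <ᵇ-false (≮⇒≥ p) | <ᵇ-false (≮⇒≥ q) =
      cong (_, m) (sym (does-yes (lookup ρ i Fin.≟ lookup ρ j) (toℕ-injective (≤-antisym (≮⇒≥ q) (≮⇒≥ p)))))
    eval-form (neg φ) ρ m rewrite eval-form φ ρ m with check φ ρ m
    ... | yes _ = refl
    ... | no _  = refl
    eval-form (φ & ψ) ρ m rewrite eval-form φ ρ m with check φ ρ m
    ... | yes _ = eval-form ψ ρ m
    ... | no _  = refl
    eval-form (φ or ψ) ρ m rewrite eval-form φ ρ m with check φ ρ m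
    ... | yes _ = refl
    ... | no _  = eval-form ψ ρ m
    eval-form (ex φ) ρ m = anyM-pure _ _ m (λ i → eval-form φ (i ∷ ρ) m)

    -- Failure is informative: it certifies that no candidate exists and that the memory is as
    -- before. This is where local optimality comes from.
    data Searches {A : Set} (o : Bool × M) (m : M) (Φ : A → Set) (act : A → M) : Set where
      miss : o ≡ (false , m) → (∀ a → ¬ Φ a) → Searches o m Φ act
      hit  : ∀ a → Φ a → o ≡ (true , act a) → Searches o m Φ act

    searches-guard : ∀ {v} φ C (ρ : Vec (Fin n) v) m →
      Searches {⊤} (eval (guard φ C) ρ m) m (λ _ → ⟦ φ ⟧ ρ m) (λ _ → proj₂ (eval C ρ m))
    searches-guard φ C ρ m rewrite eval-form φ ρ m with check φ ρ m
    ... | yes p = hit tt p refl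
    ... | no ¬p = miss refl (λ _ → ¬p)

    searches-or : ∀ {A A' : Set} {v} {P Q : Prog r v} {ρ m} {Φ : A → Set} {Φ' : A' → Set} {act act'} →
      Searches (eval P ρ m) m Φ act → Searches (eval Q ρ m) m Φ' act' →
      Searches (eval (orElse P Q) ρ m) m [ Φ , Φ' ]′ [ act , act' ]′
    searches-or (hit a p eq) _ rewrite eq = hit (inj₁ a) p refl
    searches-or (miss eq ¬p) (hit a p eq') rewrite eq = hit (inj₂ a) p eq'
    searches-or (miss eq ¬p) (miss eq' ¬p') rewrite eq = miss eq' λ { (inj₁ a) → ¬p a ; (inj₂ a) → ¬p' a }

    -- Keeps track of the order of trial: no smaller value of the outermost variable admits a
    -- candidate. The auction turns this into cheapness.
    data Least {l} {A : Set} (o : Bool × M) (m : M) (Φ : Fin l → A → Set) (act : Fin l → A → M) : Set where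
      miss : o ≡ (false , m) → (∀ i a → ¬ Φ i a) → Least o m Φ act
      hit  : ∀ i a → Φ i a → (∀ j → toℕ j < toℕ i → ∀ b → ¬ Φ j b) → o ≡ (true , act i a) → Least o m Φ act

    least-any : ∀ {l} {A : Set} (f : Fin l → M → Bool × M) m {Φ : Fin l → A → Set} {act : Fin l → A → M} →
      (∀ i → Searches (f i m) m (Φ i) (act i)) → Least (anyM f m) m Φ act
    least-any {zero} f m h = miss refl λ ()
    least-any {suc l} f m {Φ} {act} h with f zero m | h zero
    ... | .(true , act zero a) | hit a p refl = hit zero a p (λ j ()) refl
    ... | .(false , m) | miss refl ¬p with least-any (λ i → f (suc i)) m (λ i → h (suc i))
    ... | miss eq none = miss eq λ { zero → ¬p ; (suc i) → none i }
    ... | hit i a p low eq = hit (suc i) a p (λ { zero _ → ¬p ; (suc j) (s≤s le) → low j le }) eq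

    searches-any : ∀ {l} {A : Set} (f : Fin l → M → Bool × M) m {Φ : Fin l → A → Set} {act : Fin l → A → M} →
      (∀ i → Searches (f i m) m (Φ i) (act i)) → Searches (anyM f m) m (λ (i , a) → Φ i a) (λ (i , a) → act i a)
    searches-any f m h with least-any f m h
    ... | miss eq none     = miss eq λ (i , a) → none i a
    ... | hit i a p low eq = hit (i , a) p eq

    searches-map : ∀ {A B : Set} {o m} {Φ : A → Set} {Ψ : B → Set} {act act'} (f : A → B) (g : B → A) →
      (∀ a → Φ a → Ψ (f a)) → (∀ b → Ψ b → Φ (g b)) → (∀ a → act a ≡ act' (f a)) →
      Searches o m Φ act → Searches o m Ψ act'
    searches-map f g to from same (miss eq none) = miss eq λ b p → none (g b) (from b p)
    searches-map f g to from same (hit a p eq)   = hit (f a) (to a p) (trans eq (cong (true ,_) (same a)))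

    searches-any^ : ∀ l {v} {A : Set} (P : Prog r (l + v)) m {Φ : Vec (Fin n) (l + v) → A → Set} {act : Vec (Fin n) (l + v) → A → M} →
      (∀ ρ → Searches (eval P ρ m) m (Φ ρ) (act ρ)) → (ρ : Vec (Fin n) v) →
      Searches {Vec (Fin n) l × A} (eval (any^ l P) ρ m) m (λ (xs , a) → Φ (xs ⊕ ρ) a) (λ (xs , a) → act (xs ⊕ ρ) a)
    searches-any^ zero    P m h ρ = searches-map ([] ,_) proj₂ (λ _ p → p) (λ { ([] , _) p → p }) (λ _ → refl) (h ρ)
    searches-any^ (suc l) P m h ρ = searches-map (λ (xs , x , a) → x ∷ xs , a) (λ { (x ∷ xs , a) → xs , x , a })
      (λ _ p → p) (λ { (_ ∷ _ , _) p → p }) (λ _ → refl)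
      (searches-any^ l (any P) m (λ ρ' → searches-any (λ i → eval P (i ∷ ρ')) m (λ i → h (i ∷ ρ'))) ρ)

    putRel-true : ∀ x (i j : Fin n) (m : M) {a b} → rels (putRel x i j true m) x a b ≡ true → (a ≡ i × b ≡ j) ⊎ rels m x a b ≡ true
    putRel-true x i j m {a} {b} h with a == i in p | b == j in q
    ... | true  | true  = inj₁ (==⇒≡ p , ==⇒≡ q)
    ... | true  | false = inj₂ h
    ... | false | _     = inj₂ h

    putRel-at : ∀ x (i j : Fin n) v (m : M) → rels (putRel x i j v m) x i j ≡ v
    putRel-at x i j v m rewrite ==-refl i | ==-refl j | ==-refl x = refl

    putRel-elsewhere : ∀ x (i j : Fin n) v (m : M) {a b} → ¬ (a ≡ i × b ≡ j) → rels (putRel x i j v m) x a b ≡ rels m x a b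
    putRel-elsewhere x i j v m {a} {b} ne with a == i in p | b == j in q
    ... | true  | true  = contradiction (==⇒≡ p , ==⇒≡ q) ne
    ... | true  | false = refl
    ... | false | _     = refl

    putRel-keeps : ∀ x (i j : Fin n) (m : M) a b → rels m x a b ≡ true → rels (putRel x i j true m) x a b ≡ true
    putRel-keeps x i j m a b h with a == i | b == j
    ... | true  | true  rewrite ==-refl x = refl
    ... | true  | false = h
    ... | false | _     = h

    record Frame (x : Fin r) (m m' : M) : Set where
      constructor frame
      field
        same-rels  : ∀ y → y ≢ x → ∀ a b → rels m' y a b ≡ rels m y a b
        same-dead  : dead m' ≡ dead m
        same-ticks : ticks m' ≡ ticks m
    open Frame public

    frame-refl : ∀ {x m} → Frame x m m
    frame-refl = frame (λ _ _ _ _ → refl) refl refl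

    frame-trans : ∀ {x m m' m''} → Frame x m m' → Frame x m' m'' → Frame x m m''
    frame-trans (frame a b c) (frame a' b' c') =
      frame (λ y ne i j → trans (a' y ne i j) (a y ne i j)) (trans b' b) (trans c' c)

    frame-put : ∀ x (i j : Fin n) v (m : M) → Frame x m (putRel x i j v m)
    frame-put x i j v m = frame go refl refl
      where
      go : ∀ y → y ≢ x → ∀ a b → rels (putRel x i j v m) y a b ≡ rels m y a b
      go y ne a b rewrite ==-false ne with (a == i) ∧ (b == j)
      ... | true  = refl
      ... | false = refl

    record Cleared (x : Fin r) (i : Fin n) (m m' : M) : Set where
      field
        row-empty : ∀ b → rels m' x i b ≡ false
        elsewhere : ∀ {a} → a ≢ i → ∀ b → rels m' x a b ≡ rels m x a b
        framed    : Frame x m m'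

    cleared : ∀ {v} x i (ρ : Vec (Fin n) v) m → Cleared x (lookup ρ i) m (proj₂ (eval (clearRow x i) ρ m))
    cleared x i ρ m = record
      { row-empty = λ b → proj₁ (proj₂ (go (λ j → j) m)) b
      ; elsewhere = λ ne b → proj₂ (proj₂ (go (λ j → j) m)) (λ (e , _) → ne e)
      ; framed    = proj₁ (go (λ j → j) m) }
      where
      i' : Fin n
      i' = lookup ρ i
      run : ∀ {l} → (Fin l → Fin n) → M → M
      run φ m = proj₂ (anyM (λ j m → false , putRel x i' (φ j) false m) m)
      go : ∀ {l} (φ : Fin l → Fin n) m → Frame x m (run φ m) ×
        (∀ j → rels (run φ m) x i' (φ j) ≡ false) × (∀ {a b} → ¬ (a ≡ i' × ∃[ j ] b ≡ φ j) → rels (run φ m) x a b ≡ rels m x a b)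
      go {zero} φ m = frame-refl , (λ ()) , λ _ → refl
      go {suc l} φ m with go (λ j → φ (suc j)) (putRel x i' (φ zero) false m)
      ... | fr , cl , el = frame-trans (frame-put x i' (φ zero) false m) fr
          , (λ { zero → first (any? (λ j → φ zero Fin.≟ φ (suc j))) ; (suc j) → cl j })
          , λ ne → trans (el (λ (e , j , e') → ne (e , suc j , e')))
                     (putRel-elsewhere x i' (φ zero) false m (λ (e , e') → ne (e , zero , e')))
        where
        first : Dec (∃[ j ] φ zero ≡ φ (suc j)) → rels (run (λ j → φ (suc j)) (putRel x i' (φ zero) false m)) x i' (φ zero) ≡ false
        first (yes (j , e)) = trans (cong (rels (run (λ j → φ (suc j)) (putRel x i' (φ zero) false m)) x i') e) (cl j)
        first (no ne)       = trans (el (λ (_ , h) → ne h)) (putRel-at x i' (φ zero) false m)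

    module Improvement (Inv Stable : M → Set) (μ : M → ℕ) where

      -- The substitute for a while-loop: `c` is the guaranteed gain of potential unless a stable
      -- memory is reached, and stability is never lost again.
      record Good (c : ℕ) (f : M → M) : Set where
        field
          inv    : ∀ m → Inv m → Inv (f m)
          stays  : ∀ m → Inv m → Stable m → Stable (f m)
          climbs : ∀ m → Inv m → Stable (f m) ⊎ c + μ m ≤ μ (f m)
      open Good

      good-id : Good 0 (λ m → m)
      good-id = record { inv = λ _ i → i ; stays = λ _ _ s → s ; climbs = λ _ _ → inj₂ ≤-refl }

      good-∘ : ∀ {c d f g} → Good c f → Good d g → Good (c + d) (λ m → g (f m))
      good-∘ {c} {d} {f} {g} F G = record
        { inv = λ m i → inv G _ (inv F m i)
        ; stays = λ m i s → stays G _ (inv F m i) (stays F m i s)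
        ; climbs = λ m i → climb m i (climbs F m i) (climbs G _ (inv F m i)) }
        where
        climb : ∀ m → Inv m → Stable (f m) ⊎ c + μ m ≤ μ (f m) → Stable (g (f m)) ⊎ d + μ (f m) ≤ μ (g (f m)) →
          Stable (g (f m)) ⊎ c + d + μ m ≤ μ (g (f m))
        climb m i (inj₁ s) _         = inj₁ (stays G _ (inv F m i) s)
        climb m i (inj₂ _) (inj₁ s)  = inj₁ s
        climb m i (inj₂ p) (inj₂ q)  = inj₂ (≤-trans (≤-trans (≤-reflexive (trans (cong (_+ μ m) (+-comm c d)) (+-assoc d c (μ m))))
          (+-monoʳ-≤ d p)) q)

      -- Only bodies that fail are run for every vertex, hence the hypothesis on the verdict; the
      -- gains of the `l` rounds add up.
      good-anyM : ∀ {c l} (f : Fin l → M → Bool × M) → (∀ i m → proj₁ (f i m) ≡ false) →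
        (∀ i → Good c (λ m → proj₂ (f i m))) → Good (l * c) (λ m → proj₂ (anyM f m))
      good-anyM {c} {zero} f h G = good-id
      good-anyM {c} {suc l} f h G = subst-good (good-∘ (G zero) (good-anyM (λ i → f (suc i)) (λ i → h (suc i)) (λ i → G (suc i))))
        where
        unfold : ∀ m → proj₂ (anyM f m) ≡ proj₂ (anyM (λ i → f (suc i)) (proj₂ (f zero m)))
        unfold m with f zero m | h zero m
        ... | false , m' | refl = refl
        subst-good : ∀ {c} → Good c (λ m → proj₂ (anyM (λ i → f (suc i)) (proj₂ (f zero m)))) → Good c (λ m → proj₂ (anyM f m))
        subst-good G = record
          { inv = λ m i → subst Inv (sym (unfold m)) (inv G m i)
          ; stays = λ m i s → subst Stable (sym (unfold m)) (stays G m i s)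
          ; climbs = λ m i → subst (λ z → Stable z ⊎ _ ≤ μ z) (sym (unfold m)) (climbs G m i) }

      loopN-false : ∀ d (P : ∀ {v} → Prog r v) {v} (ρ : Vec (Fin n) v) m → proj₁ (eval (loopN d P) ρ m) ≡ false
      loopN-false zero    P ρ m = refl
      loopN-false (suc d) P ρ m = go (λ i → eval (loopN d P) (i ∷ ρ)) (λ i → loopN-false d P (i ∷ ρ)) m
        where
        go : ∀ {l} (f : Fin l → M → Bool × M) → (∀ i m → proj₁ (f i m) ≡ false) → ∀ m → proj₁ (anyM f m) ≡ false
        go {zero}  f h m = refl
        go {suc l} f h m with f zero m | h zero m
        ... | false , m' | _ = go (λ i → f (suc i)) (λ i → h (suc i)) m'

      good-loopN : ∀ d (P : ∀ {v} → Prog r v) → (∀ {v} (ρ : Vec (Fin n) v) → Good 1 (λ m → proj₂ (eval P ρ m))) →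
        ∀ {v} (ρ : Vec (Fin n) v) → Good (n ^ d * 4) (λ m → proj₂ (eval (loopN d P) ρ m))
      good-loopN zero    P G ρ = good-∘ (G ρ) (good-∘ (G ρ) (good-∘ (G ρ) (good-∘ (G ρ) good-id)))
      good-loopN (suc d) P G ρ = subst (λ c → Good c (λ m → proj₂ (eval (loopN (suc d) P) ρ m))) (sym (*-assoc n (n ^ d) 4))
        (good-anyM (λ i → eval (loopN d P) (i ∷ ρ)) (λ i → loopN-false d P (i ∷ ρ)) (λ i → good-loopN d P G (i ∷ ρ)))

      -- `better` refutes stability of the old memory, so a stable memory can only be left as it is.
      data Step (m m' : M) : Set where
        stable : m' ≡ m → Stable m → Step m m'
        better : ¬ Stable m → Inv m' → 1 + μ m ≤ μ m' → Step m m'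

      good-steps : ∀ {f} → (∀ m → Inv m → Step m (f m)) → Good 1 f
      good-steps {f} st = record { inv = inv' ; stays = stays' ; climbs = climbs' }
        where
        inv' : ∀ m → Inv m → Inv (f m)
        inv' m i with st m i
        ... | stable e _    = subst Inv (sym e) i
        ... | better _ i' _ = i'
        climbs' : ∀ m → Inv m → Stable (f m) ⊎ 1 + μ m ≤ μ (f m)
        climbs' m i with st m i
        ... | stable e s   = inj₁ (subst Stable (sym e) s)
        ... | better _ _ c = inj₂ c
        stays' : ∀ m → Inv m → Stable m → Stable (f m)
        stays' m i s with st m i
        ... | stable e _    = subst Stable (sym e) s
        ... | better ¬s _ _ = contradiction s ¬s

      -- Without a stable memory on the way the potential would have gained `c`, more than its final
      -- value allows.
      stabilises : ∀ {c f} → Good c f → ∀ m → Inv m → μ (f m) < c → Stable (f m)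
      stabilises G m i μ< with climbs G m i
      ... | inj₁ s = s
      ... | inj₂ le = contradiction (≤-trans (m≤m+n _ (μ m)) le) (<⇒≱ μ<)

  count : ∀ {A : Set} {P : A → Set} → Decidable P → List A → ℕ
  count P? xs = length (filter P? xs)

  count-mono : ∀ {A : Set} {P Q : A → Set} (P? : Decidable P) (Q? : Decidable Q) xs →
    (∀ x → P x → Q x) → count P? xs ≤ count Q? xs
  count-mono P? Q? []       h = z≤n
  count-mono P? Q? (x ∷ xs) h with P? x | Q? x
  ... | yes p | yes q = s≤s (count-mono P? Q? xs h)
  ... | yes p | no ¬q = contradiction (h x p) ¬q
  ... | no ¬p | yes q = m≤n⇒m≤1+n (count-mono P? Q? xs h)
  ... | no ¬p | no ¬q = count-mono P? Q? xs h

  count-strict : ∀ {A : Set} {P Q : A → Set} (P? : Decidable P) (Q? : Decidable Q) xs →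
    (∀ x → P x → Q x) → ∀ {x} → x ∈ xs → ¬ P x → Q x → count P? xs < count Q? xs
  count-strict P? Q? (x ∷ xs) h (here refl) ¬p q with P? x | Q? x
  ... | yes p | _     = contradiction p ¬p
  ... | no _  | yes _ = s≤s (count-mono P? Q? xs h)
  ... | no _  | no ¬q = contradiction q ¬q
  count-strict P? Q? (x ∷ xs) h (there x∈) ¬p q with P? x | Q? x
  ... | yes _ | yes _ = s≤s (count-strict P? Q? xs h x∈ ¬p q)
  ... | yes p | no ¬q = contradiction (h x p) ¬q
  ... | no _  | yes _ = m≤n⇒m≤1+n (count-strict P? Q? xs h x∈ ¬p q)
  ... | no _  | no _  = count-strict P? Q? xs h x∈ ¬p q

-- Local search for a packing

module PackingSearch where
  open import Defs using (Graph; adj; irrefl)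
  open TapeLayout
  open ProgramLogic
  open import Data.Vec as Vec using (Vec; []; _∷_; lookup) renaming (_++_ to _⊕_)

  open Mem

  pattern Eᵣ = 0F
  -- Row `i` of this relation is class `i`. Vertices serve as names of classes, being the only
  -- objects over which programs quantify; an empty row is a free name.
  pattern Bᵣ = 1F

  length-cartesianProduct : ∀ {A B : Set} (xs : List A) (ys : List B) →
    length (cartesianProduct xs ys) ≡ length xs * length ys
  length-cartesianProduct []       ys = refl
  length-cartesianProduct (x ∷ xs) ys = trans (length-++ (Data.List.map (x ,_) ys))
    (cong₂ _+_ (length-map (x ,_) ys) (length-cartesianProduct xs ys))

  module Formulas {v : ℕ} where
    outside : Fin v → Form 8 v
    outside x = neg (ex (rel Bᵣ 0F (suc x)))

    isolated : Fin v → Form 8 v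
    isolated x = neg (ex (neg (ex (rel Bᵣ 0F 1F)) & rel Eᵣ (suc x) 0F))

    unused : Fin v → Form 8 v
    unused i = neg (ex (rel Bᵣ (suc i) 0F))

  open Formulas

  assign : ∀ {v} (i p q s : Fin v) → Prog 8 v
  assign i p q s = seq (clearRow Bᵣ i) (seq (put Bᵣ i p true) (seq (put Bᵣ i q true) (put Bᵣ i s true)))

  -- Move 1: x - y - z is a path outside the packing; it becomes class j.
  φ₁ : ∀ {v} → Form 8 (4 + v)
  φ₁ = outside 0F & outside 1F & outside 2F & rel Eᵣ 0F 1F & rel Eᵣ 1F 2F & neg (0F ≐ 2F) & unused 3F

  C₁ : ∀ {v} → Prog 8 (4 + v)
  C₁ = assign 3F 0F 1F 2F

  -- Move 2: class i = {f, g, h} becomes {x, g, h} with x isolated outside the packing,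
  -- and the freed vertex f is matched with y.
  φ₂ : ∀ {v} → Form 8 (6 + v)
  φ₂ = rel Bᵣ 0F 1F & rel Bᵣ 0F 2F & rel Bᵣ 0F 3F & neg (1F ≐ 2F) & neg (1F ≐ 3F) & rel Eᵣ 2F 3F
     & outside 4F & outside 5F & neg (4F ≐ 5F) & isolated 4F & rel Eᵣ 4F 2F & rel Eᵣ 1F 5F

  C₂ : ∀ {v} → Prog 8 (6 + v)
  C₂ = assign 0F 4F 2F 3F

  -- Move 3: p, q in class i with paths p - a - b and q - d - e; they become classes i and j.
  φ₃ : ∀ {v} → Form 8 (8 + v)
  φ₃ = rel Bᵣ 0F 1F & rel Bᵣ 0F 2F & neg (1F ≐ 2F)
     & outside 3F & outside 4F & outside 5F & outside 6F
     & neg (3F ≐ 5F) & neg (3F ≐ 6F) & neg (4F ≐ 5F) & neg (4F ≐ 6F)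
     & rel Eᵣ 1F 3F & rel Eᵣ 3F 4F & rel Eᵣ 2F 5F & rel Eᵣ 5F 6F & unused 7F

  C₃ : ∀ {v} → Prog 8 (8 + v)
  C₃ = seq (assign 0F 1F 3F 4F) (assign 7F 2F 5F 6F)

  localStep : ∀ {v} → Prog 8 v
  localStep = orElse (any^ 4 (guard φ₁ C₁)) (orElse (any^ 6 (guard φ₂ C₂)) (any^ 8 (guard φ₃ C₃)))

  localSearch : ∀ {v} → Prog 8 v
  localSearch = loopN 3 localStep

  module LocalSearch (G : Graph) (k : ℕ) (m₀ : Mem 8 (Graph.n G)) where
    n : ℕ
    n = Graph.n G
    open Logic {8} {n} k

    V : Set
    V = Fin n

    E : V → V → Set
    E u v = adj G u v ≡ true

    E-sym : ∀ {u v} → E u v → E v u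
    E-sym {u} {v} e = trans (Graph.sym G v u) e

    E-irr : ∀ {u v} → E u v → u ≢ v
    E-irr e refl = contradiction (trans (sym e) (irrefl G _)) λ ()

    B : M → V → V → Set
    B m i v = rels m Bᵣ i v ≡ true

    Q : M → V → Set
    Q m v = ¬ (∃[ i ] B m i v)

    record Triple (m : M) (i : V) : Set where
      constructor triple
      field
        p q s : V
        p≢q   : p ≢ q
        p≢s   : p ≢ s
        q≢s   : q ≢ s
        Epq   : E p q
        Eqs   : E q s
        Bp    : B m i p
        Bq    : B m i q
        Bs    : B m i s
        only  : ∀ {v} → B m i v → v ≡ p ⊎ v ≡ q ⊎ v ≡ s

    record Packing (m : M) : Set where
      field
        disjoint : ∀ {i j v} → B m i v → B m j v → i ≡ j
        classes  : ∀ i → (∀ v → ¬ B m i v) ⊎ Triple m i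

    open Packing

    Inv : M → Set
    Inv m = Frame Bᵣ m₀ m × Packing m

    -- All that the invariants use of an assignment. `inverse` traces membership in the new packing
    -- back to the old one, which is how disjointness and outsideness are transferred.
    record Assigned (i p q s : V) (m m' : M) : Set where
      field
        inverse : ∀ {c v} → B m' c v → (c ≡ i × (v ≡ p ⊎ v ≡ q ⊎ v ≡ s)) ⊎ (c ≢ i × B m c v)
        has-p   : B m' i p
        has-q   : B m' i q
        has-s   : B m' i s
        keeps   : ∀ {c v} → c ≢ i → B m c v → B m' c v
        framed  : Frame Bᵣ m m'

    open Assigned

    assigned : ∀ {v} (i p q s : Fin v) (ρ : Vec V v) m →
      Assigned (lookup ρ i) (lookup ρ p) (lookup ρ q) (lookup ρ s) m (proj₂ (eval (assign i p q s) ρ m))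
    assigned i p q s ρ m = record
      { inverse = inv
      ; has-p = putRel-keeps Bᵣ i' s' m₃ i' p' (putRel-keeps Bᵣ i' q' m₂ i' p' (putRel-at Bᵣ i' p' true m₁))
      ; has-q = putRel-keeps Bᵣ i' s' m₃ i' q' (putRel-at Bᵣ i' q' true m₂)
      ; has-s = putRel-at Bᵣ i' s' true m₃
      ; keeps = λ {c} {v} ne b → putRel-keeps Bᵣ i' s' m₃ c v (putRel-keeps Bᵣ i' q' m₂ c v (putRel-keeps Bᵣ i' p' m₁ c v
          (trans (Cleared.elsewhere cl ne v) b)))
      ; framed = frame-trans (Cleared.framed cl) (frame-trans (frame-put Bᵣ i' p' true m₁)
          (frame-trans (frame-put Bᵣ i' q' true m₂) (frame-put Bᵣ i' s' true m₃))) }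
      where
      i' p' q' s' : V
      i' = lookup ρ i
      p' = lookup ρ p
      q' = lookup ρ q
      s' = lookup ρ s
      m₁ m₂ m₃ : M
      m₁ = proj₂ (eval (clearRow Bᵣ i) ρ m)
      m₂ = putRel Bᵣ i' p' true m₁
      m₃ = putRel Bᵣ i' q' true m₂
      cl : Cleared Bᵣ i' m m₁
      cl = cleared Bᵣ i ρ m
      inv : ∀ {c v} → B (putRel Bᵣ i' s' true m₃) c v → (c ≡ i' × (v ≡ p' ⊎ v ≡ q' ⊎ v ≡ s')) ⊎ (c ≢ i' × B m c v)
      inv {c} {v} b with putRel-true Bᵣ i' s' m₃ b
      ... | inj₁ (e , e') = inj₁ (e , inj₂ (inj₂ e'))
      ... | inj₂ b₃ with putRel-true Bᵣ i' q' m₂ b₃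
      ... | inj₁ (e , e') = inj₁ (e , inj₂ (inj₁ e'))
      ... | inj₂ b₂ with putRel-true Bᵣ i' p' m₁ b₂
      ... | inj₁ (e , e') = inj₁ (e , inj₁ e')
      ... | inj₂ b₁ with c Fin.≟ i'
      ... | yes refl = contradiction (trans (sym b₁) (Cleared.row-empty cl v)) λ ()
      ... | no ne    = inj₂ (ne , trans (sym (Cleared.elsewhere cl ne v)) b₁)

    packing-assign : ∀ {i p q s m m'} → Packing m → Assigned i p q s m m' →
      p ≢ q → p ≢ s → q ≢ s → E p q → E q s →
      (∀ {c} → B m c p → c ≡ i) → (∀ {c} → B m c q → c ≡ i) → (∀ {c} → B m c s → c ≡ i) → Packing m'
    packing-assign {i} {p} {q} {s} {m} {m'} pk as p≢q p≢s q≢s epq eqs op oq os = record { disjoint = dis ; classes = cls }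
      where
      owner : ∀ {v c} → (v ≡ p ⊎ v ≡ q ⊎ v ≡ s) → B m c v → c ≡ i
      owner (inj₁ refl)        = op
      owner (inj₂ (inj₁ refl)) = oq
      owner (inj₂ (inj₂ refl)) = os
      dis : ∀ {a c v} → B m' a v → B m' c v → a ≡ c
      dis x y with inverse as x | inverse as y
      ... | inj₁ (refl , _)  | inj₁ (refl , _)  = refl
      ... | inj₁ (refl , v∈) | inj₂ (ne , b)    = contradiction (owner v∈ b) ne
      ... | inj₂ (ne , b)    | inj₁ (refl , v∈) = contradiction (owner v∈ b) ne
      ... | inj₂ (_ , b)     | inj₂ (_ , b')    = disjoint pk b b'
      cls : ∀ c → (∀ v → ¬ B m' c v) ⊎ Triple m' c
      cls c with c Fin.≟ i
      ... | yes refl = inj₂ (triple p q s p≢q p≢s q≢s epq eqs (has-p as) (has-q as) (has-s as) (λ b → member (inverse as b)))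
        where
        member : ∀ {v} → (c ≡ c × (v ≡ p ⊎ v ≡ q ⊎ v ≡ s)) ⊎ (c ≢ c × B m c v) → v ≡ p ⊎ v ≡ q ⊎ v ≡ s
        member (inj₁ (_ , v∈)) = v∈
        member (inj₂ (ne , _)) = contradiction refl ne
      ... | no ne with classes pk c
      ... | inj₁ empty = inj₁ λ v b → [ (λ (e , _) → ne e) , (λ (_ , b) → empty v b) ]′ (inverse as b)
      ... | inj₂ (triple p q s a b c' d e bp bq bs only) =
        inj₂ (triple p q s a b c' d e (keeps as ne bp) (keeps as ne bq) (keeps as ne bs)
          (λ b → [ (λ (e , _) → contradiction e ne) , (λ (_ , b) → only b) ]′ (inverse as b)))

    Used : M → V → Set
    Used m i = ∃[ v ] B m i v

    used? : ∀ m i → Dec (Used m i)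
    used? m i = any? (λ v → rels m Bᵣ i v Bool.≟ true)

    Q? : ∀ m v → Dec (Q m v)
    Q? m v = ¬? (any? (λ i → rels m Bᵣ i v Bool.≟ true))

    QEdge : M → V × V → Set
    QEdge m (a , b) = Q m a × Q m b × E a b

    qedge? : ∀ m e → Dec (QEdge m e)
    qedge? m (a , b) = Q? m a ×-dec (Q? m b ×-dec (adj G a b Bool.≟ true))

    pairs : List (V × V)
    pairs = cartesianProduct (allFin n) (allFin n)

    -- A lexicographic order, classes before ordered adjacent pairs outside: there are at most
    -- `n * n` such pairs, so one more class outweighs the loss of all of them.
    size edges μ : M → ℕ
    size m = count (used? m) (allFin n)
    edges m = count (qedge? m) pairs
    μ m = size m * suc (n * n) + edges m

    private
      edges≤ : ∀ m → edges m ≤ n * n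
      edges≤ m = ≤-trans (length-filter (qedge? m) pairs) (≤-reflexive
        (trans (length-cartesianProduct (allFin n) (allFin n)) (cong₂ _*_ (length-tabulate {n = n} (λ i → i)) (length-tabulate {n = n} (λ i → i)))))

      size≤ : ∀ m → size m ≤ n
      size≤ m = ≤-trans (length-filter (used? m) (allFin n)) (≤-reflexive (length-tabulate {n = n} (λ i → i)))

      climb-size : ∀ m m' → size m < size m' → 1 + μ m ≤ μ m'
      climb-size m m' lt′ = begin
        1 + (size m * suc (n * n) + edges m) ≤⟨ s≤s (+-monoʳ-≤ _ (edges≤ m)) ⟩
        1 + (size m * suc (n * n) + n * n)   ≡⟨ cong suc (+-comm _ (n * n)) ⟩
        suc (size m) * suc (n * n)           ≤⟨ *-monoˡ-≤ (suc (n * n)) lt′ ⟩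
        size m' * suc (n * n)                ≤⟨ m≤m+n _ _ ⟩
        μ m' ∎
        where open ≤-Reasoning

      climb-edges : ∀ m m' → size m ≤ size m' → edges m < edges m' → 1 + μ m ≤ μ m'
      climb-edges m m' le lt′ = ≤-trans (≤-reflexive (sym (+-suc _ (edges m)))) (+-mono-≤ (*-monoˡ-≤ _ le) lt′)

    μ≤ : ∀ m → μ m ≤ n * suc (n * n) + n * n
    μ≤ m = +-mono-≤ (*-monoˡ-≤ _ (size≤ m)) (edges≤ m)

    Move₁ : M → (x y z j : V) → Set
    Move₁ m x y z j = ⟦ φ₁ ⟧ (x ∷ y ∷ z ∷ j ∷ []) m

    Move₂ : M → (i f g h x y : V) → Set
    Move₂ m i f g h x y = ⟦ φ₂ ⟧ (i ∷ f ∷ g ∷ h ∷ x ∷ y ∷ []) m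

    Move₃ : M → (i p q a b d e j : V) → Set
    Move₃ m i p q a b d e j = ⟦ φ₃ ⟧ (i ∷ p ∷ q ∷ a ∷ b ∷ d ∷ e ∷ j ∷ []) m

    record Stable (m : M) : Set where
      field
        none₁ : ∀ x y z j → ¬ Move₁ m x y z j
        none₂ : ∀ i f g h x y → ¬ Move₂ m i f g h x y
        none₃ : ∀ i p q a b d e j → ¬ Move₃ m i p q a b d e j

    module _ {m : M} (inv : Inv m) (graph : ∀ a b → rels m₀ Eᵣ a b ≡ adj G a b) where
      private
        pk : Packing m
        pk = proj₂ inv

        edge : ∀ {a b} → rels m Eᵣ a b ≡ true → E a b
        edge {a} {b} h = trans (sym (trans (same-rels (proj₁ inv) Eᵣ (λ ()) a b) (graph a b))) h

        apart : ∀ {i p x} → B m i p → Q m x → p ≢ x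
        apart b q refl = q (_ , b)

        vacuous : ∀ {x} → Q m x → ∀ {c i : V} → B m c x → c ≡ i
        vacuous q b = contradiction (_ , b) q

      improve₁ : ∀ {x y z j m'} → Move₁ m x y z j → Assigned j x y z m m' → Inv m' × 1 + μ m ≤ μ m'
      improve₁ {x} {y} {z} {j} {m'} (qx , qy , qz , exy , eyz , x≢z , free) as =
        (frame-trans (proj₁ inv) (framed as)
        , packing-assign pk as (E-irr (edge exy)) x≢z (E-irr (edge eyz)) (edge exy) (edge eyz) (vacuous qx) (vacuous qy) (vacuous qz))
        , climb-size m m' (count-strict (used? m) (used? m') (allFin n)
            (λ c (v , b) → v , keeps as (λ { refl → free (v , b) }) b) (∈-allFin j) free (x , has-p as))

      -- Taking `x` in loses no outside edge, because `x` has no neighbour outside; releasing `f`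
      -- gains the edge to `y`.
      improve₂ : ∀ {i f g h x y m'} → Move₂ m i f g h x y → Assigned i x g h m m' → Inv m' × 1 + μ m ≤ μ m'
      improve₂ {i} {f} {g} {h} {x} {y} {m'} (bf , bg , bh , f≢g , f≢h , egh , qx , qy , x≢y , iso , exg , efy) as =
        (frame-trans (proj₁ inv) (framed as)
        , packing-assign pk as (≢-sym (apart bg qx)) (≢-sym (apart bh qx)) (E-irr (edge egh)) (edge exg) (edge egh)
            (vacuous qx) (λ b → disjoint pk b bg) (λ b → disjoint pk b bh))
        , climb-edges m m' (count-mono (used? m) (used? m') (allFin n) used)
            (count-strict (qedge? m) (qedge? m') pairs old (∈-cartesianProduct⁺ (∈-allFin f) (∈-allFin y))
              (λ (qf , _) → qf (i , bf)) (Q'f , Q'-from qy (≢-sym x≢y) , edge efy))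
        where
        used : ∀ c → Used m c → Used m' c
        used c (v , b) with c Fin.≟ i
        ... | yes refl = x , has-p as
        ... | no ne    = v , keeps as ne b
        Q'-from : ∀ {a} → Q m a → a ≢ x → Q m' a
        Q'-from qa a≢x (c , b) with inverse as b
        ... | inj₁ (_ , inj₁ e)           = a≢x e
        ... | inj₁ (_ , inj₂ (inj₁ refl)) = qa (i , bg)
        ... | inj₁ (_ , inj₂ (inj₂ refl)) = qa (i , bh)
        ... | inj₂ (_ , b')               = qa (c , b')
        Q'f : Q m' f
        Q'f (c , b) with inverse as b
        ... | inj₁ (_ , inj₁ refl)     = qx (i , bf)
        ... | inj₁ (_ , inj₂ (inj₁ e)) = f≢g e
        ... | inj₁ (_ , inj₂ (inj₂ e)) = f≢h e
        ... | inj₂ (ne , b')           = ne (disjoint pk b' bf)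
        lone : ∀ {a} → Q m a → ¬ E x a
        lone {a} qa e = iso (a , qa , trans (trans (same-rels (proj₁ inv) Eᵣ (λ ()) x a) (graph x a)) e)
        old : ∀ ab → QEdge m ab → QEdge m' ab
        old (a , b) (qa , qb , e) = Q'-from qa (λ { refl → lone qb e }) , Q'-from qb (λ { refl → lone qa (E-sym e) }) , e

      -- After the first assignment `q` lies outside together with `d` and `e`, so the second one is
      -- like move 1 with the free name `j`.
      improve₃ : ∀ {i p q a b d e j m₁ m'} → Move₃ m i p q a b d e j →
        Assigned i p a b m m₁ → Assigned j q d e m₁ m' → Inv m' × 1 + μ m ≤ μ m'
      improve₃ {i} {p} {q} {a} {b} {d} {e} {j} {m₁} {m'}
        (bp , bq , p≢q , qa , qb , qd , qe , a≢d , a≢e , b≢d , b≢e , epa , eab , eqd , ede , free) as₁ as₂ =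
        (frame-trans (proj₁ inv) (frame-trans (framed as₁) (framed as₂))
        , packing-assign pk₁ as₂ (apart bq qd) (apart bq qe) (E-irr (edge ede)) (edge eqd) (edge ede)
            (λ b → contradiction (_ , b) q₁) (λ b → contradiction (_ , b) (outside₁ qd (≢-sym a≢d) (≢-sym b≢d)))
            (λ b → contradiction (_ , b) (outside₁ qe (≢-sym a≢e) (≢-sym b≢e))))
        , climb-size m m' (count-strict (used? m) (used? m') (allFin n) used (∈-allFin j) free (q , has-p as₂))
        where
        pk₁ : Packing m₁
        pk₁ = packing-assign pk as₁ (apart bp qa) (apart bp qb) (E-irr (edge eab)) (edge epa) (edge eab)
          (λ b → disjoint pk b bp) (vacuous qa) (vacuous qb)
        q₁ : Q m₁ q
        q₁ (c , x) with inverse as₁ x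
        ... | inj₁ (_ , inj₁ e)           = p≢q (sym e)
        ... | inj₁ (_ , inj₂ (inj₁ refl)) = qa (i , bq)
        ... | inj₁ (_ , inj₂ (inj₂ refl)) = qb (i , bq)
        ... | inj₂ (ne , x')              = ne (disjoint pk x' bq)
        outside₁ : ∀ {v} → Q m v → v ≢ a → v ≢ b → Q m₁ v
        outside₁ qv v≢a v≢b (c , x) with inverse as₁ x
        ... | inj₁ (_ , inj₁ refl)     = qv (i , bp)
        ... | inj₁ (_ , inj₂ (inj₁ e)) = v≢a e
        ... | inj₁ (_ , inj₂ (inj₂ e)) = v≢b e
        ... | inj₂ (_ , x')            = qv (c , x')
        used : ∀ c → Used m c → Used m' c
        used c (v , x) with c Fin.≟ j
        ... | yes refl = contradiction (v , x) free
        ... | no c≢j with c Fin.≟ i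
        ... | yes refl = p , keeps as₂ c≢j (has-p as₁)
        ... | no c≢i   = v , keeps as₂ c≢j (keeps as₁ c≢i x)

    module Search (graph : ∀ a b → rels m₀ Eᵣ a b ≡ adj G a b) where
      open Improvement Inv Stable μ

      module _ {v} (ρ : Vec V v) (m : M) (inv : Inv m) where
        private
          Candidate : Set
          Candidate = (Vec V 4 × ⊤) ⊎ (Vec V 6 × ⊤) ⊎ (Vec V 8 × ⊤)

          Φ : Candidate → Set
          Φ = [ (λ (xs , _) → ⟦ φ₁ ⟧ (xs ⊕ ρ) m) , [ (λ (xs , _) → ⟦ φ₂ ⟧ (xs ⊕ ρ) m) , (λ (xs , _) → ⟦ φ₃ ⟧ (xs ⊕ ρ) m) ]′ ]′

          act : Candidate → M
          act = [ (λ (xs , _) → proj₂ (eval C₁ (xs ⊕ ρ) m))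
                , [ (λ (xs , _) → proj₂ (eval C₂ (xs ⊕ ρ) m)) , (λ (xs , _) → proj₂ (eval C₃ (xs ⊕ ρ) m)) ]′ ]′

          improve : ∀ a → Φ a → ¬ Stable m × (Inv (act a) × 1 + μ m ≤ μ (act a))
          improve (inj₁ ((x ∷ y ∷ z ∷ j ∷ []) , tt)) mv = (λ st → Stable.none₁ st x y z j mv) ,
            improve₁ inv graph mv (assigned 3F 0F 1F 2F (x ∷ y ∷ z ∷ j ∷ ρ) m)
          improve (inj₂ (inj₁ ((i ∷ f ∷ g ∷ h ∷ x ∷ y ∷ []) , tt))) mv = (λ st → Stable.none₂ st i f g h x y mv) ,
            improve₂ inv graph mv (assigned 0F 4F 2F 3F (i ∷ f ∷ g ∷ h ∷ x ∷ y ∷ ρ) m)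
          improve (inj₂ (inj₂ ((i ∷ p ∷ q ∷ a ∷ b ∷ d ∷ e ∷ j ∷ []) , tt))) mv = (λ st → Stable.none₃ st i p q a b d e j mv) ,
            improve₃ inv graph mv (assigned 0F 1F 3F 4F (i ∷ p ∷ q ∷ a ∷ b ∷ d ∷ e ∷ j ∷ ρ) m)
              (assigned 7F 2F 5F 6F (i ∷ p ∷ q ∷ a ∷ b ∷ d ∷ e ∷ j ∷ ρ) _)

          conclude : ∀ {o} → Searches o m Φ act → Step m (proj₂ o)
          conclude (miss eq none) = stable (cong proj₂ eq) record
            { none₁ = λ x y z j → none (inj₁ ((x ∷ y ∷ z ∷ j ∷ []) , tt))
            ; none₂ = λ i f g h x y → none (inj₂ (inj₁ ((i ∷ f ∷ g ∷ h ∷ x ∷ y ∷ []) , tt)))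
            ; none₃ = λ i p q a b d e j → none (inj₂ (inj₂ ((i ∷ p ∷ q ∷ a ∷ b ∷ d ∷ e ∷ j ∷ []) , tt))) }
          conclude (hit a mv refl) = let (¬s , i , c) = improve a mv in better ¬s i c

        step : Step m (proj₂ (eval localStep ρ m))
        step = conclude (searches-or {P = any^ 4 (guard φ₁ C₁)} {Q = orElse (any^ 6 (guard φ₂ C₂)) (any^ 8 (guard φ₃ C₃))}
          (searches-any^ 4 (guard φ₁ C₁) m (λ ρ → searches-guard φ₁ C₁ ρ m) ρ)
          (searches-or {P = any^ 6 (guard φ₂ C₂)} {Q = any^ 8 (guard φ₃ C₃)}
            (searches-any^ 6 (guard φ₂ C₂) m (λ ρ → searches-guard φ₂ C₂ ρ m) ρ)
            (searches-any^ 8 (guard φ₃ C₃) m (λ ρ → searches-guard φ₃ C₃ ρ m) ρ)))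

      localSearch-stable : 1 ≤ n → ∀ {v} (ρ : Vec V v) m → Inv m →
        Inv (proj₂ (eval localSearch ρ m)) × Stable (proj₂ (eval localSearch ρ m))
      localSearch-stable 1≤n ρ m inv = Good.inv good m inv , stabilises good m inv (≤-<-trans (μ≤ (proj₂ (eval localSearch ρ m))) bound)
        where
        good : Good (n ^ 3 * 4) (λ m → proj₂ (eval localSearch ρ m))
        good = good-loopN 3 localStep (λ ρ → good-steps (step ρ)) ρ
        bound : n * suc (n * n) + n * n < n ^ 3 * 4
        bound = begin-strict
          n * suc (n * n) + n * n       ≡⟨ expand n ⟩
          n + n * n + n * n * n         <⟨ m<m+n _ (*-mono-≤ (*-mono-≤ 1≤n 1≤n) 1≤n) ⟩
          n + n * n + n * n * n + n * n * n ≤⟨ +-monoˡ-≤ _ (+-monoˡ-≤ _ (+-mono-≤ n≤ (m≤m*n (n * n) n {{>-nonZero 1≤n}}))) ⟩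
          n * n * n + n * n * n + n * n * n + n * n * n ≡⟨ collect n ⟩
          n ^ 3 * 4 ∎
          where
          open ≤-Reasoning
          n≤ : n ≤ n * n * n
          n≤ = ≤-trans (m≤m*n n n {{>-nonZero 1≤n}}) (m≤m*n (n * n) n {{>-nonZero 1≤n}})
          expand : ∀ n → n * suc (n * n) + n * n ≡ n + n * n + n * n * n
          expand = solve-∀
          collect : ∀ n → n * n * n + n * n * n + n * n * n + n * n * n ≡ n * (n * (n * 1)) * 4
          collect = solve-∀

-- The auction of slots to outside components

module SlotAuction where
  open import Defs using (Graph; adj)
  open TapeLayout
  open ProgramLogic
  open PackingSearch
  open import Data.Vec as Vec using (Vec; _∷_)

  open Mem
  open Formulas

  -- Every vertex h of the packing offers slot 0 to K₂'s outside the packing and slots 1, 2 to isolated vertices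
  -- outside.  Relation `asgᵣ s` holds the current customer of a slot, `prcᵣ s` its price in unary.
  asgᵣ prcᵣ : Fin 3 → Fin 8
  asgᵣ s = 2 ↑ʳ (s ↑ˡ 3)
  prcᵣ s = 5 ↑ʳ s

  asgᵣ-injective : ∀ {s t} → asgᵣ s ≡ asgᵣ t → s ≡ t
  asgᵣ-injective {s} {t} e = ↑ˡ-injective 3 s t (↑ʳ-injective 2 (s ↑ˡ 3) (t ↑ˡ 3) e)

  prcᵣ-injective : ∀ {s t} → prcᵣ s ≡ prcᵣ t → s ≡ t
  prcᵣ-injective {s} {t} e = ↑ʳ-injective 5 s t e

  asgᵣ≢prcᵣ : ∀ s t → asgᵣ s ≢ prcᵣ t
  asgᵣ≢prcᵣ 0F 0F ()
  asgᵣ≢prcᵣ 0F 1F ()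
  asgᵣ≢prcᵣ 0F 2F ()
  asgᵣ≢prcᵣ 1F 0F ()
  asgᵣ≢prcᵣ 1F 1F ()
  asgᵣ≢prcᵣ 1F 2F ()
  asgᵣ≢prcᵣ 2F 0F ()
  asgᵣ≢prcᵣ 2F 1F ()
  asgᵣ≢prcᵣ 2F 2F ()

  module _ {v : ℕ} where
    paired : Fin v → Form 8 v
    paired x = ex (outside 0F & rel Eᵣ (suc x) 0F)

    suits : Fin 3 → Fin v → Form 8 v
    suits 0F      x = paired x
    suits (suc _) x = neg (paired x)

    -- A K₂ is represented by whichever end made the bid, so the customer may be the vertex itself
    -- or its neighbour.
    taken : Fin 3 → Fin v → Form 8 v
    taken s x = ex (ex (rel (asgᵣ s) 1F 0F & (0F ≐ suc (suc x) or rel Eᵣ 0F (suc (suc x)))))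

  -- The variables are the owner of the slot, the bidder and a price level. The last conjunct says
  -- that the price is at most this level, with equality when the level is least.
  bids : ∀ {v} → Fin 3 → Form 8 (3 + v)
  bids s = neg (outside 0F) & outside 1F & rel Eᵣ 0F 1F & suits s 1F
         & neg (taken 0F 1F) & neg (taken 1F 1F) & neg (taken 2F 1F) & neg (rel (prcᵣ s) 0F 2F)

  -- Clearing the row evicts the former customer. Marking the level equal to the price raises the
  -- price by one, in unary.
  accept : ∀ {v} → Fin 3 → Prog 8 (3 + v)
  accept s = seq (clearRow (asgᵣ s) 0F) (seq (put (asgᵣ s) 0F 1F true) (put (prcᵣ s) 0F 2F true))

  or₃ : ∀ {v} → (Fin 3 → Prog 8 v) → Prog 8 v
  or₃ P = orElse (P 0F) (orElse (P 1F) (P 2F))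

  -- Scanning the price in the outermost loop makes every bid go to a cheapest slot.
  auctionStep : ∀ {v} → Prog 8 v
  auctionStep = any (any (any (or₃ (λ s → guard (bids s) (accept s)))))

  auction : ∀ {v} → Prog 8 v
  auction = loopN 2 auctionStep

  module Auction (G : Graph) (k : ℕ) (m₁ : Mem 8 (Graph.n G))
    (acyclic : ∀ {x y z} → LocalSearch.Q G k m₁ m₁ x → LocalSearch.Q G k m₁ m₁ y → LocalSearch.Q G k m₁ m₁ z →
               adj G x y ≡ true → adj G y z ≡ true → x ≡ z) where
    open LocalSearch G k m₁
    open Logic {8} {n} k

    Out : V → Set
    Out = Q m₁

    Paired : V → Set
    Paired x = ∃[ w ] (Out w × E x w)

    Suits : Fin 3 → V → Set
    Suits 0F      x = Paired x
    Suits (suc _) x = ¬ Paired x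

    Slot : Fin 3 → V → V → Set
    Slot s h x = ¬ Out h × Out x × E h x × Suits s x

    infix 4 _≈_
    -- Membership in the same outside component; `acyclic` leaves these components at most two
    -- vertices, which gives transitivity.
    _≈_ : V → V → Set
    x ≈ y = x ≡ y ⊎ E x y

    ≈-sym : ∀ {x y} → x ≈ y → y ≈ x
    ≈-sym (inj₁ e) = inj₁ (sym e)
    ≈-sym (inj₂ e) = inj₂ (E-sym e)

    ≈-trans : ∀ {x y z} → Out x → Out y → Out z → x ≈ y → y ≈ z → x ≈ z
    ≈-trans ox oy oz (inj₁ refl) e           = e
    ≈-trans ox oy oz (inj₂ e)    (inj₁ refl) = inj₂ e
    ≈-trans ox oy oz (inj₂ e)    (inj₂ e')   = inj₁ (acyclic ox oy oz e e')

    Asg : M → Fin 3 → V → V → Set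
    Asg m s h x = rels m (asgᵣ s) h x ≡ true

    Taken : M → V → Set
    Taken m x = ∃[ s ] ∃[ h ] ∃[ y ] (Asg m s h y × y ≈ x)

    record Base (m : M) : Set where
      field
        graph    : ∀ a b → rels m Eᵣ a b ≡ adj G a b
        packing  : ∀ i v → rels m Bᵣ i v ≡ rels m₁ Bᵣ i v
        unkilled : dead m ≡ dead m₁
        unticked : ticks m ≡ ticks m₁

    -- The core is `cheap`: a customer's slot costs at most one more than any slot suiting its
    -- component. It persists for old customers because prices only grow. `sold` persists because a
    -- customer leaves only by being replaced.
    record Inv′ (m : M) : Set where
      field
        base     : Base m
        price    : Fin 3 → V → ℕ
        priced   : ∀ s h l → rels m (prcᵣ s) h l ≡ (toℕ l <ᵇ price s h)
        price≤n  : ∀ s h → price s h ≤ n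
        suitable : ∀ {s h x} → Asg m s h x → Slot s h x
        single   : ∀ {s h x y} → Asg m s h x → Asg m s h y → x ≡ y
        once     : ∀ {s h x t g y} → Asg m s h x → Asg m t g y → x ≈ y → s ≡ t × h ≡ g
        sold     : ∀ {s h} → 0 < price s h → ∃[ x ] Asg m s h x
        cheap    : ∀ {s h x y t g} → Asg m s h x → x ≈ y → Slot t g y → price s h ≤ suc (price t g)

    -- No bid is possible: all slots that suit an unserved vertex have the full price `n`.
    Stable′ : M → Set
    Stable′ m = ∀ l x h s → Slot s h x → ¬ Taken m x → rels m (prcᵣ s) h l ≡ true

    record Bid (s : Fin 3) (h x l : V) (m m' : M) : Set where
      field
        asg-inverse : ∀ {t g y} → Asg m' t g y → (t ≡ s × g ≡ h × y ≡ x) ⊎ (¬ (t ≡ s × g ≡ h) × Asg m t g y)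
        asg-new     : Asg m' s h x
        asg-keep    : ∀ {t g y} → ¬ (t ≡ s × g ≡ h) → Asg m t g y → Asg m' t g y
        prc-new     : rels m' (prcᵣ s) h l ≡ true
        prc-else    : ∀ t g l' → ¬ (t ≡ s × g ≡ h × l' ≡ l) → rels m' (prcᵣ t) g l' ≡ rels m (prcᵣ t) g l'
        base-keep   : Base m → Base m'

    accepted : ∀ {v} s (h x l : V) (ρ : Vec V v) m → Bid s h x l m (proj₂ (eval (accept s) (h ∷ x ∷ l ∷ ρ) m))
    accepted s h x l ρ m = record
      { asg-inverse = inv
      ; asg-new = trans (asg≡ s h x) (putRel-at (asgᵣ s) h x true mc)
      ; asg-keep = λ {t} {g} {y} ne a → trans (asg≡ t g y) (keep ne a)
      ; prc-new = putRel-at (prcᵣ s) h l true ma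
      ; prc-else = λ t g l' ne → prc t g l' ne
      ; base-keep = λ b → record
          { graph = λ a c → trans (old Eᵣ (λ ()) (λ ()) a c) (Base.graph b a c)
          ; packing = λ i v → trans (old Bᵣ (λ ()) (λ ()) i v) (Base.packing b i v)
          ; unkilled = trans (same-dead (Cleared.framed cl)) (Base.unkilled b)
          ; unticked = trans (same-ticks (Cleared.framed cl)) (Base.unticked b) } }
      where
      mc ma m' : M
      mc = proj₂ (eval (clearRow (asgᵣ s) 0F) (h ∷ x ∷ l ∷ ρ) m)
      ma = putRel (asgᵣ s) h x true mc
      m' = putRel (prcᵣ s) h l true ma
      cl : Cleared (asgᵣ s) h m mc
      cl = cleared (asgᵣ s) 0F (h ∷ x ∷ l ∷ ρ) m
      asg≡ : ∀ t g y → rels m' (asgᵣ t) g y ≡ rels ma (asgᵣ t) g y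
      asg≡ t g y = same-rels (frame-put (prcᵣ s) h l true ma) (asgᵣ t) (asgᵣ≢prcᵣ t s) g y
      old : ∀ r → r ≢ asgᵣ s → r ≢ prcᵣ s → ∀ a b → rels m' r a b ≡ rels m r a b
      old r ne ne' a b = trans (same-rels (frame-put (prcᵣ s) h l true ma) r ne' a b)
        (trans (same-rels (frame-put (asgᵣ s) h x true mc) r ne a b) (same-rels (Cleared.framed cl) r ne a b))
      keep : ∀ {t g y} → ¬ (t ≡ s × g ≡ h) → Asg m t g y → rels ma (asgᵣ t) g y ≡ true
      keep {t} {g} {y} ne a with t Fin.≟ s
      ... | yes refl = putRel-keeps (asgᵣ s) h x mc g y (trans (Cleared.elsewhere cl (λ e → ne (refl , e)) y) a)
      ... | no t≢s   = trans (same-rels (frame-put (asgᵣ s) h x true mc) (asgᵣ t) (λ e → t≢s (asgᵣ-injective e)) g y)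
                         (trans (same-rels (Cleared.framed cl) (asgᵣ t) (λ e → t≢s (asgᵣ-injective e)) g y) a)
      inv : ∀ {t g y} → Asg m' t g y → (t ≡ s × g ≡ h × y ≡ x) ⊎ (¬ (t ≡ s × g ≡ h) × Asg m t g y)
      inv {t} {g} {y} a′ with trans (sym (asg≡ t g y)) a′ | t Fin.≟ s
      ... | a | no t≢s = inj₂ ((λ (e , _) → t≢s e) ,
            trans (sym (trans (same-rels (frame-put (asgᵣ s) h x true mc) (asgᵣ t) (λ e → t≢s (asgᵣ-injective e)) g y)
                    (same-rels (Cleared.framed cl) (asgᵣ t) (λ e → t≢s (asgᵣ-injective e)) g y))) a)
      ... | a | yes refl with putRel-true (asgᵣ s) h x mc {g} {y} a
      ... | inj₁ (e , e') = inj₁ (refl , e , e')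
      ... | inj₂ b with g Fin.≟ h
      ... | yes refl = contradiction (trans (sym b) (Cleared.row-empty cl y)) λ ()
      ... | no ne    = inj₂ ((λ (_ , e) → ne e) , trans (sym (Cleared.elsewhere cl ne y)) b)
      prc : ∀ t g l' → ¬ (t ≡ s × g ≡ h × l' ≡ l) → rels m' (prcᵣ t) g l' ≡ rels m (prcᵣ t) g l'
      prc t g l' ne with t Fin.≟ s
      ... | yes refl = trans (putRel-elsewhere (prcᵣ s) h l true ma {g} {l'} (λ (e , e') → ne (refl , e , e')))
            (trans (same-rels (frame-put (asgᵣ s) h x true mc) (prcᵣ s) (λ e → asgᵣ≢prcᵣ s s (sym e)) g l')
              (same-rels (Cleared.framed cl) (prcᵣ s) (λ e → asgᵣ≢prcᵣ s s (sym e)) g l'))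
      ... | no t≢s = old (prcᵣ t) (λ e → asgᵣ≢prcᵣ s t (sym e)) (λ e → t≢s (prcᵣ-injective e)) g l'

    module _ {m : M} (b : Base m) where
      open Base b

      to-E : ∀ {a c} → rels m Eᵣ a c ≡ true → E a c
      to-E {a} {c} e = trans (sym (graph a c)) e

      from-E : ∀ {a c} → E a c → rels m Eᵣ a c ≡ true
      from-E {a} {c} e = trans (graph a c) e

      to-Out : ∀ {x} → Q m x → Out x
      to-Out q (i , e) = q (i , trans (packing i _) e)

      from-Out : ∀ {x} → Out x → Q m x
      from-Out q (i , e) = q (i , trans (sym (packing i _)) e)

      private
        Paired′ : V → Set
        Paired′ x = ∃[ w ] (Q m w × rels m Eᵣ x w ≡ true)

        to-Paired : ∀ {x} → Paired′ x → Paired x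
        to-Paired (w , q , e) = w , to-Out q , to-E e

        from-Paired : ∀ {x} → Paired x → Paired′ x
        from-Paired (w , q , e) = w , from-Out q , from-E e

        Taken′ : Fin 3 → V → Set
        Taken′ s x = ∃[ h ] ∃[ y ] (Asg m s h y × (y ≡ x ⊎ rels m Eᵣ y x ≡ true))

        from-Taken : ∀ {x} → Taken m x → ∃[ s ] Taken′ s x
        from-Taken (s , h , y , a , inj₁ e) = s , h , y , a , inj₁ e
        from-Taken (s , h , y , a , inj₂ e) = s , h , y , a , inj₂ (from-E e)

        to-Taken : ∀ {s x} → Taken′ s x → Taken m x
        to-Taken {s} (h , y , a , inj₁ e) = s , h , y , a , inj₁ e
        to-Taken {s} (h , y , a , inj₂ e) = s , h , y , a , inj₂ (to-E e)

      module _ {v} {ρ : Vec V v} {h x l : V} where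
        from-bids : ∀ s → ⟦ bids s ⟧ (h ∷ x ∷ l ∷ ρ) m → Slot s h x × ¬ Taken m x × ¬ (rels m (prcᵣ s) h l ≡ true)
        from-bids s (ph , qx , e , su , t0 , t1 , t2 , pr) =
          ((λ q → ph (from-Out q)) , to-Out qx , to-E e , suit s su) , untaken , pr
          where
          suit : ∀ s → ⟦ suits s 1F ⟧ (h ∷ x ∷ l ∷ ρ) m → Suits s x
          suit 0F      p = to-Paired p
          suit (suc _) p = λ q → p (from-Paired q)
          untaken : ¬ Taken m x
          untaken t with from-Taken t
          ... | 0F , t' = t0 t'
          ... | 1F , t' = t1 t'
          ... | 2F , t' = t2 t'

        to-bids : ∀ s → Slot s h x → ¬ Taken m x → ¬ (rels m (prcᵣ s) h l ≡ true) → ⟦ bids s ⟧ (h ∷ x ∷ l ∷ ρ) m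
        to-bids s (ph , qx , e , su) t pr =
          (λ q → ph (to-Out q)) , from-Out qx , from-E e , suit s su , (λ t' → t (to-Taken t')) , (λ t' → t (to-Taken t'))
          , (λ t' → t (to-Taken t')) , pr
          where
          suit : ∀ s → Suits s x → ⟦ suits s 1F ⟧ (h ∷ x ∷ l ∷ ρ) m
          suit 0F      p = from-Paired p
          suit (suc _) p = λ q → p (to-Paired q)

    cells : List (Fin 3 × V × V)
    cells = cartesianProduct (allFin 3) pairs

    Raised : M → Fin 3 × V × V → Set
    Raised m (s , h , l) = rels m (prcᵣ s) h l ≡ true

    raised? : ∀ m c → Dec (Raised m c)
    raised? m (s , h , l) = rels m (prcᵣ s) h l Bool.≟ true

    -- The sum of all prices, counted as marked cells of their unary notation. Evictions leave it
    -- unchanged, so every bid raises it.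
    total : M → ℕ
    total m = count (raised? m) cells

    total≤ : ∀ m → total m ≤ 3 * (n * n)
    total≤ m = ≤-trans (length-filter (raised? m) cells) (≤-reflexive
      (trans (length-cartesianProduct (allFin 3) pairs) (cong (3 *_)
        (trans (length-cartesianProduct (allFin n) (allFin n))
          (cong₂ _*_ (length-tabulate {n = n} (λ i → i)) (length-tabulate {n = n} (λ i → i)))))))

    -- Leastness of `l` puts every slot suiting the component of `x` at price `l` or more, while the
    -- slot itself costs at most `l`. So its price is exactly `l` before the bid and `l + 1` after,
    -- which is `cheap` for the new customer.
    bid-improves : ∀ {s h x l m m'} → Inv′ m → Slot s h x → ¬ Taken m x → ¬ (rels m (prcᵣ s) h l ≡ true) →
      (∀ j → toℕ j < toℕ l → ∀ t g y → Slot t g y → ¬ Taken m y → rels m (prcᵣ t) g j ≡ true) →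
      Bid s h x l m m' → Inv′ m' × 1 + total m ≤ total m'
    bid-improves {s} {h} {x} {l} {m} {m'} iv slot untaken low least bid = record
      { base = base-keep base
      ; price = price′
      ; priced = priced′
      ; price≤n = bound′
      ; suitable = λ a → suitable′ (asg-inverse a)
      ; single = λ a a' → single′ (asg-inverse a) (asg-inverse a')
      ; once = λ a a' e → once′ (asg-inverse a) (asg-inverse a') e
      ; sold = sold′
      ; cheap = λ a e sl → cheap′ (asg-inverse a) e sl
      } , count-strict (raised? m) (raised? m') cells grows
            (∈-cartesianProduct⁺ (∈-allFin s) (∈-cartesianProduct⁺ (∈-allFin h) (∈-allFin l))) low prc-new
      where
      open Inv′ iv
      open Bid bid

      same? : ∀ t g → Dec (t ≡ s × g ≡ h)
      same? t g = (t Fin.≟ s) ×-dec (g Fin.≟ h)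

      price′ : Fin 3 → V → ℕ
      price′ t g with same? t g
      ... | yes _ = suc (toℕ l)
      ... | no _  = price t g

      untaken-≈ : ∀ {y} → Out y → x ≈ y → ¬ Taken m y
      untaken-≈ oy e (t , g , z , a , e') =
        untaken (t , g , z , a , ≈-trans (proj₁ (proj₂ (suitable a))) oy (proj₁ (proj₂ slot)) e' (≈-sym e))

      lowest : ∀ {t g y} → x ≈ y → Slot t g y → toℕ l ≤ price t g
      lowest {t} {g} {y} e sl = ≮⇒≥ λ p< →
        let p<n = <-trans p< (toℕ<n l)
            j   = fromℕ< p<n
            j≡  = toℕ-fromℕ< p<n
        in contradiction (trans (sym (least j (subst (_< toℕ l) (sym j≡) p<) t g y sl (untaken-≈ (proj₁ (proj₂ sl)) e)))
             (trans (priced t g j) (<ᵇ-false {toℕ j} {price t g} (≤-reflexive (sym j≡))))) λ ()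

      price≡ : price s h ≡ toℕ l
      price≡ = ≤-antisym (≮⇒≥ λ l< → low (trans (priced s h l) (<ᵇ-true l<))) (lowest (inj₁ refl) slot)

      price-grows : ∀ t g → price t g ≤ price′ t g
      price-grows t g with same? t g
      ... | yes (refl , refl) = ≤-trans (≤-reflexive price≡) (n≤1+n _)
      ... | no _              = ≤-refl

      price-new : price′ s h ≡ suc (toℕ l)
      price-new with same? s h
      ... | yes _ = refl
      ... | no ne = contradiction (refl , refl) ne

      price-old : ∀ {t g} → ¬ (t ≡ s × g ≡ h) → price′ t g ≡ price t g
      price-old {t} {g} ne with same? t g
      ... | yes e = contradiction e ne
      ... | no _  = refl

      priced′ : ∀ t g j → rels m' (prcᵣ t) g j ≡ (toℕ j <ᵇ price′ t g)
      priced′ t g j with same? t g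
      ... | no ne = trans (prc-else t g j (λ (e , e' , _) → ne (e , e'))) (priced t g j)
      ... | yes (refl , refl) with j Fin.≟ l
      ... | yes refl = trans prc-new (sym (<ᵇ-true (n<1+n (toℕ j))))
      ... | no j≢l   = trans (prc-else s h j (λ (_ , _ , e) → j≢l e)) (trans (priced s h j)
            (trans (cong (toℕ j <ᵇ_) price≡) (shift (toℕ j <? toℕ l))))
        where
        shift : Dec (toℕ j < toℕ l) → (toℕ j <ᵇ toℕ l) ≡ (toℕ j <ᵇ suc (toℕ l))
        shift (yes p) = trans (<ᵇ-true p) (sym (<ᵇ-true (m<n⇒m<1+n p)))
        shift (no p)  = trans (<ᵇ-false (≮⇒≥ p)) (sym (<ᵇ-false (≤∧≢⇒< (≮⇒≥ p) (λ e → j≢l (toℕ-injective (sym e))))))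

      bound′ : ∀ t g → price′ t g ≤ n
      bound′ t g with same? t g
      ... | yes _ = toℕ<n l
      ... | no _  = price≤n t g

      Inverse : Fin 3 → V → V → Set
      Inverse t g y = (t ≡ s × g ≡ h × y ≡ x) ⊎ (¬ (t ≡ s × g ≡ h) × Asg m t g y)

      suitable′ : ∀ {t g y} → Inverse t g y → Slot t g y
      suitable′ (inj₁ (refl , refl , refl)) = slot
      suitable′ (inj₂ (_ , a))              = suitable a

      single′ : ∀ {t g y z} → Inverse t g y → Inverse t g z → y ≡ z
      single′ (inj₁ (_ , _ , refl)) (inj₁ (_ , _ , refl)) = refl
      single′ (inj₁ (e , e' , _))   (inj₂ (ne , _))       = contradiction (e , e') ne
      single′ (inj₂ (ne , _))       (inj₁ (e , e' , _))   = contradiction (e , e') ne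
      single′ (inj₂ (_ , a))        (inj₂ (_ , a'))       = single a a'

      once′ : ∀ {t g y t' g' y'} → Inverse t g y → Inverse t' g' y' → y ≈ y' → t ≡ t' × g ≡ g'
      once′ (inj₁ (refl , refl , _)) (inj₁ (refl , refl , _)) e = refl , refl
      once′ (inj₁ (_ , _ , refl)) (inj₂ (_ , a)) e = contradiction (_ , _ , _ , a , ≈-sym e) untaken
      once′ (inj₂ (_ , a)) (inj₁ (_ , _ , refl)) e = contradiction (_ , _ , _ , a , e) untaken
      once′ (inj₂ (_ , a)) (inj₂ (_ , a')) e = once a a' e

      sold′ : ∀ {t g} → 0 < price′ t g → ∃[ y ] Asg m' t g y
      sold′ {t} {g} pos with same? t g
      ... | yes (refl , refl) = x , asg-new
      ... | no ne             = let (y , a) = sold pos in y , asg-keep ne a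

      cheap′ : ∀ {t g y z t' g'} → Inverse t g y → y ≈ z → Slot t' g' z → price′ t g ≤ suc (price′ t' g')
      cheap′ {t' = t'} {g'} (inj₁ (refl , refl , refl)) e sl =
        ≤-trans (≤-reflexive price-new) (s≤s (≤-trans (lowest e sl) (price-grows t' g')))
      cheap′ {t' = t'} {g'} (inj₂ (ne , a)) e sl =
        ≤-trans (≤-reflexive (price-old ne)) (≤-trans (cheap a e sl) (s≤s (price-grows t' g')))

      grows : ∀ c → Raised m c → Raised m' c
      grows (t , g , j) r with (t Fin.≟ s) ×-dec ((g Fin.≟ h) ×-dec (j Fin.≟ l))
      ... | yes (refl , refl , refl) = prc-new
      ... | no ne                    = trans (prc-else t g j ne) r

    open Improvement Inv′ Stable′ total

    module _ {v} (ρ : Vec V v) (m : M) (iv : Inv′ m) where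
      private
        Φ : V → V × V × Fin 3 → Set
        Φ l (x , h , s) = ⟦ bids s ⟧ (h ∷ x ∷ l ∷ ρ) m

        act : V → V × V × Fin 3 → M
        act l (x , h , s) = proj₂ (eval (accept s) (h ∷ x ∷ l ∷ ρ) m)

        conclude : ∀ {o} → Least o m Φ act → Step m (proj₂ o)
        conclude (miss eq none) = stable (cong proj₂ eq) λ l x h s sl ut →
          decidable-stable (rels m (prcᵣ s) h l Bool.≟ true) (λ np → none l (x , h , s) (to-bids (Inv′.base iv) s sl ut np))
        conclude (hit l (x , h , s) φ least refl) =
          let (sl , ut , low) = from-bids (Inv′.base iv) s φ
              (iv' , c) = bid-improves iv sl ut low
                 (λ j j<l t g y sl' ut' → decidable-stable (rels m (prcᵣ t) g j Bool.≟ true)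
                    (λ np → least j j<l (y , g , t) (to-bids (Inv′.base iv) t sl' ut' np)))
                 (accepted s h x l ρ m)
          in better (λ st → low (st l x h s sl ut)) iv' c

        searches-or₃ : ∀ {v} {ρ : Vec V v} {P : Fin 3 → Prog 8 v} {Φ : Fin 3 → Set} {act : Fin 3 → M} →
          (∀ s → Searches {⊤} (eval (P s) ρ m) m (λ _ → Φ s) (λ _ → act s)) → Searches (eval (or₃ P) ρ m) m Φ act
        searches-or₃ {P = P} h = searches-map
          (λ { (inj₁ _) → 0F ; (inj₂ (inj₁ _)) → 1F ; (inj₂ (inj₂ _)) → 2F })
          (λ { 0F → inj₁ tt ; 1F → inj₂ (inj₁ tt) ; 2F → inj₂ (inj₂ tt) })
          (λ { (inj₁ _) p → p ; (inj₂ (inj₁ _)) p → p ; (inj₂ (inj₂ _)) p → p })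
          (λ { 0F p → p ; 1F p → p ; 2F p → p })
          (λ { (inj₁ _) → refl ; (inj₂ (inj₁ _)) → refl ; (inj₂ (inj₂ _)) → refl })
          (searches-or {P = P 0F} {Q = orElse (P 1F) (P 2F)} (h 0F) (searches-or {P = P 1F} {Q = P 2F} (h 1F) (h 2F)))

      auction-step : Step m (proj₂ (eval auctionStep ρ m))
      auction-step = conclude (least-any (λ l → eval (any (any (or₃ (λ s → guard (bids s) (accept s))))) (l ∷ ρ)) m λ l →
        searches-any (λ x → eval (any (or₃ (λ s → guard (bids s) (accept s)))) (x ∷ l ∷ ρ)) m λ x →
        searches-any (λ h → eval (or₃ (λ s → guard (bids s) (accept s))) (h ∷ x ∷ l ∷ ρ)) m λ h →
        searches-or₃ {P = λ s → guard (bids s) (accept s)} λ s → searches-guard (bids s) (accept s) (h ∷ x ∷ l ∷ ρ) m)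

    auction-stable : 1 ≤ n → ∀ {v} (ρ : Vec V v) m → Inv′ m →
      Inv′ (proj₂ (eval auction ρ m)) × Stable′ (proj₂ (eval auction ρ m))
    auction-stable 1≤n ρ m iv = Good.inv good m iv , stabilises good m iv (≤-<-trans (total≤ (proj₂ (eval auction ρ m))) bound)
      where
      good : Good (n ^ 2 * 4) (λ m → proj₂ (eval auction ρ m))
      good = good-loopN 2 auctionStep (λ ρ → good-steps (auction-step ρ)) ρ
      bound : 3 * (n * n) < n ^ 2 * 4
      bound = begin-strict
        3 * (n * n) <⟨ m<n+m (3 * (n * n)) (*-mono-≤ 1≤n 1≤n) ⟩
        4 * (n * n) ≡⟨ cong (λ z → 4 * (n * z)) (*-identityʳ n) ⟨
        4 * n ^ 2   ≡⟨ *-comm 4 (n ^ 2) ⟩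
        n ^ 2 * 4 ∎
        where open ≤-Reasoning

-- The crown reduction for paths on three vertices

module CrownReduction where
  open import Defs using (Graph; adj; HasP₂Packing; IsP₂)
  open Execution using (induced)
  open ProgramLogic using (count)
  open import Data.List using (lookup)
  open import Data.List.Relation.Unary.Any.Properties using (lookup-index)
  open import Data.List.Relation.Unary.All as All using ()
  open import Data.List.Relation.Unary.AllPairs using ([]; _∷_)

  -- Counting by charging: every entry of `xs` finds an entry of `ys` to charge, and no entry of
  -- `ys` can be charged by two.
  length-≤ : ∀ {A B : Set} {R : A → B → Set} (xs : List A) (ys : List B) → Unique xs →
    (∀ {x} → x ∈ xs → ∃[ y ] (y ∈ ys × R x y)) → (∀ {x x' y} → R x y → R x' y → x ≡ x') → length xs ≤ length ys
  length-≤ []       ys u h inj = z≤n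
  length-≤ {R = R} (x ∷ xs) ys (x∉ ∷ u) h inj with h (here refl)
  ... | y , y∈ , r with ∈-∃++ y∈
  ... | as , bs , refl = ≤-trans (s≤s (length-≤ xs (as ++ bs) u rest inj))
      (≤-reflexive (trans (cong suc (length-++ as)) (trans (sym (+-suc (length as) (length bs))) (sym (length-++ as)))))
    where
    rest : ∀ {x'} → x' ∈ xs → ∃[ y' ] (y' ∈ as ++ bs × R x' y')
    rest x'∈ with h (there x'∈)
    ... | y' , y'∈ , r' with ∈-++⁻ as y'∈
    ... | inj₁ ∈as          = y' , ∈-++⁺ˡ ∈as , r'
    ... | inj₂ (there ∈bs)  = y' , ∈-++⁺ʳ as ∈bs , r'
    ... | inj₂ (here refl)  = contradiction (inj r r') (All.lookup x∉ x'∈)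

  length-filter-¬ : ∀ {A : Set} {P : A → Set} (P? : Decidable P) xs →
    length xs ≡ count P? xs + count (λ x → ¬? (P? x)) xs
  length-filter-¬ P? []       = refl
  length-filter-¬ P? (x ∷ xs) with P? x
  ... | yes _ = cong suc (length-filter-¬ P? xs)
  ... | no _  = trans (cong suc (length-filter-¬ P? xs)) (sym (+-suc _ _))

  lookup-injective : ∀ {A : Set} {xs : List A} → Unique xs → ∀ i j → lookup xs i ≡ lookup xs j → i ≡ j
  lookup-injective (x∉ ∷ u) zero    zero    e = refl
  lookup-injective (x∉ ∷ u) zero    (suc j) e = contradiction e (All.lookup x∉ (∈-lookup j))
  lookup-injective (x∉ ∷ u) (suc i) zero    e = contradiction (sym e) (All.lookup x∉ (∈-lookup i))
  lookup-injective (x∉ ∷ u) (suc i) (suc j) e = cong suc (lookup-injective u i j e)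

  packing-≤ : ∀ G {k k'} → k' ≤ k → HasP₂Packing G k → HasP₂Packing G k'
  packing-≤ G le (f , isP , inj) = (λ i → f (inject≤ i le)) , (λ i → isP (inject≤ i le))
    , λ i a j b e → let (e₁ , e₂) = inj _ a _ b e in inject≤-injective le le i j e₁ , e₂

  module Crown (G : Graph) where
    V : Set
    V = Fin (Graph.n G)

    E : V → V → Set
    E u v = adj G u v ≡ true

    -- Removing H and C costs exactly |H| paths: at most |H| paths of a packing meet H, and a path avoiding H cannot meet C.
    module _ {H C : V → Set} (H? : Decidable H)
      (closed : ∀ {x y} → C x → E x y → H y ⊎ C y)
      (thin   : ∀ {x y z} → C x → C y → C z → E x y → E y z → x ≡ z)
      (π      : ∀ h → H h → Fin 3 → V)
      (π-P₂   : ∀ h (p : H h) → IsP₂ G (π h p))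
      (π-in   : ∀ h (p : H h) a → H (π h p a) ⊎ C (π h p a))
      (π-apart : ∀ {h p h' p' a b} → π h p a ≡ π h' p' b → h ≡ h')
      (π-inj  : ∀ h (p : H h) a b → π h p a ≡ π h p b → a ≡ b)
      {vs : List V} (vs-unique : Unique vs)
      (vs-in  : ∀ {v} → v ∈ vs → ¬ H v × ¬ C v)
      (vs-all : ∀ {v} → ¬ H v → ¬ C v → v ∈ vs) where

      private
        hs : List V
        hs = filter H? (allFin _)

        hs-unique : Unique hs
        hs-unique = filter⁺ H? (allFin⁺ _)

      crown-reduces : ∀ k → HasP₂Packing G k → HasP₂Packing (induced G vs) (k ∸ count H? (allFin _))
      crown-reduces k (f , isP , inj) = packing-≤ (induced G vs) enough (g , g-P₂ , g-inj)
        where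
        Meets : Fin k → Set
        Meets i = ∃[ a ] H (f i a)
        meets? : Decidable Meets
        meets? i = any? (λ a → H? (f i a))
        rest : List (Fin k)
        rest = filter (λ i → ¬? (meets? i)) (allFin k)
        few : count meets? (allFin k) ≤ length hs
        few = length-≤ {R = λ i h → ∃[ a ] f i a ≡ h} (filter meets? (allFin k)) hs (filter⁺ meets? (allFin⁺ k))
          (λ {i} i∈ → let (_ , a , p) = ∈-filter⁻ meets? {xs = allFin k} i∈ in f i a , ∈-filter⁺ H? (∈-allFin (f i a)) p , a , refl)
          (λ (a , e) (b , e') → proj₁ (inj _ a _ b (trans e (sym e'))))
        enough : k ∸ length hs ≤ length rest
        enough = m≤n+o⇒m∸n≤o k (length hs) (≤-trans (≤-reflexive (trans (sym (length-tabulate {n = k} (λ i → i))) (length-filter-¬ meets? (allFin k))))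
          (+-monoˡ-≤ (length rest) few))
        avoids : ∀ i a → ¬ H (f (lookup rest i) a)
        avoids i a p = proj₂ (∈-filter⁻ (λ i → ¬? (meets? i)) {xs = allFin k} (∈-lookup i)) (a , p)
        -- A path that avoids `H` and meets `C` lies in `C` entirely by `closed`; then `thin`
        -- identifies its two ends.
        stuck : ∀ i → (∀ a → ¬ H (f i a)) → ∀ a → ¬ C (f i a)
        stuck i av a c with isP i
        ... | e₁ , e₂ = distinct (thin (c0 a c) (c1 a c) (c2 a c) e₁ e₂)
          where
          distinct : f i 0F ≢ f i 2F
          distinct e with inj i 0F i 2F e
          ... | _ , ()
          go : ∀ {a b} → C (f i a) → E (f i a) (f i b) → C (f i b)
          go {a} {b} c e with closed c e
          ... | inj₁ h = contradiction h (av b)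
          ... | inj₂ c = c
          E-sym : ∀ {u v} → E u v → E v u
          E-sym {u} {v} e = trans (Graph.sym G v u) e
          c1 : ∀ a → C (f i a) → C (f i 1F)
          c1 0F c = go {0F} {1F} c e₁
          c1 1F c = c
          c1 2F c = go {2F} {1F} c (E-sym e₂)
          c0 : ∀ a → C (f i a) → C (f i 0F)
          c0 a c = go {1F} {0F} (c1 a c) (E-sym e₁)
          c2 : ∀ a → C (f i a) → C (f i 2F)
          c2 a c = go {1F} {2F} (c1 a c) e₂
        inside : ∀ i a → f (lookup rest i) a ∈ vs
        inside i a = vs-all (avoids i a) (stuck (lookup rest i) (avoids i) a)
        g : Fin (length rest) → Fin 3 → Fin (length vs)
        g i a = index (inside i a)
        g-lookup : ∀ i a → f (lookup rest i) a ≡ lookup vs (g i a)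
        g-lookup i a = lookup-index (inside i a)
        g-P₂ : ∀ i → IsP₂ (induced G vs) (g i)
        g-P₂ i = trans (cong₂ (adj G) (sym (g-lookup i 0F)) (sym (g-lookup i 1F))) (proj₁ (isP (lookup rest i)))
               , trans (cong₂ (adj G) (sym (g-lookup i 1F)) (sym (g-lookup i 2F))) (proj₂ (isP (lookup rest i)))
        g-inj : ∀ i a j b → g i a ≡ g j b → i ≡ j × a ≡ b
        g-inj i a j b e with inj (lookup rest i) a (lookup rest j) b
                               (trans (g-lookup i a) (trans (cong (lookup vs) e) (sym (g-lookup j b))))
        ... | e₁ , e₂ = lookup-injective (filter⁺ (λ i → ¬? (meets? i)) (allFin⁺ k)) i j e₁ , e₂

      crown-extends : ∀ k → HasP₂Packing (induced G vs) (k ∸ count H? (allFin _)) → HasP₂Packing G k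
      -- The inequality `k ≤ |H| + (k ∸ |H|)` also covers `k < |H|`, where the paths through `H`
      -- alone are enough.
      crown-extends k (f , isP , inj) = packing-≤ G (m≤n+m∸n k (length hs)) (g , g-P₂ , g-inj)
        where
        in-H : ∀ i → H (lookup hs i)
        in-H i = proj₂ (∈-filter⁻ H? {xs = allFin _} (∈-lookup i))
        pick : Fin (length hs) ⊎ Fin (k ∸ length hs) → Fin 3 → V
        pick (inj₁ i) a = π (lookup hs i) (in-H i) a
        pick (inj₂ i) a = lookup vs (f i a)
        pick-P₂ : ∀ x → IsP₂ G (pick x)
        pick-P₂ (inj₁ i) = π-P₂ (lookup hs i) (in-H i)
        pick-P₂ (inj₂ i) = isP i
        clash : ∀ i a j b → pick (inj₁ i) a ≢ pick (inj₂ j) b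
        clash i a j b e with π-in (lookup hs i) (in-H i) a | vs-in (∈-lookup {xs = vs} (f j b))
        ... | inj₁ h | ¬h , _ = ¬h (subst H e h)
        ... | inj₂ c | _ , ¬c = ¬c (subst C e c)
        pick-inj : ∀ x a y b → pick x a ≡ pick y b → x ≡ y × a ≡ b
        pick-inj (inj₁ i) a (inj₁ j) b e with lookup-injective hs-unique i j (π-apart e)
        ... | refl = refl , π-inj (lookup hs i) (in-H i) a b e
        pick-inj (inj₁ i) a (inj₂ j) b e = contradiction e (clash i a j b)
        pick-inj (inj₂ i) a (inj₁ j) b e = contradiction (sym e) (clash j b i a)
        pick-inj (inj₂ i) a (inj₂ j) b e =
          let (e₁ , e₂) = inj i a j b (lookup-injective vs-unique (f i a) (f j b) e) in cong inj₂ e₁ , e₂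
        g : Fin (length hs + (k ∸ length hs)) → Fin 3 → V
        g i = pick (splitAt (length hs) i)
        g-P₂ : ∀ i → IsP₂ G (g i)
        g-P₂ i = pick-P₂ (splitAt (length hs) i)
        g-inj : ∀ i a j b → g i a ≡ g j b → i ≡ j × a ≡ b
        g-inj i a j b e with pick-inj (splitAt (length hs) i) a (splitAt (length hs) j) b e
        ... | e₁ , e₂ = trans (sym (join-splitAt (length hs) _ i)) (trans (cong (join (length hs) _) e₁) (join-splitAt (length hs) _ j)) , e₂

      crown-⇔ : ∀ k → HasP₂Packing G k ⇔ HasP₂Packing (induced G vs) (k ∸ count H? (allFin _))
      crown-⇔ k = mk⇔ (crown-reduces k) (crown-extends k)

-- The kernelization as a vertex program

module KernelProgram where
  open TapeLayout
  open ProgramLogic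
  open PackingSearch
  open SlotAuction
  open import Data.Vec as Vec using (Vec; _∷_)

  open Mem
  open Formulas

  -- The body always fails, so that `any` visits every vertex.
  forAll : ∀ {v} → Form 8 (suc v) → Prog 8 (suc v) → Prog 8 v
  forAll φ C = any (ite ⌜ φ ⌝ (seq C (ret false)) (ret false))

  used : ∀ {v} → Fin v → Form 8 v
  used i = ex (rel Bᵣ (suc i) 0F)

  -- Every class spends one unit of the budget k; success means that the budget ran out.
  overflow : ∀ {v} → Prog 8 v
  overflow = any (ite ⌜ used 0F ⌝ (ite (tick false) (ret false) (ret true)) (ret false))

  -- Produces the trivial yes-instance: no vertices and, as there are more than `k` classes, no
  -- budget either.
  eraseAll : ∀ {v} → Prog 8 v
  eraseAll = seq (forAll (0F ≐ 0F) (kill 0F)) (forAll (used 0F) (tick true))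

  -- Some price of kind s is exactly one more than l.
  top : ∀ {v} → Fin 3 → Fin v → Form 8 v
  top s l = ex (rel (prcᵣ s) 0F (suc l) & neg (ex (suc (suc l) ≺ 0F & rel (prcᵣ s) 1F 0F)))

  gap : ∀ {v} → Fin v → Form 8 v
  gap l = neg (top 0F l) & neg (top 1F l) & neg (top 2F l)

  -- The side `H` of the crown: vertices owning a slot that costs more than the level `1F`.
  head : ∀ {v} → Form 8 (2 + v)
  head = rel (prcᵣ 0F) 0F 1F or rel (prcᵣ 1F) 0F 1F or rel (prcᵣ 2F) 0F 1F

  reached : ∀ {v} → Fin 3 → Form 8 (2 + v)
  reached s = ex (ex (rel (asgᵣ s) 1F 0F & (0F ≐ 2F or rel Eᵣ 0F 2F) & rel (prcᵣ s) 1F 3F))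

  -- The side `C` of the crown: outside vertices whose component is unserved or holds a slot costing
  -- more than the level.
  tail : ∀ {v} → Form 8 (2 + v)
  tail = outside 0F & (neg (taken 0F 0F) & neg (taken 1F 0F) & neg (taken 2F 0F)
                       or reached 0F or reached 1F or reached 2F)

  cutCrown : ∀ {v} → Prog 8 (suc v)
  cutCrown = seq (forAll head (kill 0F)) (seq (forAll head (tick true)) (forAll tail (kill 0F)))

  removeCrown : ∀ {v} → Prog 8 v
  removeCrown = any (guard (gap 0F) cutCrown)

  kernel : Prog 8 0
  kernel = seq localSearch (seq auction (ite overflow eraseAll removeCrown))

  module Loops {n : ℕ} (k : ℕ) where
    open Logic {8} {n} k

    -- Formulas read the relations only. Deletions and ticks made by a loop thus leave its later
    -- tests, and those of the following loops, as they were.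
    form-≡ : ∀ {v} (φ : Form 8 v) ρ {m m'} → rels m ≡ rels m' → ⟦ φ ⟧ ρ m → ⟦ φ ⟧ ρ m'
    form-≡ (rel x i j) ρ e p = trans (cong (λ R → R x _ _) (sym e)) p
    form-≡ (i ≐ j)     ρ e p = p
    form-≡ (i ≺ j)     ρ e p = p
    form-≡ (neg φ)     ρ e p = λ q → p (form-≡ φ ρ (sym e) q)
    form-≡ (φ & ψ)     ρ e (p , q) = form-≡ φ ρ e p , form-≡ ψ ρ e q
    form-≡ (φ or ψ)    ρ e (inj₁ p) = inj₁ (form-≡ φ ρ e p)
    form-≡ (φ or ψ)    ρ e (inj₂ q) = inj₂ (form-≡ ψ ρ e q)
    form-≡ (ex φ)      ρ e (i , p) = i , form-≡ φ (i ∷ ρ) e p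

    private
      branch : ∀ {v} (φ : Form 8 v) A B ρ m →
        (⟦ φ ⟧ ρ m × eval (ite ⌜ φ ⌝ A B) ρ m ≡ eval A ρ m) ⊎ (¬ ⟦ φ ⟧ ρ m × eval (ite ⌜ φ ⌝ A B) ρ m ≡ eval B ρ m)
      branch φ A B ρ m rewrite eval-form φ ρ m with check φ ρ m
      ... | yes p = inj₁ (p , refl)
      ... | no ¬p = inj₂ (¬p , refl)

      Iterates : (R : Fin 8 → Fin n → Fin n → Bool) (P : Fin n → Set) (act : Fin n → M → M) (f : Fin n → M → Bool × M) → Set
      Iterates R P act f = ∀ i m → rels m ≡ R → (P i × f i m ≡ (false , act i m)) ⊎ (¬ P i × f i m ≡ (false , m))

      iterates : ∀ {v} φ C (ρ : Vec (Fin n) v) m₀ →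
        Iterates (rels m₀) (λ i → ⟦ φ ⟧ (i ∷ ρ) m₀) (λ i m → proj₂ (eval C (i ∷ ρ) m))
                 (λ i → eval (ite ⌜ φ ⌝ (seq C (ret false)) (ret false)) (i ∷ ρ))
      iterates φ C ρ m₀ i m e with branch φ (seq C (ret false)) (ret false) (i ∷ ρ) m
      ... | inj₁ (p , eq)  = inj₁ (form-≡ φ (i ∷ ρ) e p , eq)
      ... | inj₂ (¬p , eq) = inj₂ ((λ p → ¬p (form-≡ φ (i ∷ ρ) (sym e) p)) , eq)

      anyM-false : ∀ {l} {f : Fin (suc l) → M → Bool × M} {m m'} → f zero m ≡ (false , m') →
        anyM f m ≡ anyM (f ∘ suc) m'
      anyM-false eq rewrite eq = refl

    record Killed (P : Fin n → Set) (m m' : M) : Set where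
      field
        kills  : ∀ {v} → dead m' v ≡ true → dead m v ≡ true ⊎ P v
        killed : ∀ {v} → P v → dead m' v ≡ true
        stays  : ∀ {v} → dead m v ≡ true → dead m' v ≡ true
        rels≡  : rels m' ≡ rels m
        ticks≡ : ticks m' ≡ ticks m

    forAll-kill : ∀ {v} φ (ρ : Vec (Fin n) v) m →
      Killed (λ i → ⟦ φ ⟧ (i ∷ ρ) m) m (proj₂ (eval (forAll φ (kill 0F)) ρ m))
    forAll-kill φ ρ m₀ =
      let (a , b , c , d , e) = go (λ i → i) m₀ refl
      in record { kills = a ; killed = λ {v} p → b v p ; stays = c ; rels≡ = d ; ticks≡ = e }
      where
      P : Fin n → Set
      P i = ⟦ φ ⟧ (i ∷ ρ) m₀
      f : Fin n → M → Bool × M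
      f i = eval (ite ⌜ φ ⌝ (seq (kill 0F) (ret false)) (ret false)) (i ∷ ρ)
      Result : ∀ {l} → (Fin l → Fin n) → M → M → Set
      Result ψ m m' = (∀ {v} → dead m' v ≡ true → dead m v ≡ true ⊎ P v) × (∀ j → P (ψ j) → dead m' (ψ j) ≡ true)
        × (∀ {v} → dead m v ≡ true → dead m' v ≡ true) × rels m' ≡ rels m × ticks m' ≡ ticks m
      go : ∀ {l} (ψ : Fin l → Fin n) m → rels m ≡ rels m₀ → Result ψ m (proj₂ (anyM (f ∘ ψ) m))
      go {zero}  ψ m e = inj₁ , (λ ()) , (λ d → d) , refl , refl
      go {suc l} ψ m e with iterates φ (kill 0F) ρ m₀ (ψ zero) m e
      ... | inj₁ (p , eq) = subst (Result ψ m) (sym (cong proj₂ (anyM-false {f = f ∘ ψ} eq))) (extend (go (ψ ∘ suc) m′ e))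
        where
        m′ : M
        m′ = killVertex (ψ zero) m
        split : ∀ {v} → dead m′ v ≡ true → dead m v ≡ true ⊎ P v
        split {v} d with dead m v | v == ψ zero in q
        ... | true  | _    = inj₁ refl
        ... | false | true = inj₂ (subst P (sym (==⇒≡ q)) p)
        grow : ∀ {v} → dead m v ≡ true → dead m′ v ≡ true
        grow d rewrite d = refl
        extend : ∀ {m''} → Result (ψ ∘ suc) m′ m'' → Result ψ m m''
        extend (a , b , c , d , e) = (λ x → [ split , inj₂ ]′ (a x))
          , (λ { zero _ → c here′ ; (suc j) p → b j p }) , (λ x → c (grow x)) , d , e
          where
          here′ : dead m′ (ψ zero) ≡ true
          here′ rewrite ==-refl (ψ zero) = ∨-zeroʳ (dead m (ψ zero))
      ... | inj₂ (¬p , eq) = subst (Result ψ m) (sym (cong proj₂ (anyM-false {f = f ∘ ψ} eq))) (extend (go (ψ ∘ suc) m e))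
        where
        extend : ∀ {m''} → Result (ψ ∘ suc) m m'' → Result ψ m m''
        extend (a , b , c , d , e) = a , (λ { zero p → contradiction p ¬p ; (suc j) p → b j p }) , c , d , e

    record Ticked (c : ℕ) (m m' : M) : Set where
      field
        ticks-true : ticks m' true ≡ (ticks m true + c) ⊓ k
        rels≡      : rels m' ≡ rels m
        dead≡      : dead m' ≡ dead m

    private
      ⊓-absorb : ∀ a c → (a ⊓ k + c) ⊓ k ≡ (a + c) ⊓ k
      ⊓-absorb a c with ≤-total a k
      ... | inj₁ a≤k = cong (λ z → (z + c) ⊓ k) (m≤n⇒m⊓n≡m a≤k)
      ... | inj₂ k≤a = trans (cong (λ z → (z + c) ⊓ k) (m≥n⇒m⊓n≡n k≤a))
        (trans (m≥n⇒m⊓n≡n (m≤m+n k c)) (sym (m≥n⇒m⊓n≡n (≤-trans k≤a (m≤m+n a c)))))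

    forAll-tick : ∀ {v} φ (ρ : Vec (Fin n) v) m → ticks m true ≤ k →
      Ticked (count (λ i → check φ (i ∷ ρ) m) (allFin n)) m (proj₂ (eval (forAll φ (tick true)) ρ m))
    forAll-tick φ ρ m₀ le = go (λ i → i) m₀ refl le
      where
      P? : ∀ i → Dec (⟦ φ ⟧ (i ∷ ρ) m₀)
      P? i = check φ (i ∷ ρ) m₀
      f : Fin n → M → Bool × M
      f i = eval (ite ⌜ φ ⌝ (seq (tick true) (ret false)) (ret false)) (i ∷ ρ)
      go : ∀ {l} (ψ : Fin l → Fin n) m → rels m ≡ rels m₀ → ticks m true ≤ k →
        Ticked (count P? (tabulate ψ)) m (proj₂ (anyM (f ∘ ψ) m))
      go {zero} ψ m e le = record
        { ticks-true = sym (trans (cong (_⊓ k) (+-identityʳ _)) (m≤n⇒m⊓n≡m le)) ; rels≡ = refl ; dead≡ = refl }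
      go {suc l} ψ m e le with P? (ψ zero) | iterates φ (tick true) ρ m₀ (ψ zero) m e
      ... | yes p | inj₂ (¬p , _) = contradiction p ¬p
      ... | no ¬p | inj₁ (p , _)  = contradiction p ¬p
      ... | no _  | inj₂ (_ , eq) = subst (Ticked _ m) (sym (cong proj₂ (anyM-false {f = f ∘ ψ} eq))) (go (ψ ∘ suc) m e le)
      ... | yes _ | inj₁ (_ , eq) = subst (Ticked _ m) (sym (cong proj₂ (anyM-false {f = f ∘ ψ} eq)))
          (extend (go (ψ ∘ suc) (tickMem k true m) e (m⊓n≤n _ k)))
        where
        extend : ∀ {c m''} → Ticked c (tickMem k true m) m'' → Ticked (suc c) m m''
        extend {c} t = record
          { ticks-true = trans (Ticked.ticks-true t) (trans (⊓-absorb (suc (ticks m true)) c)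
              (cong (_⊓ k) (sym (+-suc (ticks m true) c))))
          ; rels≡ = Ticked.rels≡ t ; dead≡ = Ticked.dead≡ t }

    record Overflowed (c : ℕ) (m : M) (o : Bool × M) : Set where
      field
        verdict    : (proj₁ o ≡ true × k < ticks m false + c) ⊎ (proj₁ o ≡ false × ticks m false + c ≤ k)
        rels≡      : rels (proj₂ o) ≡ rels m
        dead≡      : dead (proj₂ o) ≡ dead m
        ticks-true : ticks (proj₂ o) true ≡ ticks m true

    overflowed : ∀ {v} (ρ : Vec (Fin n) v) m → ticks m false ≤ k →
      Overflowed (count (λ i → check (used 0F) (i ∷ ρ) m) (allFin n)) m (eval overflow ρ m)
    overflowed ρ m₀ le = go (λ i → i) m₀ refl le
      where
      P? : ∀ i → Dec (⟦ used 0F ⟧ (i ∷ ρ) m₀)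
      P? i = check (used 0F) (i ∷ ρ) m₀
      f : Fin n → M → Bool × M
      f i = eval (ite ⌜ used 0F ⌝ (ite (tick false) (ret false) (ret true)) (ret false)) (i ∷ ρ)
      body : ∀ i m → rels m ≡ rels m₀ → (⟦ used 0F ⟧ (i ∷ ρ) m₀ × f i m ≡ eval (ite (tick false) (ret false) (ret true)) (i ∷ ρ) m)
        ⊎ (¬ ⟦ used 0F ⟧ (i ∷ ρ) m₀ × f i m ≡ (false , m))
      body i m e with branch (used 0F) (ite (tick false) (ret false) (ret true)) (ret false) (i ∷ ρ) m
      ... | inj₁ (p , eq)  = inj₁ (form-≡ (used 0F) (i ∷ ρ) {m} {m₀} e p , eq)
      ... | inj₂ (¬p , eq) = inj₂ ((λ p → ¬p (form-≡ (used 0F) (i ∷ ρ) {m₀} {m} (sym e) p)) , eq)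
      inner : ∀ i m → (ticks m false < k × eval (ite (tick false) (ret false) (ret true)) (i ∷ ρ) m ≡ (false , tickMem k false m))
        ⊎ (k ≤ ticks m false × eval (ite (tick false) (ret false) (ret true)) (i ∷ ρ) m ≡ (true , tickMem k false m))
      inner i m with ticks m false <? k
      ... | yes p rewrite <ᵇ-true p = inj₁ (p , refl)
      ... | no p  rewrite <ᵇ-false (≮⇒≥ p) = inj₂ (≮⇒≥ p , refl)
      anyM-true : ∀ {l} {f : Fin (suc l) → M → Bool × M} {m m'} → f zero m ≡ (true , m') → anyM f m ≡ (true , m')
      anyM-true eq rewrite eq = refl
      go : ∀ {l} (ψ : Fin l → Fin n) m → rels m ≡ rels m₀ → ticks m false ≤ k → Overflowed (count P? (tabulate ψ)) m (anyM (f ∘ ψ) m)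
      go {zero} ψ m e le = record
        { verdict = inj₂ (refl , ≤-trans (≤-reflexive (+-identityʳ _)) le) ; rels≡ = refl ; dead≡ = refl ; ticks-true = refl }
      go {suc l} ψ m e le with P? (ψ zero) | body (ψ zero) m e
      ... | yes p | inj₂ (¬p , _) = contradiction p ¬p
      ... | no ¬p | inj₁ (p , _)  = contradiction p ¬p
      ... | no _  | inj₂ (_ , eq) = subst (Overflowed _ m) (sym (anyM-false {f = f ∘ ψ} eq)) (go (ψ ∘ suc) m e le)
      ... | yes _ | inj₁ (_ , eq) with inner (ψ zero) m
      ... | inj₂ (k≤ , eq') = subst (Overflowed _ m) (sym (anyM-true {f = f ∘ ψ} (trans eq eq'))) record
            { verdict = inj₁ (refl , ≤-<-trans k≤ (m<m+n _ (s≤s z≤n))) ; rels≡ = refl ; dead≡ = refl ; ticks-true = refl }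
      ... | inj₁ (<k , eq') = subst (Overflowed _ m) (sym (anyM-false {f = f ∘ ψ} (trans eq eq')))
            (extend (go (ψ ∘ suc) (tickMem k false m) e (m⊓n≤n _ k)))
        where
        t≡ : suc (ticks m false) ⊓ k ≡ suc (ticks m false)
        t≡ = m≤n⇒m⊓n≡m <k
        extend : ∀ {c o} → Overflowed c (tickMem k false m) o → Overflowed (suc c) m o
        extend {c} t = record
          { verdict = [ (λ (b , lt′) → inj₁ (b , ≤-trans lt′ (≤-reflexive shift)))
                      , (λ (b , le′) → inj₂ (b , ≤-trans (≤-reflexive (sym shift)) le′)) ]′ (Overflowed.verdict t)
          ; rels≡ = Overflowed.rels≡ t ; dead≡ = Overflowed.dead≡ t ; ticks-true = Overflowed.ticks-true t }
          where
          shift : suc (ticks m false) ⊓ k + c ≡ ticks m false + suc c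
          shift = trans (cong (_+ c) t≡) (sym (+-suc (ticks m false) c))

-- Local optima, the charge of seven, and the crown at a missing price

module KernelAnalysis where
  open import Defs using (Graph; adj; HasP₂Packing; IsP₂)
  open TapeLayout
  open Execution using (induced; survivors; alive)
  open ProgramLogic
  open PackingSearch
  open SlotAuction
  open CrownReduction
  open KernelProgram
  open import Data.Vec as Vec using ()

  open Mem

  module Analysis (G : Graph) (k : ℕ) where
    m₀ : Mem 8 (Graph.n G)
    m₀ = startMem (adj G)

    open LocalSearch G k m₀
    open Logic {8} {n} k
    open Packing
    open Triple using (only)

    module Packed (1≤n : 1 ≤ n) (m₁ : M) (inv₁ : Inv m₁) (st₁ : Stable m₁) where
      private
        pk : Packing m₁
        pk = proj₂ inv₁

        edge : ∀ {a b} → E a b → rels m₁ Eᵣ a b ≡ true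
        edge {a} {b} e = trans (same-rels (proj₁ inv₁) Eᵣ (λ ()) a b) e

      triple-of : ∀ {i v} → B m₁ i v → Triple m₁ i
      triple-of {i} {v} b with classes pk i
      ... | inj₁ empty = contradiction b (empty v)
      ... | inj₂ t     = t

      -- Otherwise the n classes would contain more than n vertices.
      some-unused : ∃[ j ] ¬ Used m₁ j
      some-unused with any? (λ j → ¬? (used? m₁ j))
      ... | yes p = p
      ... | no np = ⊥-elim (overfull 1≤n refl)
        where
        trip : ∀ j → Triple m₁ j
        trip j with used? m₁ j
        ... | yes (_ , b) = triple-of b
        ... | no nu       = contradiction (j , nu) np
        overfull : ∀ {l} → 1 ≤ l → l ≡ n → ⊥
        overfull (s≤s {n = l} _) refl = clash (pigeonhole (n<1+n n) f)
          where
          f : Fin (suc n) → V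
          f zero    = Triple.q (trip zero)
          f (suc j) = Triple.p (trip j)
          clash : ∃[ i ] ∃[ j ] (i Fin.< j × f i ≡ f j) → ⊥
          clash (zero , suc j , _ , e) with disjoint pk (subst (B m₁ zero) e (Triple.Bq (trip zero))) (Triple.Bp (trip j))
          ... | refl = Triple.p≢q (trip zero) (sym e)
          clash (suc i , suc j , s≤s i<j , e) with disjoint pk (subst (B m₁ i) e (Triple.Bp (trip i))) (Triple.Bp (trip j))
          ... | refl = <-irrefl refl i<j

      acyclic : ∀ {x y z} → Q m₁ x → Q m₁ y → Q m₁ z → E x y → E y z → x ≡ z
      acyclic {x} {y} {z} qx qy qz exy eyz with x Fin.≟ z
      ... | yes e = e
      ... | no ne = contradiction (qx , qy , qz , edge exy , edge eyz , ne , proj₂ some-unused)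
                      (Stable.none₁ st₁ x y z (proj₁ some-unused))

      -- A class spans a path on three vertices, so its third vertex is adjacent to one of the other
      -- two. This is the edge inside the class that move 2 keeps.
      third : ∀ {i u w} → B m₁ i u → B m₁ i w → u ≢ w → ∃[ r ] (B m₁ i r × r ≢ u × r ≢ w × (E u r ⊎ E w r))
      third {i} bu bw u≢w with triple-of bu
      ... | triple p q s p≢q p≢s q≢s epq eqs bp bq bs only with only bu | only bw
      ... | inj₁ refl        | inj₁ refl        = contradiction refl u≢w
      ... | inj₁ refl        | inj₂ (inj₁ refl) = s , bs , ≢-sym p≢s , ≢-sym q≢s , inj₂ eqs
      ... | inj₁ refl        | inj₂ (inj₂ refl) = q , bq , ≢-sym p≢q , q≢s , inj₁ epq
      ... | inj₂ (inj₁ refl) | inj₁ refl        = s , bs , ≢-sym q≢s , ≢-sym p≢s , inj₁ eqs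
      ... | inj₂ (inj₁ refl) | inj₂ (inj₁ refl) = contradiction refl u≢w
      ... | inj₂ (inj₁ refl) | inj₂ (inj₂ refl) = p , bp , p≢q , p≢s , inj₁ (E-sym epq)
      ... | inj₂ (inj₂ refl) | inj₁ refl        = q , bq , q≢s , ≢-sym p≢q , inj₂ epq
      ... | inj₂ (inj₂ refl) | inj₂ (inj₁ refl) = p , bp , p≢s , p≢q , inj₂ (E-sym epq)
      ... | inj₂ (inj₂ refl) | inj₂ (inj₂ refl) = contradiction refl u≢w

      open Auction G k m₁ acyclic

      Lone : V → Set
      Lone x = ¬ Paired x

      -- Otherwise move 2 applies. If the third vertex `r` is adjacent to `u`, then `x` replaces `w`
      -- in the class and the released `w` gets the edge to `y`; the other case is symmetric.
      same-lone : ∀ {i u w x y} → B m₁ i u → B m₁ i w → u ≢ w → Q m₁ x → Q m₁ y → Lone x → Lone y → E u x → E w y → x ≡ y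
      same-lone {i} {u} {w} {x} {y} bu bw u≢w qx qy lx ly eux ewy with x Fin.≟ y
      ... | yes e = e
      ... | no x≢y with third bu bw u≢w
      ... | r , br , r≢u , r≢w , inj₁ eur = contradiction
            (bw , bu , br , ≢-sym u≢w , ≢-sym r≢w , edge eur , qx , qy , x≢y , alone lx , edge (E-sym eux) , edge ewy)
            (Stable.none₂ st₁ i w u r x y)
        where
        alone : Lone x → ¬ (∃[ v ] (Q m₁ v × rels m₁ Eᵣ x v ≡ true))
        alone l (v , q , e) = l (v , q , trans (sym (same-rels (proj₁ inv₁) Eᵣ (λ ()) x v)) e)
      ... | r , br , r≢u , r≢w , inj₂ ewr = contradiction
            (bu , bw , br , u≢w , ≢-sym r≢u , edge ewr , qy , qx , ≢-sym x≢y , alone ly , edge (E-sym ewy) , edge eux)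
            (Stable.none₂ st₁ i u w r y x)
        where
        alone : Lone y → ¬ (∃[ v ] (Q m₁ v × rels m₁ Eᵣ y v ≡ true))
        alone l (v , q , e) = l (v , q , trans (sym (same-rels (proj₁ inv₁) Eᵣ (λ ()) y v)) e)

      -- Otherwise `u`, `x`, `x'` and `w`, `y`, `y'` are disjoint paths, and move 3 splits the class
      -- into these two.
      same-pair : ∀ {i u w x y} → B m₁ i u → B m₁ i w → u ≢ w → Q m₁ x → Q m₁ y →
        Paired x → Paired y → E u x → E w y → x ≈ y
      same-pair {i} {u} {w} {x} {y} bu bw u≢w qx qy (x' , qx' , exx') (y' , qy' , eyy') eux ewy
        with x Fin.≟ y | adj G x y Bool.≟ true
      ... | yes e | _     = inj₁ e
      ... | no _  | yes e = inj₂ e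
      ... | no ne | no na = contradiction
            (bu , bw , u≢w , qx , qx' , qy , qy' , ne , (λ { refl → na (E-sym eyy') }) , (λ { refl → na exx' })
            , (λ { refl → ne (acyclic qx qx' qy exx' (E-sym eyy')) })
            , edge eux , edge exx' , edge ewy , edge eyy' , proj₂ some-unused)
            (Stable.none₃ st₁ i u w x x' y y' (proj₁ some-unused))

      module Auctioned (m₂ : M) (inv₂ : Inv′ m₂) (st₂ : Stable′ m₂) where
        open Inv′ inv₂

        private
          member : ∀ {i} → (∀ v → ¬ B m₁ i v) ⊎ Triple m₁ i → Fin 3 → V → Set
          member (inj₁ _) _  v = ⊥
          member (inj₂ t) 0F v = v ≡ Triple.p t
          member (inj₂ t) 1F v = v ≡ Triple.q t
          member (inj₂ t) 2F v = v ≡ Triple.s t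

          -- Class i accounts for its own three vertices, two isolated vertices and one K₂.
          Charged : V → V × Fin 7 → Set
          Charged v (i , 0F) = member (classes pk i) 0F v
          Charged v (i , 1F) = member (classes pk i) 1F v
          Charged v (i , 2F) = member (classes pk i) 2F v
          Charged v (i , 3F) = ∃[ h ] (B m₁ i h × Asg m₂ 1F h v)
          Charged v (i , 4F) = ∃[ h ] (B m₁ i h × Asg m₂ 2F h v)
          Charged v (i , 5F) = ∃[ h ] (B m₁ i h × Asg m₂ 0F h v)
          Charged v (i , 6F) = ∃[ h ] ∃[ y ] (B m₁ i h × Asg m₂ 0F h y × E y v × Out v)

          member-unique : ∀ {i} c (a : Fin 3) {v w} → member {i} c a v → member c a w → v ≡ w
          member-unique (inj₂ t) 0F e e' = trans e (sym e')
          member-unique (inj₂ t) 1F e e' = trans e (sym e')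
          member-unique (inj₂ t) 2F e e' = trans e (sym e')

          -- By `same-lone` two owners in one class can only hold the same isolated vertex, so each
          -- of the slots 1 and 2 accounts for one vertex per class.
          lone-unique : ∀ {i h g s v w} → B m₁ i h → B m₁ i g → Asg m₂ (suc s) h v → Asg m₂ (suc s) g w → v ≡ w
          lone-unique {h = h} {g} bh bg av aw with h Fin.≟ g
          ... | yes refl = single av aw
          ... | no ne    =
            let (_ , qv , ev , lv) = suitable av
                (_ , qw , ew , lw) = suitable aw
            in same-lone bh bg ne qv qw lv lw ev ew

          -- Two owners in one class would hold the same K₂ by `same-pair`, but `once` serves a
          -- component at most once.
          pair-unique : ∀ {i h g v w} → B m₁ i h → B m₁ i g → Asg m₂ 0F h v → Asg m₂ 0F g w → v ≡ w
          pair-unique {h = h} {g} bh bg av aw with h Fin.≟ g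
          ... | yes refl = single av aw
          ... | no ne    =
            let (_ , qv , ev , lv) = suitable av
                (_ , qw , ew , lw) = suitable aw
            in contradiction (proj₂ (once av aw (same-pair bh bg ne qv qw lv lw ev ew))) ne

          charged-unique : ∀ {v w ic} → Charged v ic → Charged w ic → v ≡ w
          charged-unique {ic = i , 0F} = member-unique (classes pk i) 0F
          charged-unique {ic = i , 1F} = member-unique (classes pk i) 1F
          charged-unique {ic = i , 2F} = member-unique (classes pk i) 2F
          charged-unique {ic = i , 3F} (h , bh , ah) (g , bg , ag) = lone-unique bh bg ah ag
          charged-unique {ic = i , 4F} (h , bh , ah) (g , bg , ag) = lone-unique bh bg ah ag
          charged-unique {ic = i , 5F} (h , bh , ah) (g , bg , ag) = pair-unique bh bg ah ag
          charged-unique {ic = i , 6F} (h , y , bh , ah , e , qv) (g , z , bg , ag , e' , qw)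
            with pair-unique bh bg ah ag
          ... | refl = acyclic qv (proj₁ (proj₂ (suitable ah))) qw (E-sym e) e'

          owner : ∀ {h} → ¬ Out h → ∃[ i ] B m₁ i h
          owner {h} nq with any? (λ i → rels m₁ Bᵣ i h Bool.≟ true)
          ... | yes p = p
          ... | no np = contradiction np nq

          charge : ∀ v → (Out v → Taken m₂ v) → ∃[ i ] ∃[ c ] (Used m₁ i × Charged v (i , c))
          charge v h with Q? m₁ v
          ... | no nq = position (owner nq)
            where
            position : ∃[ i ] B m₁ i v → ∃[ i ] ∃[ c ] (Used m₁ i × Charged v (i , c))
            position (i , b) with classes pk i in eq
            ... | inj₁ empty = contradiction b (empty v)
            ... | inj₂ t with only t b
            ... | inj₁ e        = i , 0F , (v , b) , subst (λ c → member c 0F v) (sym eq) e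
            ... | inj₂ (inj₁ e) = i , 1F , (v , b) , subst (λ c → member c 1F v) (sym eq) e
            ... | inj₂ (inj₂ e) = i , 2F , (v , b) , subst (λ c → member c 2F v) (sym eq) e
          ... | yes q with h q
          ... | s , g , y , a , e with owner (proj₁ (suitable a))
          ... | i , bg = slot s a e
            where
            slot : ∀ s → Asg m₂ s g y → y ≈ v → ∃[ i ] ∃[ c ] (Used m₁ i × Charged v (i , c))
            slot 0F a (inj₁ refl) = i , 5F , (g , bg) , g , bg , a
            slot 0F a (inj₂ e)    = i , 6F , (g , bg) , g , y , bg , a , e , q
            slot 1F a (inj₁ refl) = i , 3F , (g , bg) , g , bg , a
            slot 2F a (inj₁ refl) = i , 4F , (g , bg) , g , bg , a
            slot 1F a (inj₂ e)    = contradiction (v , q , e) (proj₂ (proj₂ (proj₂ (suitable a))))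
            slot 2F a (inj₂ e)    = contradiction (v , q , e) (proj₂ (proj₂ (proj₂ (suitable a))))

        -- Used for the survivors with or without a crown: in both cases the remaining outside
        -- vertices are served.
        seven : ∀ vs → Unique vs → (∀ {v} → v ∈ vs → Out v → Taken m₂ v) → length vs ≤ 7 * size m₁
        seven vs u h = ≤-trans (length-≤ {R = Charged} vs (cartesianProduct (filter (used? m₁) (allFin n)) (allFin 7)) u
            (λ {v} v∈ → let (i , c , us , ch) = charge v (h v∈)
                        in (i , c) , ∈-cartesianProduct⁺ (∈-filter⁺ (used? m₁) (∈-allFin i) us) (∈-allFin c) , ch)
            (λ {v} {w} {ic} → charged-unique {ic = ic}))
          (≤-reflexive (trans (length-cartesianProduct (filter (used? m₁) (allFin n)) (allFin 7)) (*-comm (size m₁) 7)))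

        taken? : ∀ x → Dec (Taken m₂ x)
        taken? x = any? λ s → any? λ h → any? λ y →
          (rels m₂ (asgᵣ s) h y Bool.≟ true) ×-dec ((y Fin.≟ x) ⊎-dec (adj G y x Bool.≟ true))

        -- If every price 1, …, n occurs, the customers paying them are n different vertices.
        no-gap⇒taken : (∀ (l : V) → ∃[ s ] ∃[ h ] price s h ≡ suc (toℕ l)) → ∀ x → Taken m₂ x
        no-gap⇒taken full x with taken? x
        ... | yes t = t
        ... | no nt = ⊥-elim (clash (pigeonhole (n<1+n n) f))
          where
          customer : ∀ l → ∃[ y ] Asg m₂ (proj₁ (full l)) (proj₁ (proj₂ (full l))) y
          customer l = sold (subst (0 <_) (sym (proj₂ (proj₂ (full l)))) (s≤s z≤n))
          f : Fin (suc n) → V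
          f zero    = x
          f (suc l) = proj₁ (customer l)
          clash : ∃[ i ] ∃[ j ] (i Fin.< j × f i ≡ f j) → ⊥
          clash (zero , suc j , _ , e) = nt (_ , _ , _ , proj₂ (customer j) , inj₁ (sym e))
          clash (suc i , suc j , s≤s i<j , e) =
            let (e₁ , e₂) = once (proj₂ (customer i)) (proj₂ (customer j)) (inj₁ e)
                pi≡pj = trans (sym (proj₂ (proj₂ (full i)))) (trans (cong₂ price e₁ e₂) (proj₂ (proj₂ (full j))))
            in <-irrefl (suc-injective pi≡pj) i<j

        module Gap (l : V) (gap-l : ∀ s h → price s h ≢ suc (toℕ l)) where

          H : V → Set
          H v = ∃[ s ] toℕ l < price s v

          H? : Decidable H
          H? v = any? λ s → toℕ l <? price s v

          Reached : V → Set
          Reached x = ∃[ s ] ∃[ h ] ∃[ y ] (Asg m₂ s h y × y ≈ x × toℕ l < price s h)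

          C : V → Set
          C x = Out x × (¬ Taken m₂ x ⊎ Reached x)

          -- For an unserved vertex the auction stopped only because all its slots have the full
          -- price. A reached component pays more than `l`, hence at least `l + 2` by the gap, and
          -- `cheap` gives away only one.
          expensive : ∀ {x t g} → C x → Slot t g x → toℕ l < price t g
          expensive {x} {t} {g} (_ , inj₁ nt) sl = ≰⇒> λ le →
            contradiction (trans (sym (st₂ l x g t sl nt)) (trans (priced t g l) (<ᵇ-false le))) λ ()
          expensive (_ , inj₂ (s , h , y , a , e , p)) sl =
            s≤s⁻¹ (≤-trans (≤∧≢⇒< p (λ e → gap-l s h (sym e))) (cheap a e sl))

          closed-out : ∀ {x y} → C x → E x y → Out y → C y
          closed-out {x} {y} (ox , inj₁ nt) e oy = oy , inj₁ λ (s , h , z , a , e') →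
            nt (s , h , z , a , ≈-trans (proj₁ (proj₂ (suitable a))) oy ox e' (inj₂ (E-sym e)))
          closed-out (ox , inj₂ (s , h , z , a , e' , p)) e oy =
            oy , inj₂ (s , h , z , a , ≈-trans (proj₁ (proj₂ (suitable a))) ox oy e' (inj₂ e) , p)

          suits-some : ∀ x → ∃[ s ] Suits s x
          suits-some x with any? (λ w → Q? m₁ w ×-dec (adj G x w Bool.≟ true))
          ... | yes p = 0F , p
          ... | no np = 1F , np

          -- A neighbour in the packing offers a slot of the kind that suits `x`; by `expensive`
          -- that slot is dear, so its owner lies in `H`.
          closed : ∀ {x y} → C x → E x y → H y ⊎ C y
          closed {x} {y} c e with Q? m₁ y
          ... | yes oy = inj₂ (closed-out c e oy)
          ... | no ny  = let (s , su) = suits-some x in inj₁ (s , expensive c (ny , proj₁ c , E-sym e , su))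

          thin : ∀ {x y z} → C x → C y → C z → E x y → E y z → x ≡ z
          thin (ox , _) (oy , _) (oz , _) = acyclic ox oy oz

          customer-C : ∀ {s h x} → Asg m₂ s h x → toℕ l < price s h → C x
          customer-C a p = proj₁ (proj₂ (suitable a)) , inj₂ (_ , _ , _ , a , inj₁ refl , p)

          data Star (h : V) : Set where
            edge-star : ∀ x w → Asg m₂ 0F h x → Out w → E x w → C x → C w → Star h
            pair-star : ∀ x w → Asg m₂ 1F h x → Asg m₂ 2F h w → C x → C w → Star h

          -- A dear slot has a customer. A customer with a partner gives the path `h`, `x`, `w`. An
          -- isolated one suits both slots 1 and 2 of `h`, so both are dear and sold, and their
          -- customers are the two leaves around `h`.
          star : ∀ h → H h → Star h
          star h (s , p) = build s p (sold (≤-<-trans z≤n p))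
            where
            lone-star : ∀ {s x} → Asg m₂ (suc s) h x → C x → Star h
            lone-star a c =
              let (nh , ox , e , lo) = suitable a
                  p₁ = expensive {t = 1F} c (nh , ox , e , lo)
                  p₂ = expensive {t = 2F} c (nh , ox , e , lo)
                  (x₁ , a₁) = sold (≤-<-trans z≤n p₁)
                  (x₂ , a₂) = sold (≤-<-trans z≤n p₂)
              in pair-star x₁ x₂ a₁ a₂ (customer-C a₁ p₁) (customer-C a₂ p₂)
            build : ∀ s → toℕ l < price s h → ∃[ x ] Asg m₂ s h x → Star h
            build 0F p (x , a) = let (_ , _ , _ , w , ow , e) = suitable a ; c = customer-C a p
                                 in edge-star x w a ow e c (closed-out c e ow)
            build (suc s) p (x , a) = lone-star a (customer-C a p)

          ray : ∀ {h} → Star h → Fin 3 → V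
          ray {h} (edge-star x w _ _ _ _ _) 0F = h
          ray {h} (edge-star x w _ _ _ _ _) 1F = x
          ray {h} (edge-star x w _ _ _ _ _) 2F = w
          ray {h} (pair-star x w _ _ _ _)   0F = x
          ray {h} (pair-star x w _ _ _ _)   1F = h
          ray {h} (pair-star x w _ _ _ _)   2F = w

          ray-P₂ : ∀ {h} (t : Star h) → IsP₂ G (ray t)
          ray-P₂ (edge-star x w a ow e _ _) = proj₁ (proj₂ (proj₂ (suitable a))) , e
          ray-P₂ (pair-star x w a a' _ _)   = E-sym (proj₁ (proj₂ (proj₂ (suitable a)))) , proj₁ (proj₂ (proj₂ (suitable a')))

          ray-in : ∀ {h} → H h → (t : Star h) → ∀ c → H (ray t c) ⊎ C (ray t c)
          ray-in p (edge-star x w _ _ _ cx cw) 0F = inj₁ p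
          ray-in p (edge-star x w _ _ _ cx cw) 1F = inj₂ cx
          ray-in p (edge-star x w _ _ _ cx cw) 2F = inj₂ cw
          ray-in p (pair-star x w _ _ cx cw)   0F = inj₂ cx
          ray-in p (pair-star x w _ _ cx cw)   1F = inj₁ p
          ray-in p (pair-star x w _ _ cx cw)   2F = inj₂ cw

          -- Recovers the owner from any vertex of its path, so that disjointness of the paths
          -- follows without comparing the two shapes.
          Serves : V → V → Set
          Serves h v = (¬ Out v × v ≡ h) ⊎ (Out v × ∃[ s ] ∃[ y ] (Asg m₂ s h y × y ≈ v))

          ray-serves : ∀ {h} (t : Star h) c → Serves h (ray t c)
          ray-serves (edge-star x w a ow e _ _) 0F = inj₁ (proj₁ (suitable a) , refl)
          ray-serves (edge-star x w a ow e _ _) 1F = inj₂ (proj₁ (proj₂ (suitable a)) , _ , _ , a , inj₁ refl)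
          ray-serves (edge-star x w a ow e _ _) 2F = inj₂ (ow , _ , _ , a , inj₂ e)
          ray-serves (pair-star x w a a' _ _) 0F = inj₂ (proj₁ (proj₂ (suitable a)) , _ , _ , a , inj₁ refl)
          ray-serves (pair-star x w a a' _ _) 1F = inj₁ (proj₁ (suitable a) , refl)
          ray-serves (pair-star x w a a' _ _) 2F = inj₂ (proj₁ (proj₂ (suitable a')) , _ , _ , a' , inj₁ refl)

          serves-unique : ∀ {h g v} → Serves h v → Serves g v → h ≡ g
          serves-unique (inj₁ (_ , refl)) (inj₁ (_ , refl)) = refl
          serves-unique (inj₁ (nv , _))   (inj₂ (ov , _))   = contradiction ov nv
          serves-unique (inj₂ (ov , _))   (inj₁ (nv , _))   = contradiction ov nv
          serves-unique (inj₂ (ov , s , y , a , e)) (inj₂ (_ , t , z , b , e')) =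
            proj₂ (once a b (≈-trans (proj₁ (proj₂ (suitable a))) ov (proj₁ (proj₂ (suitable b))) e (≈-sym e')))

          ray-apart : ∀ {h g} (t : Star h) (u : Star g) {c d} → ray t c ≡ ray u d → h ≡ g
          ray-apart t u {c} {d} e = serves-unique (ray-serves t c) (subst (Serves _) (sym e) (ray-serves u d))

          ray-inj : ∀ {h} (t : Star h) c d → ray t c ≡ ray t d → c ≡ d
          ray-inj {h} t@(edge-star x w a ow e _ _) = go
            where
            h≢ : ∀ {v} → Out v → h ≢ v
            h≢ ov refl = proj₁ (suitable a) ov
            go : ∀ c d → ray t c ≡ ray t d → c ≡ d
            go 0F 0F _ = refl
            go 1F 1F _ = refl
            go 2F 2F _ = refl
            go 0F 1F q = contradiction q (h≢ (proj₁ (proj₂ (suitable a))))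
            go 0F 2F q = contradiction q (h≢ ow)
            go 1F 0F q = contradiction (sym q) (h≢ (proj₁ (proj₂ (suitable a))))
            go 2F 0F q = contradiction (sym q) (h≢ ow)
            go 1F 2F q = contradiction q (E-irr e)
            go 2F 1F q = contradiction (sym q) (E-irr e)
          ray-inj {h} t@(pair-star x w a a' _ _) = go
            where
            h≢ : ∀ {v} → Out v → h ≢ v
            h≢ ov refl = proj₁ (suitable a) ov
            x≢w : x ≢ w
            x≢w q with proj₁ (once a a' (inj₁ q))
            ... | ()
            go : ∀ c d → ray t c ≡ ray t d → c ≡ d
            go 0F 0F _ = refl
            go 1F 1F _ = refl
            go 2F 2F _ = refl
            go 0F 1F q = contradiction (sym q) (h≢ (proj₁ (proj₂ (suitable a))))
            go 1F 0F q = contradiction q (h≢ (proj₁ (proj₂ (suitable a))))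
            go 1F 2F q = contradiction q (h≢ (proj₁ (proj₂ (suitable a'))))
            go 2F 1F q = contradiction (sym q) (h≢ (proj₁ (proj₂ (suitable a'))))
            go 0F 2F q = contradiction q x≢w
            go 2F 0F q = contradiction (sym q) x≢w

          gap-⇔ : ∀ {vs} → Unique vs → (∀ {v} → v ∈ vs → ¬ H v × ¬ C v) → (∀ {v} → ¬ H v → ¬ C v → v ∈ vs) →
            HasP₂Packing G k ⇔ HasP₂Packing (induced G vs) (k ∸ count H? (allFin n))
          gap-⇔ u out all = Crown.crown-⇔ G {H} {C} H? closed thin (λ h p → ray (star h p)) (λ h p → ray-P₂ (star h p))
            (λ h p → ray-in p (star h p)) (λ {h} {p} {h'} {p'} → ray-apart (star h p) (star h' p'))
            (λ h p → ray-inj (star h p)) u out all k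

-- The final memory encodes an equivalent instance of the required size

module KernelCorrectness where
  open import Defs using (Graph; adj; HasP₂Packing; P₂PackingKernel)
  open TapeLayout
  open Execution
  open ProgramLogic
  open PackingSearch
  open SlotAuction
  open CrownReduction
  open KernelProgram
  open KernelAnalysis
  open import Data.List using (lookup)
  open import Data.Vec as Vec using (Vec; []; _∷_)

  open Mem

  count-≡ : ∀ {A : Set} {P Q : A → Set} (P? : Decidable P) (Q? : Decidable Q) xs →
    (∀ x → P x → Q x) → (∀ x → Q x → P x) → count P? xs ≡ count Q? xs
  count-≡ P? Q? xs to from = ≤-antisym (count-mono P? Q? xs to) (count-mono Q? P? xs from)

  ∸-⊓ : ∀ k c → k ∸ c ⊓ k ≡ k ∸ c
  ∸-⊓ k c with ≤-total c k
  ... | inj₁ c≤k = cong (k ∸_) (m≤n⇒m⊓n≡m c≤k)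
  ... | inj₂ k≤c = trans (cong (k ∸_) (m≥n⇒m⊓n≡n k≤c)) (trans (n∸n≡0 k) (sym (m≤n⇒m∸n≡0 k≤c)))

  module Survival {r n} (m : Mem r n) where
    survivors-unique : Unique (survivors m)
    survivors-unique = filter⁺ (λ i → T? (alive m i)) (allFin⁺ n)

    survivor-alive : ∀ {v} → v ∈ survivors m → dead m v ≢ true
    survivor-alive {v} v∈ d with proj₂ (∈-filter⁻ (λ i → T? (alive m i)) {xs = allFin n} v∈)
    ... | t rewrite d = t

    alive-survives : ∀ {v} → dead m v ≢ true → v ∈ survivors m
    alive-survives {v} nd = ∈-filter⁺ (λ i → T? (alive m i)) (∈-allFin v) (go (dead m v) nd)
      where
      go : ∀ d → d ≢ true → T (not d)
      go true  nd = contradiction refl nd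
      go false nd = tt

  record Kernelised (G : Graph) (k : ℕ) (m : Mem 8 (Graph.n G)) : Set where
    field
      graph      : ∀ i j → rels m Eᵣ i j ≡ adj G i j
      equivalent : HasP₂Packing G k ⇔ HasP₂Packing (induced G (survivors m)) (k ∸ ticks m true)
      small      : length (survivors m) ≤ 7 * k

  -- The crown equivalence with both sides of the crown empty.
  untouched-⇔ : ∀ G k {vs} → Unique vs → (∀ v → v ∈ vs) → HasP₂Packing G k ⇔ HasP₂Packing (induced G vs) k
  untouched-⇔ G k {vs} u all = subst (λ c → HasP₂Packing G k ⇔ HasP₂Packing (induced G vs) (k ∸ c)) (none (allFin (Graph.n G)))
    (Crown.crown-⇔ G {λ _ → ⊥} {λ _ → ⊥} (λ _ → no λ ()) (λ ()) (λ ()) (λ _ ()) (λ _ ()) (λ _ ()) (λ { {p = ()} }) (λ _ ())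
      u (λ _ → (λ ()) , λ ()) (λ {v} _ _ → all v) k)
    where
    none : ∀ {A : Set} (xs : List A) → count {P = λ _ → ⊥} (λ _ → no λ ()) xs ≡ 0
    none []       = refl
    none (x ∷ xs) = none xs

  empty-kernelised : ∀ G k → Graph.n G ≡ 0 → Kernelised G k (startMem (adj G))
  empty-kernelised G k n≡0 = record
    { graph = λ _ _ → refl
    ; equivalent = untouched-⇔ G k survivors-unique (λ v → alive-survives λ ())
    ; small = ≤-trans (none G n≡0) z≤n }
    where
    open Survival (startMem {7} (adj G))
    none : ∀ G → Graph.n G ≡ 0 → length (survivors (startMem {7} (adj G))) ≤ 0
    none record { n = zero } refl = z≤n

  module Assembly (G : Graph) (k : ℕ) (1≤n : 1 ≤ Graph.n G) where
    open Analysis G k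
    open LocalSearch G k m₀
    open Logic {8} {n} k
    open Loops {n} k

    module _ (m₁ : M) (inv₁ : Inv m₁) (st₁ : Stable m₁) where
      open Packed 1≤n m₁ inv₁ st₁
      open Auction G k m₁ acyclic

      private
        pk : Packing m₁
        pk = proj₂ inv₁

      classes-packing : HasP₂Packing G (size m₁)
      classes-packing = f , (λ i → Triple.Epq (t i) , Triple.Eqs (t i)) , f-inj
        where
        ids : List V
        ids = filter (used? m₁) (allFin n)
        t : ∀ i → Triple m₁ (lookup ids i)
        t i = triple-of (proj₂ (proj₂ (∈-filter⁻ (used? m₁) {xs = allFin n} (∈-lookup {xs = ids} i))))
        point : ∀ {c} → Triple m₁ c → Fin 3 → V
        point t 0F = Triple.p t
        point t 1F = Triple.q t
        point t 2F = Triple.s t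
        in-class : ∀ {c} (t : Triple m₁ c) a → B m₁ c (point t a)
        in-class t 0F = Triple.Bp t
        in-class t 1F = Triple.Bq t
        in-class t 2F = Triple.Bs t
        point-inj : ∀ {c} (t : Triple m₁ c) a b → point t a ≡ point t b → a ≡ b
        point-inj t 0F 0F e = refl
        point-inj t 1F 1F e = refl
        point-inj t 2F 2F e = refl
        point-inj t 0F 1F e = contradiction e (Triple.p≢q t)
        point-inj t 0F 2F e = contradiction e (Triple.p≢s t)
        point-inj t 1F 2F e = contradiction e (Triple.q≢s t)
        point-inj t 1F 0F e = contradiction (sym e) (Triple.p≢q t)
        point-inj t 2F 0F e = contradiction (sym e) (Triple.p≢s t)
        point-inj t 2F 1F e = contradiction (sym e) (Triple.q≢s t)
        f : Fin (size m₁) → Fin 3 → V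
        f i = point (t i)
        f-inj : ∀ i a j b → f i a ≡ f j b → i ≡ j × a ≡ b
        f-inj i a j b e with lookup-injective (filter⁺ (used? m₁) (allFin⁺ n)) i j
            (Packing.disjoint pk (subst (B m₁ (lookup ids i)) e (in-class (t i) a)) (in-class (t j) b))
        ... | refl = refl , point-inj (t i) a b e

      module _ (m₂ : M) (inv₂ : Inv′ m₂) (st₂ : Stable′ m₂) where
        open Auctioned m₂ inv₂ st₂
        open Inv′ inv₂

        private
          alive₂ : ∀ v → dead m₂ v ≡ false
          alive₂ v = cong (λ d → d v) (trans (Base.unkilled base) (same-dead (proj₁ inv₁)))

          unticked₂ : ∀ c → ticks m₂ c ≡ 0
          unticked₂ c = cong (λ d → d c) (trans (Base.unticked base) (same-ticks (proj₁ inv₁)))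

          used-count : ∀ (m : M) → rels m ≡ rels m₂ → count (λ i → check (used 0F) (i ∷ []) m) (allFin n) ≡ size m₁
          used-count m e = count-≡ (λ i → check (used 0F) (i ∷ []) m) (used? m₁) (allFin n)
            (λ i (v , b) → v , trans (sym (trans (cong (λ R → R Bᵣ i v) e) (Base.packing base i v))) b)
            (λ i (v , b) → v , trans (trans (cong (λ R → R Bᵣ i v) e) (Base.packing base i v)) b)

        -- Both instances are yes-instances: `k` of the more than `k` classes form a packing of `G`,
        -- and the new budget is 0.
        erased : ∀ m₃ → rels m₃ ≡ rels m₂ → ticks m₃ true ≡ 0 → k < size m₁ →
          Kernelised G k (proj₂ (eval eraseAll [] m₃))
        erased m₃ r≡ t≡ big = record
          { graph = λ i j → trans (cong (λ R → R Eᵣ i j) (trans (Ticked.rels≡ tk) (trans (Killed.rels≡ kl) r≡))) (Base.graph base i j)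
          ; equivalent = mk⇔ (λ _ → subst (HasP₂Packing (induced G (survivors m₅))) (sym k'≡0) ((λ ()) , (λ ()) , λ ()))
                             (λ _ → packing-≤ G (<⇒≤ big) classes-packing)
          ; small = nobody (survivors m₅) (λ v∈ → Survival.survivor-alive m₅ v∈
                      (trans (cong (λ d → d _) (Ticked.dead≡ tk)) (Killed.killed kl refl))) }
          where
          m₄ m₅ : M
          m₄ = proj₂ (eval (forAll (0F ≐ 0F) (kill 0F)) [] m₃)
          m₅ = proj₂ (eval (forAll (used 0F) (tick true)) [] m₄)
          kl : Killed (λ i → ⟦ 0F ≐ 0F ⟧ (i ∷ []) m₃) m₃ m₄
          kl = forAll-kill (0F ≐ 0F) [] m₃
          t≡₄ : ticks m₄ true ≡ 0
          t≡₄ = trans (cong (λ t → t true) (Killed.ticks≡ kl)) t≡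
          tk : Ticked (count (λ i → check (used 0F) (i ∷ []) m₄) (allFin n)) m₄ m₅
          tk = forAll-tick (used 0F) [] m₄ (subst (_≤ k) (sym t≡₄) z≤n)
          c : ℕ
          c = count (λ i → check (used 0F) (i ∷ []) m₄) (allFin n)
          k'≡0 : k ∸ ticks m₅ true ≡ 0
          k'≡0 = trans (cong (k ∸_) (Ticked.ticks-true tk)) (trans (∸-⊓ k (ticks m₄ true + c)) (m≤n⇒m∸n≡0
            (≤-trans (<⇒≤ big) (≤-reflexive (sym (trans (cong (_+ c) t≡₄) (used-count m₄ (trans (Killed.rels≡ kl) r≡))))))))
          nobody : ∀ vs → (∀ {v} → v ∈ vs → ⊥) → length vs ≤ 7 * k
          nobody []       h = z≤n
          nobody (v ∷ vs) h = ⊥-elim (h (here refl))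

        module _ (m₃ : M) (r≡ : rels m₃ ≡ rels m₂) (t≡ : ticks m₃ true ≡ 0) (d≡ : ∀ v → dead m₃ v ≡ false) (fits : size m₁ ≤ k) where
          private
            graph₃ : ∀ i j → rels m₃ Eᵣ i j ≡ adj G i j
            graph₃ i j = trans (cong (λ R → R Eᵣ i j) r≡) (Base.graph base i j)

            raised⇒ : ∀ {s h l} → rels m₂ (prcᵣ s) h l ≡ true → toℕ l < price s h
            raised⇒ {s} {h} {l} r = ≰⇒> λ le → contradiction (trans (sym r) (trans (priced s h l) (<ᵇ-false le))) λ ()

            ⇒raised : ∀ {s h l} → toℕ l < price s h → rels m₂ (prcᵣ s) h l ≡ true
            ⇒raised {s} {h} {l} p = trans (priced s h l) (<ᵇ-true p)

            top⇒ : ∀ s l → ⟦ top s 0F ⟧ (l ∷ []) m₂ → ∃[ h ] price s h ≡ suc (toℕ l)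
            top⇒ s l (h , r , nh) = h , ≤-antisym (≮⇒≥ λ lt′ → nh (next lt′)) (raised⇒ r)
              where
              next : suc (toℕ l) < price s h → ∃[ l' ] (toℕ l < toℕ l' × rels m₂ (prcᵣ s) h l' ≡ true)
              next lt′ = Fin.fromℕ< sl<n , subst (toℕ l <_) (sym eq) (n<1+n _) , ⇒raised (subst (_< price s h) (sym eq) lt′)
                where
                sl<n : suc (toℕ l) < n
                sl<n = ≤-trans lt′ (price≤n s h)
                eq : toℕ (Fin.fromℕ< sl<n) ≡ suc (toℕ l)
                eq = Data.Fin.Properties.toℕ-fromℕ< sl<n

            ⇒top : ∀ s l h → price s h ≡ suc (toℕ l) → ⟦ top s 0F ⟧ (l ∷ []) m₂
            ⇒top s l h e = h , ⇒raised (subst (toℕ l <_) (sym e) (n<1+n _))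
              , λ (l' , lt′ , r) → <⇒≱ lt′ (s≤s⁻¹ (subst (toℕ l' <_) e (raised⇒ r)))

          -- With no price missing all components are served, so the charging argument applies to
          -- the whole graph.
          unchanged : (∀ l → ¬ ⟦ gap 0F ⟧ (l ∷ []) m₃) → Kernelised G k m₃
          unchanged none = record
            { graph = graph₃
            ; equivalent = subst (λ c → HasP₂Packing G k ⇔ HasP₂Packing (induced G (survivors m₃)) (k ∸ c)) (sym t≡)
                (untouched-⇔ G k (Survival.survivors-unique m₃) (λ v → Survival.alive-survives m₃ (λ d → contradiction (trans (sym d) (d≡ v)) λ ())))
            ; small = ≤-trans (seven (survivors m₃) (Survival.survivors-unique m₃) (λ {v} _ _ → no-gap⇒taken full v)) (*-monoʳ-≤ 7 fits) }
            where
            full : ∀ l → ∃[ s ] ∃[ h ] price s h ≡ suc (toℕ l)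
            full l with check (top 0F 0F) (l ∷ []) m₂ | check (top 1F 0F) (l ∷ []) m₂ | check (top 2F 0F) (l ∷ []) m₂
            ... | yes p | _ | _ = 0F , top⇒ 0F l p
            ... | no _ | yes p | _ = 1F , top⇒ 1F l p
            ... | no _ | no _ | yes p = 2F , top⇒ 2F l p
            ... | no a | no b | no c = contradiction (form-≡ (gap 0F) (l ∷ []) {m₂} {m₃} (sym r≡) (a , b , c)) (none l)

          module _ (l : V) (g : ⟦ gap 0F ⟧ (l ∷ []) m₃) where
            private
              gap-l : ∀ s h → price s h ≢ suc (toℕ l)
              gap-l s h e = refute s (⇒top s l h e) (form-≡ (gap 0F) (l ∷ []) {m₃} {m₂} r≡ g)
                where
                refute : ∀ s → ⟦ top s 0F ⟧ (l ∷ []) m₂ → ¬ ⟦ gap 0F ⟧ (l ∷ []) m₂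
                refute 0F p (a , b , c) = a p
                refute 1F p (a , b , c) = b p
                refute 2F p (a , b , c) = c p

            open Gap l gap-l

            private
              ρ : V → Vec V 2
              ρ v = v ∷ l ∷ []

              head⇒ : ∀ {v} → ⟦ head ⟧ (ρ v) m₂ → H v
              head⇒ (inj₁ r)        = 0F , raised⇒ r
              head⇒ (inj₂ (inj₁ r)) = 1F , raised⇒ r
              head⇒ (inj₂ (inj₂ r)) = 2F , raised⇒ r

              ⇒head : ∀ {v} → H v → ⟦ head ⟧ (ρ v) m₂
              ⇒head (0F , p) = inj₁ (⇒raised p)
              ⇒head (1F , p) = inj₂ (inj₁ (⇒raised p))
              ⇒head (2F , p) = inj₂ (inj₂ (⇒raised p))

              reached⇒ : ∀ s {v} → ⟦ reached s ⟧ (ρ v) m₂ → Reached v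
              reached⇒ s (h , y , a , inj₁ e , r) = s , h , y , a , inj₁ e , raised⇒ r
              reached⇒ s (h , y , a , inj₂ e , r) = s , h , y , a , inj₂ (to-E base e) , raised⇒ r

              ⇒reached : ∀ {v} → (c : Reached v) → ⟦ reached (proj₁ c) ⟧ (ρ v) m₂
              ⇒reached (s , h , y , a , inj₁ e , p) = h , y , a , inj₁ e , ⇒raised p
              ⇒reached (s , h , y , a , inj₂ e , p) = h , y , a , inj₂ (from-E base e) , ⇒raised p

              taken⇒ : ∀ s {v} → ⟦ taken s 0F ⟧ (ρ v) m₂ → Taken m₂ v
              taken⇒ s (h , y , a , inj₁ e) = s , h , y , a , inj₁ e
              taken⇒ s (h , y , a , inj₂ e) = s , h , y , a , inj₂ (to-E base e)

              ⇒taken : ∀ {v} → (c : Taken m₂ v) → ⟦ taken (proj₁ c) 0F ⟧ (ρ v) m₂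
              ⇒taken (s , h , y , a , inj₁ e) = h , y , a , inj₁ e
              ⇒taken (s , h , y , a , inj₂ e) = h , y , a , inj₂ (from-E base e)

              tail⇒ : ∀ {v} → ⟦ tail ⟧ (ρ v) m₂ → C v
              tail⇒ {v} (o , inj₁ (a , b , c)) = to-Out base o , inj₁ untaken
                where
                untaken : ¬ Taken m₂ v
                untaken t@(0F , _) = a (⇒taken t)
                untaken t@(1F , _) = b (⇒taken t)
                untaken t@(2F , _) = c (⇒taken t)
              tail⇒ (o , inj₂ (inj₁ r))        = to-Out base o , inj₂ (reached⇒ 0F r)
              tail⇒ (o , inj₂ (inj₂ (inj₁ r))) = to-Out base o , inj₂ (reached⇒ 1F r)
              tail⇒ (o , inj₂ (inj₂ (inj₂ r))) = to-Out base o , inj₂ (reached⇒ 2F r)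

              ⇒tail : ∀ {v} → C v → ⟦ tail ⟧ (ρ v) m₂
              ⇒tail (o , inj₁ nt) = from-Out base o , inj₁ ((λ t → nt (taken⇒ 0F t)) , (λ t → nt (taken⇒ 1F t)) , (λ t → nt (taken⇒ 2F t)))
              ⇒tail (o , inj₂ r@(0F , _)) = from-Out base o , inj₂ (inj₁ (⇒reached r))
              ⇒tail (o , inj₂ r@(1F , _)) = from-Out base o , inj₂ (inj₂ (inj₁ (⇒reached r)))
              ⇒tail (o , inj₂ r@(2F , _)) = from-Out base o , inj₂ (inj₂ (inj₂ (⇒reached r)))

            cut : Kernelised G k (proj₂ (eval cutCrown (l ∷ []) m₃))
            cut = record
              { graph = λ i j → trans (cong (λ R → R Eᵣ i j) r≡₆) (Base.graph base i j)
              ; equivalent = subst (λ c → HasP₂Packing G k ⇔ HasP₂Packing (induced G (survivors m₆)) c) (sym k'≡)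
                  (gap-⇔ survivors-unique (λ v∈ → (λ h → survivor-alive v∈ (dead-H h)) , (λ c → survivor-alive v∈ (dead-C c)))
                    (λ nh nc → alive-survives λ d → [ nh , nc ]′ (dead⇒ d)))
              ; small = ≤-trans (seven (survivors m₆) survivors-unique served) (*-monoʳ-≤ 7 fits) }
              where
              m₄ m₅ m₆ : M
              m₄ = proj₂ (eval (forAll head (kill 0F)) (l ∷ []) m₃)
              m₅ = proj₂ (eval (forAll head (tick true)) (l ∷ []) m₄)
              m₆ = proj₂ (eval (forAll tail (kill 0F)) (l ∷ []) m₅)
              open Survival m₆
              k₄ : Killed (λ i → ⟦ head ⟧ (ρ i) m₃) m₃ m₄
              k₄ = forAll-kill head (l ∷ []) m₃
              t≡₄ : ticks m₄ true ≡ 0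
              t≡₄ = trans (cong (λ t → t true) (Killed.ticks≡ k₄)) t≡
              k₅ : Ticked (count (λ i → check head (ρ i) m₄) (allFin n)) m₄ m₅
              k₅ = forAll-tick head (l ∷ []) m₄ (subst (_≤ k) (sym t≡₄) z≤n)
              k₆ : Killed (λ i → ⟦ tail ⟧ (ρ i) m₅) m₅ m₆
              k₆ = forAll-kill tail (l ∷ []) m₅
              r≡₄ : rels m₄ ≡ rels m₂
              r≡₄ = trans (Killed.rels≡ k₄) r≡
              r≡₅ : rels m₅ ≡ rels m₂
              r≡₅ = trans (Ticked.rels≡ k₅) r≡₄
              r≡₆ : rels m₆ ≡ rels m₂
              r≡₆ = trans (Killed.rels≡ k₆) r≡₅
              c : ℕ
              c = count (λ i → check head (ρ i) m₄) (allFin n)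
              k'≡ : k ∸ ticks m₆ true ≡ k ∸ count H? (allFin n)
              k'≡ = trans (cong (k ∸_) (trans (cong (λ t → t true) (Killed.ticks≡ k₆)) (Ticked.ticks-true k₅)))
                (trans (∸-⊓ k (ticks m₄ true + c)) (cong (k ∸_) (trans (cong (_+ c) t≡₄)
                  (count-≡ (λ i → check head (ρ i) m₄) H? (allFin n)
                    (λ i p → head⇒ (form-≡ head (ρ i) {m₄} {m₂} r≡₄ p)) (λ i p → form-≡ head (ρ i) {m₂} {m₄} (sym r≡₄) (⇒head p))))))
              dead-H : ∀ {v} → H v → dead m₆ v ≡ true
              dead-H {v} h = Killed.stays k₆ (trans (cong (λ d → d v) (Ticked.dead≡ k₅))
                (Killed.killed k₄ (form-≡ head (ρ v) {m₂} {m₃} (sym r≡) (⇒head h))))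
              dead-C : ∀ {v} → C v → dead m₆ v ≡ true
              dead-C {v} c = Killed.killed k₆ (form-≡ tail (ρ v) {m₂} {m₅} (sym r≡₅) (⇒tail c))
              dead⇒ : ∀ {v} → dead m₆ v ≡ true → H v ⊎ C v
              dead⇒ {v} d with Killed.kills k₆ d
              ... | inj₂ p = inj₂ (tail⇒ (form-≡ tail (ρ v) {m₅} {m₂} r≡₅ p))
              ... | inj₁ d₅ with Killed.kills k₄ (trans (cong (λ d → d v) (sym (Ticked.dead≡ k₅))) d₅)
              ... | inj₁ d₃ = contradiction (trans (sym d₃) (d≡ v)) λ ()
              ... | inj₂ p  = inj₁ (head⇒ (form-≡ head (ρ v) {m₃} {m₂} r≡ p))
              -- Unserved outside vertices belong to `C` and have been deleted.
              served : ∀ {v} → v ∈ survivors m₆ → Out v → Taken m₂ v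
              served {v} v∈ o with taken? v
              ... | yes t = t
              ... | no nt = contradiction (dead-C (o , inj₁ nt)) (survivor-alive v∈)

          reduced : Kernelised G k (proj₂ (eval removeCrown [] m₃))
          reduced = conclude (searches-any (λ i → eval (guard (gap 0F) cutCrown) (i ∷ [])) m₃
              (λ i → searches-guard (gap 0F) cutCrown (i ∷ []) m₃))
            where
            conclude : ∀ {o} → Searches o m₃ (λ ((l , _) : V × ⊤) → ⟦ gap 0F ⟧ (l ∷ []) m₃)
              (λ (l , _) → proj₂ (eval cutCrown (l ∷ []) m₃)) → Kernelised G k (proj₂ o)
            conclude (miss refl none)      = unchanged (λ l → none (l , tt))
            conclude (hit (l , _) g refl) = cut l g

        finished : Kernelised G k (proj₂ (eval (ite overflow eraseAll removeCrown) [] m₂))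
        finished with eval overflow [] m₂ | overflowed [] m₂ (subst (_≤ k) (sym (unticked₂ false)) z≤n)
        ... | true , m₃ | ov with Overflowed.verdict ov
        ... | inj₂ (() , _)
        ... | inj₁ (_ , big) = erased m₃ (Overflowed.rels≡ ov) (trans (Overflowed.ticks-true ov) (unticked₂ true))
              (subst (k <_) (trans (cong (_+ _) (unticked₂ false)) (used-count m₂ refl)) big)
        finished | false , m₃ | ov with Overflowed.verdict ov
        ... | inj₁ (() , _)
        ... | inj₂ (_ , fits) = reduced m₃ (Overflowed.rels≡ ov) (trans (Overflowed.ticks-true ov) (unticked₂ true))
              (λ v → trans (cong (λ d → d v) (Overflowed.dead≡ ov)) (alive₂ v))
              (subst (_≤ k) (trans (cong (_+ _) (unticked₂ false)) (used-count m₂ refl)) fits)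

      auction-start : Inv′ m₁
      auction-start = record
        { base = record { graph = λ a b → trans (old Eᵣ (λ ()) a b) refl ; packing = λ _ _ → refl ; unkilled = refl ; unticked = refl }
        ; price = λ _ _ → 0
        ; priced = λ s h l → old (prcᵣ s) (λ ()) h l
        ; price≤n = λ _ _ → z≤n
        ; suitable = λ {s} a → absurd s a
        ; single = λ {s} a → absurd s a
        ; once = λ {s} a → absurd s a
        ; sold = λ ()
        ; cheap = λ {s} a → absurd s a }
        where
        old : ∀ y → y ≢ Bᵣ → ∀ a b → rels m₁ y a b ≡ rels m₀ y a b
        old = same-rels (proj₁ inv₁)
        absurd : ∀ {A : Set} s {h x} → Asg m₁ s h x → A
        absurd s {h} {x} a = contradiction (trans (sym a) (old (asgᵣ s) (λ ()) h x)) λ ()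

      auctioned : Kernelised G k (proj₂ (eval (seq auction (ite overflow eraseAll removeCrown)) [] m₁))
      auctioned = let (iv , st) = auction-stable 1≤n [] m₁ auction-start in finished (proj₂ (eval auction [] m₁)) iv st

    start-inv : Inv m₀
    start-inv = frame-refl , record { disjoint = λ () ; classes = λ i → inj₁ λ _ () }

    kernelised : Kernelised G k (proj₂ (eval kernel [] m₀))
    kernelised = let (iv , st) = Search.localSearch-stable (λ _ _ → refl) 1≤n [] m₀ start-inv
                 in auctioned (proj₂ (eval localSearch [] m₀)) iv st

open import Defs using (Graph; adj; RunsTo; encode; P₂PackingKernel)
open TapeLayout using (startMem; module Mem)
open Execution using (survivors; induced; module Realisation)
open KernelProgram using (kernel)
open KernelCorrectness using (Kernelised; empty-kernelised; module Assembly)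
open Mem using (ticks)
open Realisation kernel

theorem3 : P₂PackingKernel (λ k → 7 * k)
theorem3 = machine , coefficient , degree , λ G k →
  let (m , final , ok) = result G k in
  induced G (survivors m) , k ∸ ticks m true
  , subst (RunsTo machine (encode G k) _) (remains-encode G k m (Kernelised.graph ok)) (machine-correct G k final)
  , Kernelised.equivalent ok , m∸n≤m k (ticks m true) , Kernelised.small ok
  where
  result : ∀ G k → ∃[ m ] (Final G k m × Kernelised G k m)
  result G k = by-size (Graph.n G ≟ 0)
    where
    by-size : Dec (Graph.n G ≡ 0) → ∃[ m ] (Final G k m × Kernelised G k m)
    by-size (yes n≡0) = startMem (adj G) , inj₁ (n≡0 , refl) , empty-kernelised G k n≡0
    by-size (no n≢0)  = _ , inj₂ (n≢0⇒n>0 n≢0 , refl) , Assembly.kernelised G k (n≢0⇒n>0 n≢0)
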